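{- There exists an absolute constant $c$ such that the following holds. Let $P$ be a finite poset with a unique minimum and a unique maximum, with $|P|=2^{k}$ for some nonnegative integer $k$, and with Dushnik–Miller dimension $d$. If $n\geq c\,d^{4}|P|^{4}$, then $2^{[n]}$ can be partitioned into copies of $P$.
   Context: $2^{[n]}$ is the power set of $[n]$ ordered by inclusion. A subset $Q'$ of a poset $Q$ is a copy of $P$ if the subposet induced on $Q'$ is isomorphic to $P$; a partition into copies of $P$ is a family of pairwise disjoint copies whose union is everything. The (Dushnik–Miller) dimension of $P$ is the smallest $d$ such that there are bijections $\pi_{1},\dots,\pi_{d}:P\to[|P|]$ with $p\leq_P q$ iff $\pi_i(p)\leq \pi_i(q)$ for all $i\in[d]$ (equivalently, the smallest $d$ such that some grid $[k]^{d}$ with the pointwise order contains a copy of $P$). -}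

module Defs where

open import Data.Nat using (ℕ; _≤_)
open import Data.Fin using (Fin)
open import Data.Fin.Subset using (Subset; _⊆_)
open import Data.Product using (Σ; ∃; _×_; _,_)
open import Relation.Binary.PropositionalEquality using (_≡_)
open import Relation.Binary.Structures using (IsPartialOrder)
open import Function.Definitions using (Injective; Surjective)
open import Function.Bundles using (_⇔_)
open import Level using (0ℓ)

-- A finite poset whose ground set is Fin size (up to relabelling, every finite poset).
record FinPoset : Set₁ where
  field
    size  : ℕ
    _≼_   : Fin size → Fin size → Set
    isPO  : IsPartialOrder _≡_ _≼_
open FinPoset public

-- Unique minimum / unique maximum (uniqueness follows from antisymmetry).
HasMinimum : FinPoset → Set
HasMinimum P = ∃ λ b → ∀ x → _≼_ P b x

HasMaximum : FinPoset → Set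
HasMaximum P = ∃ λ t → ∀ x → _≼_ P x t

Realizer : (P : FinPoset) → ℕ → Set
Realizer P d =
  Σ (Fin d → Fin (size P) → Fin (size P)) λ π →
    (∀ i → Injective _≡_ _≡_ (π i) × Surjective _≡_ _≡_ (π i)) ×
    (∀ p q → (_≼_ P p q) ⇔ (∀ i → Data.Fin._≤_ (π i p) (π i q)))

HasDimension : FinPoset → ℕ → Set
HasDimension P d = Realizer P d × (∀ e → Realizer P e → d ≤ e)

IsCopy : (P : FinPoset) (n : ℕ) → (Fin (size P) → Subset n) → Set
IsCopy P n f = Injective _≡_ _≡_ f × (∀ p q → (_≼_ P p q) ⇔ (f p ⊆ f q))

PartitionIntoCopies : (P : FinPoset) (n : ℕ) → Set
PartitionIntoCopies P n =
  Σ ℕ λ t → Σ (Fin t → Fin (size P) → Subset n) λ copy →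
    (∀ i → IsCopy P n (copy i)) ×
    (∀ i j p q → copy i p ≡ copy j q → (i ≡ j × p ≡ q)) ×
    (∀ S → ∃ λ i → ∃ λ p → copy i p ≡ S)

{-# OPTIONS --safe #-}
-- Read false as an opening and true as a closing bracket.  The unmatched letters of a word are true
-- up to some position and false afterwards, so moving that position gives a chain; stopping as soon
-- as a given number of unmatched letters has appeared, all chains get the same length.  A product
-- of one chain for each linear order of a realizer contains many disjoint copies of P, obtained by
-- shifting.  Not all points are covered, but in powers of this product, Hall's theorem assigns to every
-- uncovered point x and every short bit vector v a copy of its own whose bottom lies below x.
--
-- Now add the coordinates v and σ, where σ has exactly |P| values.  If v has many ones, it lies above a
-- copy of P × P.  The copy assigned to (x , v), multiplied by P × P, can be tiled again so as to
-- absorb the |P| uncovered points (x , v , σ): they become tops of copies, and the |P| tops which they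
-- displace form a further copy.  If v has few ones, the order dual argument applies.

module Submission where

open import Data.Bool using (Bool; true; false)
open import Data.Empty using (⊥; ⊥-elim)
open import Data.Fin using (Fin; zero; suc; combine; remQuot; inject≤; toℕ; fromℕ<)
open import Data.List using (List; []; _∷_; length)
open import Data.Maybe using (Maybe; just; nothing)
open import Data.Maybe.Properties using (just-injective)
open import Data.Nat using (ℕ; zero; suc; z≤n; s≤s; _+_; _*_; _^_; _∸_; ⌊_/2⌋)
open import Data.Nat.Tactic.RingSolver using (solve-∀)
open import Data.Product using (∃; _×_; _,_; proj₁; proj₂; ∃₂)
open import Data.Sum using (_⊎_; inj₁; inj₂)
open import Data.Unit using (⊤; tt)
open import Data.Vec using (Vec; []; _∷_; _++_)
open import Function.Base using (_∘_; flip)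
open import Function.Bundles using (_⇔_; mk⇔; Equivalence)
open import Relation.Binary.Definitions using (DecidableEquality)
open import Relation.Binary.PropositionalEquality using (_≡_; _≢_; refl; sym; trans; cong; cong₂; subst; subst₂)
open import Relation.Nullary using (¬_; Dec; yes; no; does)
open import Relation.Nullary.Decidable using (_×-dec_)
import Data.Bool as Bool
import Data.Bool.Properties as Boolₚ
import Data.Fin as Fin
import Data.Fin.Properties as Finₚ
import Data.List.Properties as Listₚ
import Data.List.Relation.Binary.Pointwise as LPW
import Data.Nat as ℕ
import Data.Nat.Properties as ℕₚ
import Data.Sum.Properties as Sumₚ
import Data.Vec as Vec
import Data.Vec.Properties as Vecₚ
import Data.Vec.Relation.Binary.Pointwise.Inductive as PW

-- Sizes are compared through `Spread`: an injection of points with one of a labels into lower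
-- points with one of b codes. If a ≥ b, the labels and codes cancel, and Hall's theorem gives an
-- injective choice of lower points. Only the ratio a / b matters. It multiplies under composition
-- and products, while in powers of a tiled cube the labels of the coordinates add up, so any
-- positive ratio can be amplified.
--
-- With s = |P|, an uncovered word reaches a chain with ratio 1/4, and 16 d such words raise this to
-- 4 d. This is enough for the d shifted chains together to lose only a factor 2. The chain that
-- records the role costs a further 5 s. From the ratio 1 / (10 s), a power with 20 s factors makes
-- 2, which is one bit of v.
--
-- The vector v needs 4 s bits: P × P embeds into the subsets of a set of size 2 s, and either the
-- ones or the zeros of v number at least 2 s. The bound multiplies 4 s, 20 s, d, 16 d and the word
-- length, which is of order (d s)². The power of two enters through σ: a Boolean coordinate must
-- have exactly s values, one for each row that receives an uncovered point.

-- Hall's theorem, as cancellation of a common factor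

module Hall where

  open import Data.Nat using (_<_)
  open import Relation.Nullary using (¬?)

  module _ {Z : Set} (_≟Z_ : DecidableEquality Z) where

    -- Read as a bipartite multigraph with an edge from `i` to `proj₁ (Φ i x)` for each `x`: every
    -- left vertex has b edges and injectivity leaves at most b at a right vertex, which is Hall's
    -- condition by counting.
    Cancellable : (n b : ℕ) → (Fin n → Fin b → Z × Fin b) → Set
    Cancellable n b Φ = ∀ {i j x y} → Φ i x ≡ Φ j y → i ≡ j × x ≡ y

    record Matching {n b} (Φ : Fin n → Fin b → Z × Fin b) : Set where
      field
        match     : Fin n → Z
        option    : ∀ i → ∃ λ x → proj₁ (Φ i x) ≡ match i
        injective : ∀ {i j} → match i ≡ match j → i ≡ j

    private
      update : ∀ {n} → (Fin n → Z) → Fin n → Z → Fin n → Z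
      update g a z i with i Finₚ.≟ a
      ... | yes _ = z
      ... | no _  = g i

      update-≢ : ∀ {n} (g : Fin n → Z) {a i} z → i ≢ a → update g a z i ≡ g i
      update-≢ g {a} {i} z i≢a with i Finₚ.≟ a
      ... | yes p = ⊥-elim (i≢a p)
      ... | no _  = refl

    module _ {n b : ℕ} (Φ : Fin (suc n) → Fin (suc b) → Z × Fin (suc b))
             (Φ-inj : Cancellable (suc n) (suc b) Φ)
             (old : Matching {n} {suc b} (λ i → Φ (suc i))) where

      open Matching old renaming (match to M; option to M-option; injective to M-injective)

      private
        V = Fin (suc n)

        -- A matching of all left vertices but a, still using only right vertices of M and
        -- agreeing with M outside the set R of vertices reached so far.
        record Missing (R : V → Set) (a : V) : Set where
          field
            g      : V → Z
            option : ∀ i → i ≢ a → ∃ λ x → proj₁ (Φ i x) ≡ g i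
            inj    : ∀ {i j} → i ≢ a → j ≢ a → g i ≡ g j → i ≡ j
            image  : ∀ i → i ≢ a → ∃ λ i′ → M i′ ≡ g i
            agree  : ∀ i → ¬ R (suc i) → g (suc i) ≡ M i

        Reached : ∀ {m} → (Fin (suc m) → V) → V → Set
        Reached α v = ∃ λ j → α j ≡ v

        start : Missing (Reached {0} (λ _ → zero)) zero
        start = record
          { g      = λ { zero → proj₁ (Φ zero zero) ; (suc i) → M i }
          ; option = λ { zero ne → ⊥-elim (ne refl) ; (suc i) _ → M-option i }
          ; inj    = λ { {zero} ne _ _ → ⊥-elim (ne refl)
                       ; {suc _} {zero} _ ne _ → ⊥-elim (ne refl)
                       ; {suc i} {suc j} _ _ e → cong suc (M-injective e) }
          ; image  = λ { zero ne → ⊥-elim (ne refl) ; (suc i) _ → i , refl }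
          ; agree  = λ _ _ → refl
          }

        -- Alternating search from the new vertex `zero`. For each of the m + 1 reached vertices a
        -- matching that omits just this vertex is carried along, in place of an alternating path.
        -- An edge that leaves the reached part ends at a right vertex outside M, which completes
        -- the matching, or reaches one more left vertex; `fuel` counts those not yet reached.
        grow : ∀ fuel m → m + fuel ≡ n → (α : Fin (suc m) → V) →
               (∀ {i j} → α i ≡ α j → i ≡ j) → α zero ≡ zero →
               (∀ j → Missing (Reached α) (α j)) → Matching Φ
        grow fuel m m+f≡n α α-inj α0 miss with Finₚ.any? exit?
          where
          exit? : (j : Fin (suc m)) → Dec (∃ λ x → ¬ (∃ λ i → M i ≡ proj₁ (Φ (α j) x) × Reached α (suc i)))
          exit? j = Finₚ.any? λ x → ¬? (Finₚ.any? λ i → (M i ≟Z proj₁ (Φ (α j) x)) ×-dec Finₚ.any? λ j′ → α j′ Finₚ.≟ suc i)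
        -- All (m + 1) · (b + 1) edges of the reached vertices would end at the m right vertices
        -- that M assigns to reached vertices, where there are only m · (b + 1) codes.
        ... | no stuck = ⊥-elim (crowded (Finₚ.pigeonhole m*b< h))
          where
          inside : ∀ j x → ∃ λ i → M i ≡ proj₁ (Φ (α j) x) × Reached α (suc i)
          inside j x with Finₚ.any? (λ i → (M i ≟Z proj₁ (Φ (α j) x)) ×-dec Finₚ.any? λ j′ → α j′ Finₚ.≟ suc i)
          ... | yes p = p
          ... | no ¬p = ⊥-elim (stuck (j , x , ¬p))
          lower : ∀ {i} → Reached α (suc i) → Fin m
          lower (zero , e) = ⊥-elim (Finₚ.0≢1+n (trans (sym α0) e))
          lower (suc j , e) = j
          lower-inj : ∀ {i i′} (p : Reached α (suc i)) (p′ : Reached α (suc i′)) → lower p ≡ lower p′ → i ≡ i′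
          lower-inj (zero , e) _ _ = ⊥-elim (Finₚ.0≢1+n (trans (sym α0) e))
          lower-inj (suc j , e) (zero , e′) _ = ⊥-elim (Finₚ.0≢1+n (trans (sym α0) e′))
          lower-inj (suc j , e) (suc .j , e′) refl = Finₚ.suc-injective (trans (sym e) e′)
          h : Fin (suc m * suc b) → Fin (m * suc b)
          h w = let j , x = remQuot {suc m} (suc b) w
                    _ , _ , r = inside j x
                in combine (lower r) (proj₂ (Φ (α j) x))
          m*b< : m * suc b < suc m * suc b
          m*b< = ℕₚ.m<n+m (m * suc b) (s≤s z≤n)
          crowded : (∃ λ u → ∃ λ w → Data.Fin._<_ u w × h u ≡ h w) → ⊥
          crowded (u , w , u<w , eq) = Finₚ.<⇒≢ u<w (trans (sym (Finₚ.combine-remQuot {suc m} (suc b) u))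
              (trans (cong₂ combine (α-inj (proj₁ same)) (proj₂ same)) (Finₚ.combine-remQuot {suc m} (suc b) w)))
            where
            j x j′ x′ : _
            j = proj₁ (remQuot {suc m} (suc b) u)
            x = proj₂ (remQuot {suc m} (suc b) u)
            j′ = proj₁ (remQuot {suc m} (suc b) w)
            x′ = proj₂ (remQuot {suc m} (suc b) w)
            cs = Finₚ.combine-injective (lower (proj₂ (proj₂ (inside j x)))) _ (lower (proj₂ (proj₂ (inside j′ x′)))) _ eq
            same-i : proj₁ (inside j x) ≡ proj₁ (inside j′ x′)
            same-i = lower-inj (proj₂ (proj₂ (inside j x))) (proj₂ (proj₂ (inside j′ x′))) (proj₁ cs)
            same : α j ≡ α j′ × x ≡ x′
            same = Φ-inj (cong₂ _,_ (trans (sym (proj₁ (proj₂ (inside j x))))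
                                      (trans (cong M same-i) (proj₁ (proj₂ (inside j′ x′))))) (proj₂ cs))
        ... | yes (j , x , out) with Finₚ.any? (λ i → M i ≟Z proj₁ (Φ (α j) x))
        ...   | no free = record { match = f ; option = f-option ; injective = f-inj }
          where
          open Missing (miss j)
          z = proj₁ (Φ (α j) x)
          f : V → Z
          f = update g (α j) z
          f-option : ∀ i → ∃ λ x → proj₁ (Φ i x) ≡ f i
          f-option i with i Finₚ.≟ α j
          ... | yes refl = x , refl
          ... | no i≢ = option i i≢
          f-inj : ∀ {i i′} → f i ≡ f i′ → i ≡ i′
          f-inj {i} {i′} e with i Finₚ.≟ α j | i′ Finₚ.≟ α j
          ... | yes refl | yes refl = refl
          ... | yes refl | no ne = ⊥-elim (free (proj₁ (image i′ ne) , trans (proj₂ (image i′ ne)) (sym e)))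
          ... | no ne | yes refl = ⊥-elim (free (proj₁ (image i ne) , trans (proj₂ (image i ne)) e))
          ... | no ne | no ne′ = inj ne ne′ e
        ...   | yes (i₁ , Mi₁) = continue fuel m+f≡n
          where
          z = proj₁ (Φ (α j) x)
          fresh : ¬ Reached α (suc i₁)
          fresh r = out (i₁ , Mi₁ , r)
          α′ : Fin (suc (suc m)) → V
          α′ zero = zero
          α′ (suc zero) = suc i₁
          α′ (suc (suc j)) = α (suc j)
          widen : ∀ {v} → Reached α v → Reached α′ v
          widen (zero , e) = zero , trans (sym α0) e
          widen (suc j , e) = suc (suc j) , e
          α′-inj : ∀ {i j} → α′ i ≡ α′ j → i ≡ j
          α′-inj {zero} {zero} e = refl
          α′-inj {zero} {suc zero} ()
          α′-inj {zero} {suc (suc j)} e with () ← α-inj {zero} {suc j} (trans α0 e)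
          α′-inj {suc zero} {zero} ()
          α′-inj {suc zero} {suc zero} e = refl
          α′-inj {suc zero} {suc (suc j)} e = ⊥-elim (fresh (suc j , sym e))
          α′-inj {suc (suc i)} {zero} e with () ← α-inj {suc i} {zero} (trans e (sym α0))
          α′-inj {suc (suc i)} {suc zero} e = ⊥-elim (fresh (suc i , e))
          α′-inj {suc (suc i)} {suc (suc j)} e with refl ← α-inj {suc i} {suc j} e = refl
          lift : ∀ {a} → Missing (Reached α) a → Missing (Reached α′) a
          lift p = record { g = g ; option = option ; inj = inj ; image = image
                          ; agree = λ i ¬r → agree i (λ r → ¬r (widen r)) }
            where open Missing p
          -- By `agree`, the matching that omits `α j` still assigns `z` to `suc i₁`. Handing `z`
          -- over to `α j` leaves `suc i₁` as the omitted vertex.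
          new : Missing (Reached α′) (suc i₁)
          new = record { g = f ; option = f-option ; inj = f-inj ; image = f-image ; agree = f-agree }
            where
            open Missing (miss j)
            f : V → Z
            f = update g (α j) z
            αj≢ : suc i₁ ≢ α j
            αj≢ e = fresh (j , sym e)
            g-i₁ : g (suc i₁) ≡ z
            g-i₁ = trans (agree i₁ fresh) Mi₁
            f-option : ∀ i → i ≢ suc i₁ → ∃ λ x → proj₁ (Φ i x) ≡ f i
            f-option i _ with i Finₚ.≟ α j
            ... | yes refl = x , refl
            ... | no i≢ = option i i≢
            f-inj : ∀ {i i′} → i ≢ suc i₁ → i′ ≢ suc i₁ → f i ≡ f i′ → i ≡ i′
            f-inj {i} {i′} n₁ n₂ e with i Finₚ.≟ α j | i′ Finₚ.≟ α j
            ... | yes refl | yes refl = refl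
            ... | yes refl | no ne = ⊥-elim (n₂ (inj ne αj≢ (trans (sym e) (sym g-i₁))))
            ... | no ne | yes refl = ⊥-elim (n₁ (inj ne αj≢ (trans e (sym g-i₁))))
            ... | no ne | no ne′ = inj ne ne′ e
            f-image : ∀ i → i ≢ suc i₁ → ∃ λ i′ → M i′ ≡ f i
            f-image i _ with i Finₚ.≟ α j
            ... | yes refl = i₁ , Mi₁
            ... | no i≢ = image i i≢
            f-agree : ∀ i → ¬ Reached α′ (suc i) → f (suc i) ≡ M i
            f-agree i ¬r = trans (update-≢ g z (λ e → ¬r (widen (j , sym e)))) (agree i (λ r → ¬r (widen r)))
          miss′ : ∀ j → Missing (Reached α′) (α′ j)
          miss′ zero = subst (Missing (Reached α′)) α0 (lift (miss zero))
          miss′ (suc zero) = new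
          miss′ (suc (suc j)) = lift (miss (suc j))
          continue : ∀ fuel → m + fuel ≡ n → Matching Φ
          continue zero e = ⊥-elim (ℕₚ.<-irrefl refl (ℕₚ.≤-trans (Finₚ.injective⇒≤ α′-inj)
                               (s≤s (ℕₚ.≤-reflexive (sym (trans (sym (ℕₚ.+-identityʳ m)) e))))))
          continue (suc fuel) e = grow fuel (suc m) (trans (sym (ℕₚ.+-suc m fuel)) e) α′ α′-inj refl miss′

      augment : Matching Φ
      augment = grow n 0 refl (λ _ → zero) (λ { {zero} {zero} _ → refl }) refl (λ { zero → start })

    cancel : ∀ n b (Φ : Fin n → Fin (suc b) → Z × Fin (suc b)) → Cancellable n (suc b) Φ → Matching Φ
    cancel zero b Φ inj = record { match = λ () ; option = λ () ; injective = λ { {()} } }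
    cancel (suc n) b Φ inj = augment Φ inj (cancel n b (λ i → Φ (suc i)) λ e →
      Finₚ.suc-injective (proj₁ (inj e)) , proj₂ (inj e))

-- Boolean cubes, partial tilings and the counting of labels

module Cubes where

  open import Data.Fin using (splitAt; join)
  open import Data.Bool using (not)
  open import Data.Vec using (take; drop)
  open import Data.Vec.Relation.Binary.Pointwise.Inductive using (Pointwise; []; _∷_)
  open import Relation.Nullary.Decidable using (map′)

  infix 4 _⊑_
  _⊑_ : ∀ {n} → Vec Bool n → Vec Bool n → Set
  _⊑_ = Pointwise Bool._≤_

  ⊑-refl : ∀ {n} {v : Vec Bool n} → v ⊑ v
  ⊑-refl = PW.refl Bool.b≤b

  ⊑-trans : ∀ {n} {u v w : Vec Bool n} → u ⊑ v → v ⊑ w → u ⊑ w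
  ⊑-trans = PW.trans Boolₚ.≤-trans

  ⊑-antisym : ∀ {n} {u v : Vec Bool n} → u ⊑ v → v ⊑ u → u ≡ v
  ⊑-antisym [] [] = refl
  ⊑-antisym (p ∷ ps) (q ∷ qs) = cong₂ _∷_ (Boolₚ.≤-antisym p q) (⊑-antisym ps qs)

  -- A poset with a chosen isomorphism to a Boolean lattice. With a free choice of carrier, points
  -- of products are pairs and the dual order is a cube on the same points.
  record Cube : Set₁ where
    infix 4 _≤_
    field
      Carrier   : Set
      _≤_       : Carrier → Carrier → Set
      dim       : ℕ
      to        : Carrier → Vec Bool dim
      from      : Vec Bool dim → Carrier
      from-to   : ∀ x → from (to x) ≡ x
      to-from   : ∀ v → to (from v) ≡ v
      to-mono   : ∀ {x y} → x ≤ y → to x ⊑ to y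
      to-cancel : ∀ {x y} → to x ⊑ to y → x ≤ y

    to-injective : ∀ {x y} → to x ≡ to y → x ≡ y
    to-injective e = trans (sym (from-to _)) (trans (cong from e) (from-to _))

    ≤-refl : ∀ {x} → x ≤ x
    ≤-refl = to-cancel ⊑-refl

    ≤-trans : ∀ {x y z} → x ≤ y → y ≤ z → x ≤ z
    ≤-trans p q = to-cancel (⊑-trans (to-mono p) (to-mono q))

    ≤-antisym : ∀ {x y} → x ≤ y → y ≤ x → x ≡ y
    ≤-antisym p q = to-injective (⊑-antisym (to-mono p) (to-mono q))

    infix 4 _≟_
    _≟_ : DecidableEquality Carrier
    x ≟ y = map′ to-injective (cong to) (Vecₚ.≡-dec Boolₚ._≟_ (to x) (to y))

  bitIndex : Bool → Fin 2
  bitIndex false = zero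
  bitIndex true  = suc zero

  indexBit : Fin 2 → Bool
  indexBit zero       = false
  indexBit (suc zero) = true

  rank : ∀ {n} → Vec Bool n → Fin (2 ^ n)
  rank []      = zero
  rank {suc n} (b ∷ v) = combine (bitIndex b) (rank v)

  unrank : ∀ {n} → Fin (2 ^ n) → Vec Bool n
  unrank {zero}  _ = []
  unrank {suc n} i = indexBit (proj₁ (remQuot {2} (2 ^ n) i)) ∷ unrank (proj₂ (remQuot {2} (2 ^ n) i))

  unrank-rank : ∀ {n} (v : Vec Bool n) → unrank (rank v) ≡ v
  unrank-rank [] = refl
  unrank-rank {suc n} (b ∷ v) =
    trans (cong (λ (i , j) → indexBit i ∷ unrank j) (Finₚ.remQuot-combine {2} {2 ^ n} (bitIndex b) (rank v)))
          (cong₂ _∷_ (indexBit-bitIndex b) (unrank-rank v))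
    where
    indexBit-bitIndex : ∀ b → indexBit (bitIndex b) ≡ b
    indexBit-bitIndex false = refl
    indexBit-bitIndex true  = refl

  rank-unrank : ∀ {n} (i : Fin (2 ^ n)) → rank {n} (unrank i) ≡ i
  rank-unrank {zero} zero = refl
  rank-unrank {suc n} i =
    trans (cong₂ combine (bitIndex-indexBit (proj₁ (remQuot {2} (2 ^ n) i))) (rank-unrank {n} (proj₂ (remQuot {2} (2 ^ n) i))))
          (Finₚ.combine-remQuot {2} (2 ^ n) i)
    where
    bitIndex-indexBit : ∀ i → bitIndex (indexBit i) ≡ i
    bitIndex-indexBit zero       = refl
    bitIndex-indexBit (suc zero) = refl

  module _ (C : Cube) where
    open Cube C

    points : ℕ
    points = 2 ^ dim

    code : Carrier → Fin points
    code x = rank (to x)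

    decode : Fin points → Carrier
    decode i = from (unrank i)

    decode-code : ∀ x → decode (code x) ≡ x
    decode-code x = trans (cong from (unrank-rank (to x))) (from-to x)

    code-decode : ∀ i → code (decode i) ≡ i
    code-decode i = trans (cong rank (to-from (unrank i))) (rank-unrank {dim} i)

    search : ∀ {Q : Carrier → Set} → (∀ x → Dec (Q x)) → Dec (∃ Q)
    search {Q} Q? = map′ (λ (i , q) → decode i , q)
                     (λ (x , q) → code x , subst Q (sym (decode-code x)) q)
                     (Finₚ.any? (λ i → Q? (decode i)))

  vecC : ℕ → Cube
  vecC n = record
    { Carrier = Vec Bool n ; _≤_ = _⊑_ ; dim = n ; to = λ v → v ; from = λ v → v
    ; from-to = λ _ → refl ; to-from = λ _ → refl ; to-mono = λ p → p ; to-cancel = λ p → p }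

  unitC : Cube
  unitC = record
    { Carrier = ⊤ ; _≤_ = λ _ _ → ⊤ ; dim = 0 ; to = λ _ → [] ; from = λ _ → tt
    ; from-to = λ _ → refl ; to-from = λ { [] → refl } ; to-mono = λ _ → [] ; to-cancel = λ _ → tt }

  infixr 3 _×C_
  _×C_ : Cube → Cube → Cube
  C ×C D = record
    { Carrier = C.Carrier × D.Carrier
    ; _≤_ = λ (x , y) (x′ , y′) → x C.≤ x′ × y D.≤ y′
    ; dim = C.dim + D.dim
    ; to = λ (x , y) → C.to x ++ D.to y
    ; from = λ v → C.from (take C.dim v) , D.from (drop C.dim v)
    ; from-to = λ (x , y) → let e = Vecₚ.++-injective (take C.dim (C.to x ++ D.to y)) (C.to x) (Vecₚ.take++drop≡id C.dim (C.to x ++ D.to y))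
        in cong₂ _,_ (trans (cong C.from (proj₁ e)) (C.from-to x)) (trans (cong D.from (proj₂ e)) (D.from-to y))
    ; to-from = λ v → trans (cong₂ _++_ (C.to-from _) (D.to-from _)) (Vecₚ.take++drop≡id C.dim v)
    ; to-mono = λ (p , q) → PW.++⁺ (C.to-mono p) (D.to-mono q)
    ; to-cancel = λ {(x , _)} {(x′ , _)} p → C.to-cancel (PW.++ˡ⁻ (C.to x) (C.to x′) p) , D.to-cancel (PW.++ʳ⁻ (C.to x) (C.to x′) p)
    }
    where
    module C = Cube C
    module D = Cube D

  infixl 4 _^C_
  _^C_ : Cube → ℕ → Cube
  C ^C zero  = unitC
  C ^C suc n = C ×C (C ^C n)

  dim-^C : ∀ C n → Cube.dim (C ^C n) ≡ n * Cube.dim C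
  dim-^C C zero    = refl
  dim-^C C (suc n) = cong (Cube.dim C +_) (dim-^C C n)

  complement : ∀ {n} → Vec Bool n → Vec Bool n
  complement = Vec.map not

  complement-involutive : ∀ {n} (v : Vec Bool n) → complement (complement v) ≡ v
  complement-involutive []      = refl
  complement-involutive (b ∷ v) = cong₂ _∷_ (Boolₚ.not-involutive b) (complement-involutive v)

  complement-anti : ∀ {n} {v w : Vec Bool n} → v ⊑ w → complement w ⊑ complement v
  complement-anti [] = []
  complement-anti (Bool.f≤t ∷ ps) = Bool.f≤t ∷ complement-anti ps
  complement-anti (Bool.b≤b ∷ ps) = Bool.b≤b ∷ complement-anti ps

  opC : Cube → Cube
  opC C = record
    { Carrier = Carrier ; _≤_ = flip _≤_ ; dim = dim
    ; to = complement ∘ to ; from = from ∘ complement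
    ; from-to = λ x → trans (cong from (complement-involutive (to x))) (from-to x)
    ; to-from = λ v → trans (cong complement (to-from (complement v))) (complement-involutive v)
    ; to-mono = λ p → complement-anti (to-mono p)
    ; to-cancel = λ {x} {y} p → to-cancel (subst₂ _⊑_ (complement-involutive (to y)) (complement-involutive (to x)) (complement-anti p))
    }
    where open Cube C

  -- Copies of the relation _≼_ in C, possibly not covering everything: loc x is the copy through x
  -- and the role of x in it.
  record Tiles {I : Set} (_≼_ : I → I → Set) (C : Cube) : Set₁ where
    open Cube C
    private X = Cube.Carrier C
    field
      J     : Set
      enc   : J → I → X
      loc   : X → Maybe (J × I)
      sound : ∀ {x j i} → loc x ≡ just (j , i) → enc j i ≡ x
      stay  : ∀ {x j i} → loc x ≡ just (j , i) → ∀ i′ → loc (enc j i′) ≡ just (j , i′)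
      order : ∀ {x j i} → loc x ≡ just (j , i) → ∀ p q → p ≼ q ⇔ (enc j p ≤ enc j q)

    Free : X → Set
    Free x = loc x ≡ nothing

    Hits : (I → Set) → X → Set
    Hits G x = ∃₂ λ j i → loc x ≡ just (j , i) × G i

  opT : ∀ {I} {_≼_ : I → I → Set} {C} → Tiles _≼_ C → Tiles (flip _≼_) (opC C)
  opT t = record { J = J ; enc = enc ; loc = loc ; sound = sound ; stay = stay ; order = λ e p q → order e q p }
    where open Tiles t

  emptyT : ∀ {I} {_≼_ : I → I → Set} {C} → Tiles _≼_ C
  emptyT = record { J = ⊥ ; enc = λ () ; loc = λ _ → nothing ; sound = λ () ; stay = λ () ; order = λ () }

  module First {I : Set} {_≼_ : I → I → Set} {C D : Cube} (T : Tiles _≼_ C) (S : Tiles _≼_ D) where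
    private
      module C = Cube C
      module D = Cube D
      module T = Tiles T
      module S = Tiles S

      J : Set
      J = (T.J × D.Carrier) ⊎ (C.Carrier × S.J)

      enc : J → I → C.Carrier × D.Carrier
      enc (inj₁ (j , y)) i = T.enc j i , y
      enc (inj₂ (x , j)) i = x , S.enc j i

      loc₂ : C.Carrier → Maybe (S.J × I) → Maybe (J × I)
      loc₂ x (just (j , i)) = just (inj₂ (x , j) , i)
      loc₂ x nothing        = nothing

      loc₁ : C.Carrier → D.Carrier → Maybe (T.J × I) → Maybe (J × I)
      loc₁ x y (just (j , i)) = just (inj₁ (j , y) , i)
      loc₁ x y nothing        = loc₂ x (S.loc y)

      loc : C.Carrier × D.Carrier → Maybe (J × I)
      loc (x , y) = loc₁ x y (T.loc x)

    loc-inj₁ : ∀ {x y j i} → T.loc x ≡ just (j , i) → loc (x , y) ≡ just (inj₁ (j , y) , i)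
    loc-inj₁ {x} {y} e = cong (loc₁ x y) e

    loc-inj₂ : ∀ {x y j i} → T.loc x ≡ nothing → S.loc y ≡ just (j , i) → loc (x , y) ≡ just (inj₂ (x , j) , i)
    loc-inj₂ {x} {y} e e′ = trans (cong (loc₁ x y) e) (cong (loc₂ x) e′)

    loc-free : ∀ {x y} → loc (x , y) ≡ nothing → T.loc x ≡ nothing × S.loc y ≡ nothing
    loc-free {x} {y} e with T.loc x
    ... | nothing with S.loc y
    ...   | nothing = refl , refl

    private
      data Located (x : C.Carrier) (y : D.Carrier) (i : I) : J → Set where
        left  : ∀ {j} → T.loc x ≡ just (j , i) → Located x y i (inj₁ (j , y))
        right : ∀ {j} → T.loc x ≡ nothing → S.loc y ≡ just (j , i) → Located x y i (inj₂ (x , j))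

      located : ∀ {x y j i} → loc (x , y) ≡ just (j , i) → Located x y i j
      located {x} {y} e with T.loc x in eT
      located refl | just _ = left eT
      ... | nothing with S.loc y in eS
      located refl | nothing | just _ = right eT eS

      sound : ∀ {z j i} → loc z ≡ just (j , i) → enc j i ≡ z
      sound e with located e
      ... | left eT     = cong (_, _) (T.sound eT)
      ... | right _ eS  = cong (_ ,_) (S.sound eS)

      stay : ∀ {z j i} → loc z ≡ just (j , i) → ∀ i′ → loc (enc j i′) ≡ just (j , i′)
      stay e i′ with located e
      ... | left eT     = loc-inj₁ (T.stay eT i′)
      ... | right eT eS = loc-inj₂ eT (S.stay eS i′)

      order : ∀ {z j i} → loc z ≡ just (j , i) → ∀ p q → p ≼ q ⇔ Cube._≤_ (C ×C D) (enc j p) (enc j q)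
      order e p q with located e
      ... | left eT     = let o = T.order eT p q in mk⇔ (λ r → Equivalence.to o r , D.≤-refl) (λ r → Equivalence.from o (proj₁ r))
      ... | right _ eS  = let o = S.order eS p q in mk⇔ (λ r → C.≤-refl , Equivalence.to o r) (λ r → Equivalence.from o (proj₂ r))

    -- The first coordinate has priority and the second one is consulted only where the first is
    -- uncovered, so the two kinds of copies are disjoint. In a power, a point is uncovered only if
    -- all its coordinates are.
    first : Tiles _≼_ (C ×C D)
    first = record { J = J ; enc = enc ; loc = loc ; sound = sound ; stay = stay ; order = order }

  open First using (first)

  powT : ∀ {I} {_≼_ : I → I → Set} {C} → Tiles _≼_ C → ∀ n → Tiles _≼_ (C ^C n)
  powT t zero    = emptyT
  powT t (suc n) = first t (powT t n)

  -- An injection of pairs (point of D, one of a labels) into pairs (smaller point of T, one of b codes);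
  -- by the cancellation theorem its strength is the ratio a / b.
  record Spread (C : Cube) (D T : Cube.Carrier C → Set) (a b : ℕ) : Set where
    open Cube C
    field
      f      : ∀ x → D x → Fin a → Cube.Carrier C × Fin b
      below  : ∀ x dx i → proj₁ (f x dx i) ≤ x
      target : ∀ x dx i → T (proj₁ (f x dx i))
      inj    : ∀ {x y} dx dy {i j} → f x dx i ≡ f y dy j → x ≡ y × i ≡ j

  module _ {C : Cube} where
    open Cube C
    private X = Cube.Carrier C

    stayPut : ∀ {D : X → Set} a → Spread C D D a a
    stayPut a = record
      { f = λ x _ i → x , i ; below = λ _ _ _ → ≤-refl ; target = λ _ dx _ → dx
      ; inj = λ { _ _ refl → refl , refl } }

    weaken : ∀ {D D′ T T′ : X → Set} {a b b′} → (∀ {x} → D′ x → D x) → (∀ {x} → T x → T′ x) →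
             b ℕ.≤ b′ → Spread C D T a b → Spread C D′ T′ a b′
    weaken d t b≤b′ s = record
      { f = λ x dx i → let z , c = f x (d dx) i in z , inject≤ c b≤b′
      ; below = λ x dx i → below x (d dx) i
      ; target = λ x dx i → t (target x (d dx) i)
      ; inj = λ dx dy e → inj (d dx) (d dy) (cong₂ _,_ (cong proj₁ e) (Finₚ.inject≤-injective b≤b′ b≤b′ _ _ (cong proj₂ e))) }
      where open Spread s

    infixr 5 _⨾_
    _⨾_ : ∀ {D T T′ : X → Set} {a b a′ b′} → Spread C D T a b → Spread C T T′ a′ b′ → Spread C D T′ (a * a′) (b * b′)
    _⨾_ {a = a} {b} {a′} {b′} s s′ = record
      { f = λ x dx i → let i₁ , i₂ = remQuot {a} a′ i ; z , c = S.f x dx i₁ ; w , c′ = S′.f z (S.target x dx i₁) i₂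
                       in w , combine c c′
      ; below = λ x dx i → ≤-trans (S′.below _ _ _) (S.below _ _ _)
      ; target = λ x dx i → S′.target _ _ _
      ; inj = λ dx dy {i} {j} e →
          let e₁ = Finₚ.combine-injective _ _ _ _ (cong proj₂ e)
              e₂ = S′.inj _ _ (cong₂ _,_ (cong proj₁ e) (proj₂ e₁))
              e₃ = S.inj dx dy (cong₂ _,_ (proj₁ e₂) (proj₁ e₁))
          in proj₁ e₃ , trans (sym (Finₚ.combine-remQuot {a} a′ i))
               (trans (cong₂ combine (proj₂ e₃) (proj₂ e₂)) (Finₚ.combine-remQuot {a} a′ j)) }
      where
      module S = Spread s
      module S′ = Spread s′

    either : ∀ {D D₁ D₂ T : X → Set} {a b₁ b₂} → (∀ x → D x → D₁ x ⊎ D₂ x) →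
             Spread C D₁ T a b₁ → Spread C D₂ T a b₂ → Spread C D T a (b₁ + b₂)
    either {D} {D₁} {D₂} {T} {a} {b₁} {b₂} split s₁ s₂ = record
      { f = λ x dx i → g x (split x dx) i
      ; below = λ x dx → g-below x (split x dx)
      ; target = λ x dx → g-target x (split x dx)
      ; inj = λ dx dy → g-inj (split _ dx) (split _ dy) }
      where
      module S₁ = Spread s₁
      module S₂ = Spread s₂
      g : ∀ x → D₁ x ⊎ D₂ x → Fin a → X × Fin (b₁ + b₂)
      g x (inj₁ d) i = let z , c = S₁.f x d i in z , join b₁ b₂ (inj₁ c)
      g x (inj₂ d) i = let z , c = S₂.f x d i in z , join b₁ b₂ (inj₂ c)
      g-below : ∀ x d i → proj₁ (g x d i) ≤ x
      g-below x (inj₁ d) i = S₁.below x d i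
      g-below x (inj₂ d) i = S₂.below x d i
      g-target : ∀ x d i → T (proj₁ (g x d i))
      g-target x (inj₁ d) i = S₁.target x d i
      g-target x (inj₂ d) i = S₂.target x d i
      join-inj : ∀ {c c′ : Fin b₁ ⊎ Fin b₂} → join b₁ b₂ c ≡ join b₁ b₂ c′ → c ≡ c′
      join-inj {c} {c′} e = trans (sym (Finₚ.splitAt-join b₁ b₂ c)) (trans (cong (splitAt b₁) e) (Finₚ.splitAt-join b₁ b₂ c′))
      inj₁-inj : ∀ {c c′} → (inj₁ {B = Fin b₂} c) ≡ inj₁ c′ → c ≡ c′
      inj₁-inj refl = refl
      inj₂-inj : ∀ {c c′} → (inj₂ {A = Fin b₁} c) ≡ inj₂ c′ → c ≡ c′
      inj₂-inj refl = refl
      g-inj : ∀ {x y i j} d e → g x d i ≡ g y e j → x ≡ y × i ≡ j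
      g-inj (inj₁ d) (inj₁ e) q = S₁.inj d e (cong₂ _,_ (cong proj₁ q) (inj₁-inj (join-inj (cong proj₂ q))))
      g-inj (inj₁ d) (inj₂ e) q with () ← join-inj {inj₁ _} {inj₂ _} (cong proj₂ q)
      g-inj (inj₂ d) (inj₁ e) q with () ← join-inj {inj₂ _} {inj₁ _} (cong proj₂ q)
      g-inj (inj₂ d) (inj₂ e) q = S₂.inj d e (cong₂ _,_ (cong proj₁ q) (inj₂-inj (join-inj (cong proj₂ q))))

  infixr 4 _⊗_
  _⊗_ : ∀ {C C′ : Cube} {D T D′ T′ a b a′ b′} → Spread C D T a b → Spread C′ D′ T′ a′ b′ →
        Spread (C ×C C′) (λ (x , x′) → D x × D′ x′) (λ (x , x′) → T x × T′ x′) (a * a′) (b * b′)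
  _⊗_ {a = a} {b} {a′} {b′} s s′ = record
    { f = λ (x , x′) (dx , dx′) i → let i₁ , i₂ = remQuot {a} a′ i ; z , c = S.f x dx i₁ ; z′ , c′ = S′.f x′ dx′ i₂
                     in (z , z′) , combine c c′
    ; below = λ _ _ _ → S.below _ _ _ , S′.below _ _ _
    ; target = λ _ _ _ → S.target _ _ _ , S′.target _ _ _
    ; inj = λ (dx , dx′) (dy , dy′) {i} {j} e →
        let e₁ = Finₚ.combine-injective _ _ _ _ (cong proj₂ e)
            e₂ = S.inj dx dy (cong₂ _,_ (cong (proj₁ ∘ proj₁) e) (proj₁ e₁))
            e₃ = S′.inj dx′ dy′ (cong₂ _,_ (cong (proj₂ ∘ proj₁) e) (proj₂ e₁))
        in cong₂ _,_ (proj₁ e₂) (proj₁ e₃) , trans (sym (Finₚ.combine-remQuot {a} a′ i))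
             (trans (cong₂ combine (proj₂ e₂) (proj₂ e₃)) (Finₚ.combine-remQuot {a} a′ j)) }
    where
    module S = Spread s
    module S′ = Spread s′

  module _ {I : Set} {_≼_ : I → I → Set} {C D : Cube} (T : Tiles _≼_ C) (S : Tiles _≼_ D) (G : I → Set) {a a′ b : ℕ} where
    private
      module C = Cube C
      module D = Cube D
      module T = Tiles T
      module S = Tiles S
      module F = First T S
      module TS = Tiles (first T S)

    -- Which of the two coordinates was changed can be read off the result, so the labels add up.
    first-spread : Spread C T.Free (T.Hits G) a b → Spread D S.Free (S.Hits G) a′ b →
                   Spread (C ×C D) TS.Free (TS.Hits G) (a + a′) b
    first-spread s s′ = record
      { f = λ z dz i → g z (F.loc-free dz) (splitAt a i)
      ; below = λ z dz i → g-below z (F.loc-free dz) (splitAt a i)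
      ; target = λ z dz i → g-target z (F.loc-free dz) (splitAt a i)
      ; inj = λ {z} {w} dz dw {i} {j} e → let e₁ , e₂ = g-inj z w (F.loc-free dz) (F.loc-free dw) (splitAt a i) (splitAt a j) e in
          e₁ , trans (sym (Finₚ.join-splitAt a a′ i)) (trans (cong (join a a′) e₂) (Finₚ.join-splitAt a a′ j)) }
      where
      module U = Spread s
      module U′ = Spread s′
      BothFree : C.Carrier × D.Carrier → Set
      BothFree (x , y) = T.Free x × S.Free y
      g : ∀ z → BothFree z → Fin a ⊎ Fin a′ → (C.Carrier × D.Carrier) × Fin b
      g (x , y) (fx , fy) (inj₁ i) = let z , c = U.f x fx i in (z , y) , c
      g (x , y) (fx , fy) (inj₂ i) = let z , c = U′.f y fy i in (x , z) , c
      g-below : ∀ z d i → Cube._≤_ (C ×C D) (proj₁ (g z d i)) z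
      g-below (x , y) (fx , fy) (inj₁ i) = U.below x fx i , D.≤-refl
      g-below (x , y) (fx , fy) (inj₂ i) = C.≤-refl , U′.below y fy i
      g-target : ∀ z d i → TS.Hits G (proj₁ (g z d i))
      g-target (x , y) (fx , fy) (inj₁ i) = let _ , r , e , ok = U.target x fx i in _ , r , F.loc-inj₁ e , ok
      g-target (x , y) (fx , fy) (inj₂ i) = let _ , r , e , ok = U′.target y fy i in _ , r , F.loc-inj₂ fx e , ok
      clash : ∀ {x z} → T.Free x → T.Hits G z → z ≢ x
      clash fx (_ , _ , e , _) refl with () ← trans (sym fx) e
      g-inj : ∀ z w d e i j → g z d i ≡ g w e j → z ≡ w × i ≡ j
      g-inj (x , y) (x′ , y′) (fx , fy) (fx′ , fy′) (inj₁ i) (inj₁ j) q =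
        let e , e′ = U.inj fx fx′ (cong₂ _,_ (cong (proj₁ ∘ proj₁) q) (cong proj₂ q))
        in cong₂ _,_ e (cong (proj₂ ∘ proj₁) q) , cong inj₁ e′
      g-inj (x , y) (x′ , y′) (fx , fy) (fx′ , fy′) (inj₁ i) (inj₂ j) q =
        ⊥-elim (clash fx′ (U.target x fx i) (cong (proj₁ ∘ proj₁) q))
      g-inj (x , y) (x′ , y′) (fx , fy) (fx′ , fy′) (inj₂ i) (inj₁ j) q =
        ⊥-elim (clash fx (U.target x′ fx′ j) (sym (cong (proj₁ ∘ proj₁) q)))
      g-inj (x , y) (x′ , y′) (fx , fy) (fx′ , fy′) (inj₂ i) (inj₂ j) q =
        let e , e′ = U′.inj fy fy′ (cong₂ _,_ (cong (proj₂ ∘ proj₁) q) (cong proj₂ q))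
        in cong₂ _,_ (cong (proj₁ ∘ proj₁) q) e , cong inj₂ e′

  -- The labels grow with n and the codes do not: this is the amplification that makes a poor ratio
  -- as large as desired.
  pow-spread : ∀ {I} {_≼_ : I → I → Set} {C} (T : Tiles _≼_ C) (G : I → Set) {a b} →
               Spread C (Tiles.Free T) (Tiles.Hits T G) a b → ∀ n →
               Spread (C ^C n) (Tiles.Free (powT T n)) (Tiles.Hits (powT T n) G) (n * a) b
  pow-spread T G s zero    = record { f = λ _ _ () ; below = λ _ _ () ; target = λ _ _ () ; inj = λ { _ _ {()} } }
  pow-spread T G s (suc n) = first-spread T (powT T n) G s (pow-spread T G s n)

-- Bracket structure of binary words, read up to a bounded number of unmatched letters

module Bracketing where

  open import Data.Nat using (_⊓_; _≤_; _≤?_; _<?_)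
  open import Data.List.Relation.Binary.Pointwise using (Pointwise; []; _∷_)
  open import Relation.Nullary.Decidable using (dec-true; dec-false; dec-yes)
  open import Relation.Binary.PropositionalEquality using (module ≡-Reasoning)

  infix 4 _⊑ₗ_
  _⊑ₗ_ : List Bool → List Bool → Set
  _⊑ₗ_ = Pointwise Bool._≤_

  ⊑ₗ-refl : ∀ {w} → w ⊑ₗ w
  ⊑ₗ-refl = LPW.refl Bool.b≤b

  ones zeros : List Bool → ℕ
  ones []           = 0
  ones (true ∷ w)   = suc (ones w)
  ones (false ∷ w)  = ones w
  zeros []          = 0
  zeros (true ∷ w)  = zeros w
  zeros (false ∷ w) = suc (zeros w)

  ones+zeros : ∀ w → ones w + zeros w ≡ length w
  ones+zeros []          = refl
  ones+zeros (true ∷ w)  = cong suc (ones+zeros w)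
  ones+zeros (false ∷ w) = trans (ℕₚ.+-suc (ones w) (zeros w)) (cong suc (ones+zeros w))

  ones-mono : ∀ {v w} → v ⊑ₗ w → ones v ≤ ones w
  ones-mono [] = z≤n
  ones-mono (_∷_ {true} Bool.b≤b p)  = s≤s (ones-mono p)
  ones-mono (_∷_ {false} Bool.b≤b p) = ones-mono p
  ones-mono (Bool.f≤t ∷ p)           = ℕₚ.m≤n⇒m≤1+n (ones-mono p)

  -- Balanced bracket words of nesting depth at most n.
  data Tree : ℕ → Set where
    leaf : ∀ {n} → Tree n
    node : ∀ {n} → Tree (suc n) → Tree n → Tree (suc n)

  module Brackets (κ : ℕ) where

    -- The balanced words before each unmatched letter; with q unmatched letters so far, the
    -- next balanced word has depth at most r = κ - q.
    data Ctx : ℕ → Set where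
      nil  : Ctx κ
      snoc : ∀ {r} → Ctx (suc r) → Tree (suc r) → Ctx r

    q : ∀ {r} → Ctx r → ℕ
    q nil        = 0
    q (snoc C _) = suc (q C)

    q+r : ∀ {r} (C : Ctx r) → q C + r ≡ κ
    q+r nil = refl
    q+r {r} (snoc C _) = trans (sym (ℕₚ.+-suc (q C) r)) (q+r C)

    read : ∀ {n} → Tree n → List Bool → List Bool
    read leaf w       = w
    read (node l t) w = read l (false ∷ read t (true ∷ w))

    -- The unmatched letter number i, counted from 0, of the word at position a.
    bit : ℕ → ℕ → Bool
    bit i a = does (i <? a)

    lead : ∀ {r} → Ctx r → ℕ → List Bool → List Bool
    lead nil a w        = w
    lead (snoc C u) a w = lead C a (read u (bit (q C) a ∷ w))

    -- A word is done as soon as it has κ + 1 unmatched letters; what follows is arbitrary.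
    data Shape : Set where
      act  : ∀ {r} → Ctx r → Tree r → Shape
      done : Ctx 0 → List Bool → Shape

    width : Shape → ℕ
    width (act C u)  = q C
    width (done C w) = suc κ

    rend : Shape → ℕ → List Bool
    rend (act C u) a  = lead C a (read u [])
    rend (done C w) a = lead C a (bit (q C) a ∷ w)

    -- State of the parser: `u` is the balanced word since the last unmatched letter, `a` the number
    -- of unmatched true letters. Opening brackets that may be closed later count as unmatched for
    -- the time being, and this bounds the nesting depth of `u` by r.
    run  : ∀ {r} → Ctx r → Tree r → ℕ → List Bool → Shape × ℕ
    grow : ∀ {r} → Ctx r → Tree r → ℕ → List Bool → Shape × ℕ
    -- If `a ≤ q C`, the last unmatched letter, number `q C`, is false, and the new true letter
    -- closes it. Otherwise all unmatched letters are true and one more is added.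
    close : ∀ {r} (C : Ctx (suc r)) → Tree (suc r) → Tree r → (a : ℕ) → Dec (a ≤ q C) → List Bool → Shape × ℕ

    -- This is unmatched letter number κ + 1, so parsing stops. Nothing is lost by dropping `u`,
    -- because a `Tree 0` is empty.
    grow {zero} C u a w  = done C w , a
    grow {suc r} C u a w = run (snoc C u) leaf a w

    close C v u a (yes _) w = run C (node v u) a w
    close C v u a (no _) w  = grow (snoc C v) u (suc a) w

    run C u a []                   = act C u , a
    run C u a (false ∷ w)          = grow C u a w
    run nil u a (true ∷ w)         = grow nil u (suc a) w
    run (snoc C v) u a (true ∷ w)  = close C v u a (a ≤? q C) w

    parse : List Bool → Shape × ℕ
    parse = run nil leaf 0

    run-close : ∀ {r} (C : Ctx (suc r)) v u {a} w → a ≤ q C → run (snoc C v) u a (true ∷ w) ≡ run C (node v u) a w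
    run-close C v u {a} w a≤q = cong (λ p → close C v u a p w) (proj₂ (dec-yes (a ≤? q C) a≤q))

    run-raise : ∀ {r} (C : Ctx r) u w → run C u (q C) (true ∷ w) ≡ grow C u (suc (q C)) w
    run-raise nil u w        = refl
    run-raise (snoc C v) u w with suc (q C) ≤? q C
    ... | yes p = ⊥-elim (ℕₚ.<-irrefl refl p)
    ... | no _  = refl

    -- Needed when a new unmatched true letter raises the position from `q C` to `suc (q C)`: the
    -- letters already read must not change.
    lead-saturated : ∀ {r} (C : Ctx r) {a a′} w → q C ≤ a → q C ≤ a′ → lead C a w ≡ lead C a′ w
    lead-saturated nil w _ _ = refl
    lead-saturated (snoc C u) {a} {a′} w p p′
      rewrite dec-true (q C <? a) p | dec-true (q C <? a′) p′ =
      lead-saturated C _ (ℕₚ.<⇒≤ p) (ℕₚ.<⇒≤ p′)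

    private
      read-0 : ∀ (u : Tree 0) w → read u w ≡ w
      read-0 leaf w = refl

    render : Shape × ℕ → List Bool
    render (sh , a) = rend sh a

    render-run  : ∀ {r} (C : Ctx r) u a w → a ≤ q C → render (run C u a w) ≡ lead C a (read u w)
    render-grow : ∀ {r} (C : Ctx r) u a w → a ≤ suc (q C) → render (grow C u a w) ≡ lead C a (read u (bit (q C) a ∷ w))
    render-raise : ∀ {r} (C : Ctx r) u w → render (grow C u (suc (q C)) w) ≡ lead C (q C) (read u (true ∷ w))

    render-grow {zero} C u a w a≤   = cong (lead C a) (sym (read-0 u _))
    render-grow {suc r} C u a w a≤  = render-run (snoc C u) leaf a w a≤

    render-raise C u w = trans (render-grow C u (suc (q C)) w ℕₚ.≤-refl)
      (trans (cong (λ b → lead C (suc (q C)) (read u (b ∷ w))) (dec-true (q C <? suc (q C)) ℕₚ.≤-refl))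
             (lead-saturated C _ (ℕₚ.n≤1+n _) ℕₚ.≤-refl))

    render-run C u a [] a≤ = refl
    render-run C u a (false ∷ w) a≤ = trans (render-grow C u a w (ℕₚ.m≤n⇒m≤1+n a≤))
      (cong (λ b → lead C a (read u (b ∷ w))) (dec-false (q C <? a) (ℕₚ.≤⇒≯ a≤)))
    render-run nil u zero (true ∷ w) a≤ = render-raise nil u w
    render-run (snoc C v) u a (true ∷ w) a≤ with a ≤? q C
    ... | yes a≤q = trans (render-run C (node v u) a w a≤q)
      (cong (λ b → lead C a (read v (b ∷ read u (true ∷ w)))) (sym (dec-false (q C <? a) (ℕₚ.≤⇒≯ a≤q))))
    ... | no a≰q with refl ← ℕₚ.≤-antisym a≤ (ℕₚ.≰⇒> a≰q) = render-raise (snoc C v) u w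

    render-parse : ∀ w → render (parse w) ≡ w
    render-parse w = render-run nil leaf 0 w z≤n

    position-bound : ∀ {r} (C : Ctx r) u a w → a ≤ q C → proj₂ (run C u a w) ≤ width (proj₁ (run C u a w))
    position-bound′ : ∀ {r} (C : Ctx r) u a w → a ≤ suc (q C) → proj₂ (grow C u a w) ≤ width (proj₁ (grow C u a w))
    position-bound′ {zero} C u a w a≤ = ℕₚ.≤-trans a≤ (s≤s (ℕₚ.≤-reflexive (trans (sym (ℕₚ.+-identityʳ (q C))) (q+r C))))
    position-bound′ {suc r} C u a w a≤ = position-bound (snoc C u) leaf a w a≤
    position-bound C u a [] a≤ = a≤
    position-bound C u a (false ∷ w) a≤ = position-bound′ C u a w (ℕₚ.m≤n⇒m≤1+n a≤)
    position-bound nil u a (true ∷ w) a≤ = position-bound′ nil u (suc a) w (s≤s a≤)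
    position-bound (snoc C v) u a (true ∷ w) a≤ with a ≤? q C
    ... | yes a≤q = position-bound C (node v u) a w a≤q
    ... | no _    = position-bound′ (snoc C v) u (suc a) w (s≤s a≤)

    run-read : ∀ {r} (t : Tree r) (C : Ctx r) {a} w → a ≤ q C → run C leaf a (read t w) ≡ run C t a w
    run-read leaf C w a≤ = refl
    run-read (node l t) C {a} w a≤ = begin
      run C leaf a (read l (false ∷ read t (true ∷ w)))  ≡⟨ run-read l C _ a≤ ⟩
      run (snoc C l) leaf a (read t (true ∷ w))          ≡⟨ run-read t (snoc C l) _ (ℕₚ.m≤n⇒m≤1+n a≤) ⟩
      run (snoc C l) t a (true ∷ w)                      ≡⟨ run-close C l t w a≤ ⟩
      run C (node l t) a w                               ∎
      where open ≡-Reasoning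

    run-letter : ∀ {r} (C : Ctx r) u a w → run C u (a ⊓ q C) (bit (q C) a ∷ w) ≡ grow C u (a ⊓ suc (q C)) w
    run-letter C u a w with q C <? a
    ... | yes q<a rewrite dec-true (q C <? a) q<a | ℕₚ.m≥n⇒m⊓n≡n (ℕₚ.<⇒≤ q<a) | ℕₚ.m≥n⇒m⊓n≡n q<a = run-raise C u w
    ... | no q≮a rewrite dec-false (q C <? a) q≮a | ℕₚ.m≤n⇒m⊓n≡m (ℕₚ.≮⇒≥ q≮a) | ℕₚ.m≤n⇒m⊓n≡m (ℕₚ.m≤n⇒m≤1+n (ℕₚ.≮⇒≥ q≮a)) = refl

    run-lead : ∀ {r} (C : Ctx r) a w → parse (lead C a w) ≡ run C leaf (a ⊓ q C) w
    run-lead nil a w rewrite ℕₚ.⊓-zeroʳ a = refl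
    run-lead (snoc C u) a w = begin
      parse (lead C a (read u (bit (q C) a ∷ w)))             ≡⟨ run-lead C a _ ⟩
      run C leaf (a ⊓ q C) (read u (bit (q C) a ∷ w))         ≡⟨ run-read u C _ (ℕₚ.m⊓n≤n a (q C)) ⟩
      run C u (a ⊓ q C) (bit (q C) a ∷ w)                     ≡⟨ run-letter C u a w ⟩
      run (snoc C u) leaf (a ⊓ suc (q C)) w                   ∎
      where open ≡-Reasoning

    -- Unmatched true letters precede unmatched false ones at every position, so moving the position
    -- creates no new pair. This makes the words of one shape a full chain, disjoint from those of
    -- the other shapes.
    parse-rend : ∀ sh {a} → a ≤ width sh → parse (rend sh a) ≡ (sh , a)
    parse-rend (act C u) {a} a≤ = begin
      parse (lead C a (read u []))      ≡⟨ run-lead C a _ ⟩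
      run C leaf (a ⊓ q C) (read u [])  ≡⟨ cong (λ a → run C leaf a (read u [])) (ℕₚ.m≤n⇒m⊓n≡m a≤) ⟩
      run C leaf a (read u [])          ≡⟨ run-read u C [] a≤ ⟩
      (act C u , a)                     ∎
      where open ≡-Reasoning
    parse-rend (done C w) {a} a≤ = begin
      parse (lead C a (bit (q C) a ∷ w))          ≡⟨ run-lead C a _ ⟩
      run C leaf (a ⊓ q C) (bit (q C) a ∷ w)      ≡⟨ run-letter C leaf a w ⟩
      (done C w , a ⊓ suc (q C))                  ≡⟨ cong (done C w ,_) (ℕₚ.m≤n⇒m⊓n≡m a≤′) ⟩
      (done C w , a)                              ∎
      where
      open ≡-Reasoning
      a≤′ : a ≤ suc (q C)
      a≤′ = ℕₚ.≤-trans a≤ (s≤s (ℕₚ.≤-reflexive (trans (sym (q+r C)) (ℕₚ.+-identityʳ (q C)))))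

    private
      bit-mono : ∀ i {a a′} → a ≤ a′ → bit i a Bool.≤ bit i a′
      bit-mono i {a} {a′} a≤ with i <? a
      ... | yes p rewrite dec-true (i <? a) p | dec-true (i <? a′) (ℕₚ.≤-trans p a≤) = Bool.b≤b
      ... | no ¬p rewrite dec-false (i <? a) ¬p with bit i a′
      ...   | true  = Bool.f≤t
      ...   | false = Bool.b≤b

      read-mono : ∀ {n} (t : Tree n) {v w} → v ⊑ₗ w → read t v ⊑ₗ read t w
      read-mono leaf p       = p
      read-mono (node l t) p = read-mono l (Bool.b≤b ∷ read-mono t (Bool.b≤b ∷ p))

      lead-mono : ∀ {r} (C : Ctx r) {a a′ v w} → a ≤ a′ → v ⊑ₗ w → lead C a v ⊑ₗ lead C a′ w
      lead-mono nil a≤ p        = p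
      lead-mono (snoc C u) a≤ p = lead-mono C a≤ (read-mono u (bit-mono (q C) a≤ ∷ p))

      pairs : ∀ {n} → Tree n → ℕ
      pairs leaf       = 0
      pairs (node l t) = pairs l + suc (pairs t)

      pairsC : ∀ {r} → Ctx r → ℕ
      pairsC nil        = 0
      pairsC (snoc C u) = pairsC C + pairs u

      ones-read : ∀ {n} (t : Tree n) w → ones (read t w) ≡ pairs t + ones w
      ones-read leaf w = refl
      ones-read (node l t) w rewrite ones-read l (false ∷ read t (true ∷ w)) | ones-read t (true ∷ w) = arith (pairs l) (pairs t) (ones w)
        where arith : ∀ a b c → a + (b + suc c) ≡ a + suc b + c
              arith = solve-∀

      zeros-read : ∀ {n} (t : Tree n) w → zeros (read t w) ≡ pairs t + zeros w
      zeros-read leaf w = refl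
      zeros-read (node l t) w rewrite zeros-read l (false ∷ read t (true ∷ w)) | zeros-read t (true ∷ w) = arith (pairs l) (pairs t) (zeros w)
        where arith : ∀ a b c → a + suc (b + c) ≡ a + suc b + c
              arith = solve-∀

      ones-bit : ∀ i a w → a ⊓ i + ones (bit i a ∷ w) ≡ a ⊓ suc i + ones w
      ones-bit i a w with i <? a
      ... | yes p rewrite dec-true (i <? a) p | ℕₚ.m≥n⇒m⊓n≡n (ℕₚ.<⇒≤ p) | ℕₚ.m≥n⇒m⊓n≡n p = ℕₚ.+-suc i (ones w)
      ... | no ¬p rewrite dec-false (i <? a) ¬p | ℕₚ.m≤n⇒m⊓n≡m (ℕₚ.≮⇒≥ ¬p) | ℕₚ.m≤n⇒m⊓n≡m (ℕₚ.m≤n⇒m≤1+n (ℕₚ.≮⇒≥ ¬p)) = refl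

      zeros-bit : ∀ i a w → i ∸ a + zeros (bit i a ∷ w) ≡ suc i ∸ a + zeros w
      zeros-bit i a w with i <? a
      ... | yes p rewrite dec-true (i <? a) p | ℕₚ.m≤n⇒m∸n≡0 (ℕₚ.<⇒≤ p) | ℕₚ.m≤n⇒m∸n≡0 p = refl
      ... | no ¬p rewrite dec-false (i <? a) ¬p | ℕₚ.+-∸-assoc 1 (ℕₚ.≮⇒≥ ¬p) = ℕₚ.+-suc (i ∸ a) (zeros w)

      ones-lead : ∀ {r} (C : Ctx r) a w → ones (lead C a w) ≡ pairsC C + (a ⊓ q C + ones w)
      ones-lead nil a w rewrite ℕₚ.⊓-zeroʳ a = refl
      ones-lead (snoc C u) a w = begin
        ones (lead C a (read u (bit (q C) a ∷ w)))                  ≡⟨ ones-lead C a _ ⟩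
        pairsC C + (a ⊓ q C + ones (read u (bit (q C) a ∷ w)))      ≡⟨ cong (λ o → pairsC C + (a ⊓ q C + o)) (ones-read u _) ⟩
        pairsC C + (a ⊓ q C + (pairs u + ones (bit (q C) a ∷ w)))   ≡⟨ arith (pairsC C) (a ⊓ q C) (pairs u) _ ⟩
        pairsC C + pairs u + (a ⊓ q C + ones (bit (q C) a ∷ w))     ≡⟨ cong (pairsC C + pairs u +_) (ones-bit (q C) a w) ⟩
        pairsC C + pairs u + (a ⊓ suc (q C) + ones w)               ∎
        where
        open ≡-Reasoning
        arith : ∀ x y z t → x + (y + (z + t)) ≡ x + z + (y + t)
        arith = solve-∀

      zeros-lead : ∀ {r} (C : Ctx r) a w → zeros (lead C a w) ≡ pairsC C + (q C ∸ a + zeros w)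
      zeros-lead nil a w rewrite ℕₚ.0∸n≡0 a = refl
      zeros-lead (snoc C u) a w = begin
        zeros (lead C a (read u (bit (q C) a ∷ w)))                  ≡⟨ zeros-lead C a _ ⟩
        pairsC C + (q C ∸ a + zeros (read u (bit (q C) a ∷ w)))      ≡⟨ cong (λ o → pairsC C + (q C ∸ a + o)) (zeros-read u _) ⟩
        pairsC C + (q C ∸ a + (pairs u + zeros (bit (q C) a ∷ w)))   ≡⟨ arith (pairsC C) (q C ∸ a) (pairs u) _ ⟩
        pairsC C + pairs u + (q C ∸ a + zeros (bit (q C) a ∷ w))     ≡⟨ cong (pairsC C + pairs u +_) (zeros-bit (q C) a w) ⟩
        pairsC C + pairs u + (suc (q C) ∸ a + zeros w)               ∎
        where
        open ≡-Reasoning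
        arith : ∀ x y z t → x + (y + (z + t)) ≡ x + z + (y + t)
        arith = solve-∀

      q≤κ : ∀ {r} (C : Ctx r) → q C ≤ κ
      q≤κ C = subst (q C ≤_) (q+r C) (ℕₚ.m≤m+n (q C) _)

      q≡κ : (C : Ctx 0) → q C ≡ κ
      q≡κ C = trans (sym (ℕₚ.+-identityʳ (q C))) (q+r C)

      base : Shape → ℕ
      base (act C u)  = pairsC C + pairs u
      base (done C w) = pairsC C + ones w

      ones-rend : ∀ sh a → ones (rend sh a) ≡ base sh + a ⊓ width sh
      ones-rend (act C u) a rewrite ones-lead C a (read u []) | ones-read u [] = arith (pairsC C) (a ⊓ q C) (pairs u)
        where arith : ∀ x y z → x + (y + (z + 0)) ≡ x + z + y
              arith = solve-∀
      ones-rend (done C w) a rewrite ones-lead C a (bit (q C) a ∷ w) | ones-bit (q C) a w | q≡κ C = arith (pairsC C) _ (ones w)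
        where arith : ∀ x y z → x + (y + z) ≡ x + z + y
              arith = solve-∀

    rend-mono : ∀ sh {a a′} → a ≤ a′ → rend sh a ⊑ₗ rend sh a′
    rend-mono (act C u) a≤  = lead-mono C a≤ ⊑ₗ-refl
    rend-mono (done C w) a≤ = lead-mono C a≤ (bit-mono (q C) a≤ ∷ ⊑ₗ-refl)

    -- Within a shape the number of ones is a constant plus the position, so comparable words have
    -- comparable positions.
    rend-cancel : ∀ sh {a a′} → a ≤ width sh → a′ ≤ width sh → rend sh a ⊑ₗ rend sh a′ → a ≤ a′
    rend-cancel sh {a} {a′} a≤ a′≤ p = ℕₚ.+-cancelˡ-≤ (base sh) a a′ (subst₂ _≤_ (e a a≤) (e a′ a′≤) (ones-mono p))
      where
      e : ∀ a → a ≤ width sh → ones (rend sh a) ≡ base sh + a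
      e a a≤ = trans (ones-rend sh a) (cong (base sh +_) (ℕₚ.m≤n⇒m⊓n≡m a≤))

    length-rend : ∀ sh a a′ → length (rend sh a) ≡ length (rend sh a′)
    length-rend sh a a′ with ℕₚ.≤-total a a′
    ... | inj₁ p = LPW.Pointwise-length (rend-mono sh p)
    ... | inj₂ p = sym (LPW.Pointwise-length (rend-mono sh p))

    -- Matched pairs contribute equally to both sides and at most κ letters are unmatched. A word
    -- with a larger surplus of zeros must therefore be on a full chain.
    zeros-act : ∀ {r} (C : Ctx r) u a → zeros (rend (act C u) a) ≤ ones (rend (act C u) a) + κ
    zeros-act C u a rewrite zeros-lead C a (read u []) | zeros-read u [] | ones-lead C a (read u []) | ones-read u [] = begin
      pairsC C + (q C ∸ a + (pairs u + 0))     ≤⟨ ℕₚ.+-monoʳ-≤ (pairsC C) (ℕₚ.+-monoˡ-≤ _ (ℕₚ.≤-trans (ℕₚ.m∸n≤m (q C) a) (q≤κ C))) ⟩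
      pairsC C + (κ + (pairs u + 0))           ≤⟨ ℕₚ.m≤n+m _ (a ⊓ q C) ⟩
      a ⊓ q C + (pairsC C + (κ + (pairs u + 0)))  ≡⟨ arith (pairsC C) κ (pairs u) (a ⊓ q C) ⟩
      pairsC C + (a ⊓ q C + (pairs u + 0)) + κ ∎
      where
      open ℕₚ.≤-Reasoning
      arith : ∀ x y z t → t + (x + (y + (z + 0))) ≡ x + (t + (z + 0)) + y
      arith = solve-∀

    ones-act : ∀ {r} (C : Ctx r) u a → ones (rend (act C u) a) ≤ zeros (rend (act C u) a) + κ
    ones-act C u a rewrite zeros-lead C a (read u []) | zeros-read u [] | ones-lead C a (read u []) | ones-read u [] = begin
      pairsC C + (a ⊓ q C + (pairs u + 0))     ≤⟨ ℕₚ.+-monoʳ-≤ (pairsC C) (ℕₚ.+-monoˡ-≤ _ (ℕₚ.≤-trans (ℕₚ.m⊓n≤n a (q C)) (q≤κ C))) ⟩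
      pairsC C + (κ + (pairs u + 0))           ≤⟨ ℕₚ.m≤n+m _ (q C ∸ a) ⟩
      q C ∸ a + (pairsC C + (κ + (pairs u + 0)))  ≡⟨ arith (pairsC C) κ (pairs u) (q C ∸ a) ⟩
      pairsC C + (q C ∸ a + (pairs u + 0)) + κ ∎
      where
      open ℕₚ.≤-Reasoning
      arith : ∀ x y z t → t + (x + (y + (z + 0))) ≡ x + (t + (z + 0)) + y
      arith = solve-∀

    data Active : Shape → Set where
      active : ∀ {r} {C : Ctx r} {u} → Active (act C u)

    private
      -- The number of unmatched true letters, started with a unmatched true and z unmatched false ones.
      unmatched : ℕ → ℕ → List Bool → ℕ
      unmatched a z []                = a
      unmatched a z (false ∷ w)       = unmatched a (suc z) w
      unmatched a zero (true ∷ w)     = unmatched (suc a) zero w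
      unmatched a (suc z) (true ∷ w)  = unmatched a z w

      unmatched-grows : ∀ a z w → a ≤ unmatched a z w
      unmatched-grows a z []               = ℕₚ.≤-refl
      unmatched-grows a z (false ∷ w)      = unmatched-grows a (suc z) w
      unmatched-grows a zero (true ∷ w)    = ℕₚ.≤-trans (ℕₚ.n≤1+n a) (unmatched-grows (suc a) zero w)
      unmatched-grows a (suc z) (true ∷ w) = unmatched-grows a z w

      -- Lowering a word raises z − a at all times, and a is minus the minimum of z − a so far.
      unmatched-mono : ∀ {a z a′ z′ c w} → c ⊑ₗ w → a ≤ a′ → z′ + a ≤ z + a′ → unmatched a z c ≤ unmatched a′ z′ w
      unmatched-mono [] a≤ z≤ = a≤
      unmatched-mono (_∷_ {false} Bool.b≤b p) a≤ z≤ = unmatched-mono p a≤ (s≤s z≤)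
      unmatched-mono {z = zero} {z′ = zero} (_∷_ {true} Bool.b≤b p) a≤ z≤ = unmatched-mono p (s≤s a≤) (s≤s a≤)
      unmatched-mono {a} {zero} {a′} {suc z′} (_∷_ {true} Bool.b≤b p) a≤ z≤ =
        unmatched-mono p (ℕₚ.≤-trans (s≤s (ℕₚ.m≤n+m a z′)) z≤) (subst (_≤ a′) (sym (ℕₚ.+-suc z′ a)) z≤)
      unmatched-mono {a} {suc z} {a′} {zero} (_∷_ {true} Bool.b≤b p) a≤ z≤ =
        unmatched-mono p (ℕₚ.m≤n⇒m≤1+n a≤) (ℕₚ.≤-trans z≤ (ℕₚ.≤-reflexive (sym (ℕₚ.+-suc z a′))))
      unmatched-mono {z = suc z} {z′ = suc z′} (_∷_ {true} Bool.b≤b p) a≤ (s≤s z≤) = unmatched-mono p a≤ z≤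
      unmatched-mono {a} {z} {a′} {zero} (Bool.f≤t ∷ p) a≤ z≤ =
        unmatched-mono p (ℕₚ.m≤n⇒m≤1+n a≤) (ℕₚ.≤-trans a≤ (ℕₚ.m≤n⇒m≤1+n (ℕₚ.≤-trans (ℕₚ.m≤n+m a′ z) (ℕₚ.+-monoʳ-≤ z (ℕₚ.n≤1+n a′)))))
      unmatched-mono {a} {z} {a′} {suc z′} (Bool.f≤t ∷ p) a≤ z≤ =
        unmatched-mono p a≤ (ℕₚ.≤-trans (ℕₚ.n≤1+n _) (ℕₚ.m≤n⇒m≤1+n z≤))

      split : ∀ {n} a z → suc n ≡ a + suc z → n ≡ a + z
      split a z e = ℕₚ.suc-injective (trans e (ℕₚ.+-suc a z))

      join : ∀ {n} a z → n ≡ a + z → suc n ≡ a + suc z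
      join a z e = trans (cong suc e) (sym (ℕₚ.+-suc a z))

      position≤ : ∀ {r} (C : Ctx r) u a z w → q C ≡ a + z → proj₂ (run C u a w) ≤ unmatched a z w
      grow≤ : ∀ {r} (C : Ctx r) u a z w → suc (q C) ≡ a + z → proj₂ (grow C u a w) ≤ unmatched a z w
      grow≤ {zero} C u a z w e  = unmatched-grows a z w
      grow≤ {suc r} C u a z w e = position≤ (snoc C u) leaf a z w e
      position≤ C u a z [] e = ℕₚ.≤-refl
      position≤ C u a z (false ∷ w) e = grow≤ C u a (suc z) w (join a z e)
      position≤ C u a zero (true ∷ w) e with refl ← trans e (ℕₚ.+-identityʳ a) rewrite run-raise C u w =
        grow≤ C u (suc (q C)) zero w (sym (ℕₚ.+-identityʳ _))
      position≤ nil u a (suc z) (true ∷ w) e with () ← trans e (ℕₚ.+-suc a z)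
      position≤ (snoc C v) u a (suc z) (true ∷ w) e
        rewrite run-close C v u {a} w (subst (a ≤_) (sym (split a z e)) (ℕₚ.m≤m+n a z)) = position≤ C (node v u) a z w (split a z e)

      position≥ : ∀ {r} (C : Ctx r) u a z w → q C ≡ a + z → Active (proj₁ (run C u a w)) → unmatched a z w ≤ proj₂ (run C u a w)
      grow≥ : ∀ {r} (C : Ctx r) u a z w → suc (q C) ≡ a + z → Active (proj₁ (grow C u a w)) → unmatched a z w ≤ proj₂ (grow C u a w)
      grow≥ {suc r} C u a z w e ac = position≥ (snoc C u) leaf a z w e ac
      position≥ C u a z [] e ac = ℕₚ.≤-refl
      position≥ C u a z (false ∷ w) e ac = grow≥ C u a (suc z) w (join a z e) ac
      position≥ C u a zero (true ∷ w) e ac with refl ← trans e (ℕₚ.+-identityʳ a) rewrite run-raise C u w =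
        grow≥ C u (suc (q C)) zero w (sym (ℕₚ.+-identityʳ _)) ac
      position≥ nil u a (suc z) (true ∷ w) e ac with () ← trans e (ℕₚ.+-suc a z)
      position≥ (snoc C v) u a (suc z) (true ∷ w) e ac
        rewrite run-close C v u {a} w (subst (a ≤_) (sym (split a z e)) (ℕₚ.m≤m+n a z)) = position≥ C (node v u) a z w (split a z e) ac

    -- On `c` the parser may have stopped early, so its position is at most the total number of
    -- unmatched true letters. That total is monotone, and on the active word `w` it equals the
    -- position. Thus positions stay low while letters are cleared.
    position-mono : ∀ {c w} → c ⊑ₗ w → Active (proj₁ (parse w)) → proj₂ (parse c) ≤ proj₂ (parse w)
    position-mono {c} {w} p ac = ℕₚ.≤-trans (position≤ nil leaf 0 0 c refl)
      (ℕₚ.≤-trans (unmatched-mono p z≤n z≤n) (position≥ nil leaf 0 0 w refl ac))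

-- The chains as tiles of a cube, and how uncovered words descend to them

module Cells where

  open import Data.Nat using (_≤_; _<_)
  open import Data.List.Relation.Binary.Pointwise using ([]; _∷_)
  open import Data.Vec using (toList)
  open import Data.Vec.Relation.Binary.Pointwise.Inductive using ([]; _∷_)
  open Cubes
  open Bracketing

  mk : ∀ L (l : List Bool) → .(length l ≡ L) → Vec Bool L
  mk zero []          _ = []
  mk (suc L) (b ∷ l)  e = b ∷ mk L l (ℕₚ.suc-injective e)

  toList-mk : ∀ L l .(e : length l ≡ L) → toList (mk L l e) ≡ l
  toList-mk zero [] _         = refl
  toList-mk (suc L) (b ∷ l) e = cong (b ∷_) (toList-mk L l (ℕₚ.suc-injective e))

  toList-inj : ∀ {L} {v w : Vec Bool L} → toList v ≡ toList w → v ≡ w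
  toList-inj {v = []} {[]} _ = refl
  toList-inj {v = a ∷ v} {b ∷ w} e = cong₂ _∷_ (proj₁ (Listₚ.∷-injective e)) (toList-inj (proj₂ (Listₚ.∷-injective e)))

  toList-mono : ∀ {L} {v w : Vec Bool L} → v ⊑ w → toList v ⊑ₗ toList w
  toList-mono []       = []
  toList-mono (p ∷ ps) = p ∷ toList-mono ps

  toList-cancel : ∀ {L} {v w : Vec Bool L} → toList v ⊑ₗ toList w → v ⊑ w
  toList-cancel {v = []} {[]} []             = []
  toList-cancel {v = _ ∷ _} {_ ∷ _} (p ∷ ps) = p ∷ toList-cancel ps

  -- The second component is the rank of the new zero among all zeros of the result.
  clear : List Bool → ℕ → List Bool × ℕ
  clear [] r                = [] , 0
  clear (true ∷ w) zero     = false ∷ w , 0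
  clear (true ∷ w) (suc r)  = let c , ρ = clear w r in true ∷ c , ρ
  clear (false ∷ w) r       = let c , ρ = clear w r in false ∷ c , suc ρ

  restore : List Bool → ℕ → List Bool × ℕ
  restore [] ρ                = [] , 0
  restore (false ∷ c) zero    = true ∷ c , 0
  restore (false ∷ c) (suc ρ) = let w , r = restore c ρ in false ∷ w , r
  restore (true ∷ c) ρ        = let w , r = restore c ρ in true ∷ w , suc r

  restore-clear : ∀ w {r} → r < ones w → restore (proj₁ (clear w r)) (proj₂ (clear w r)) ≡ (w , r)
  restore-clear (true ∷ w) {zero} r<  = refl
  restore-clear (true ∷ w) {suc r} (s≤s r<) rewrite restore-clear w r< = refl
  restore-clear (false ∷ w) {r} r< rewrite restore-clear w r< = refl

  ones-clear : ∀ w {r} → r < ones w → suc (ones (proj₁ (clear w r))) ≡ ones w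
  ones-clear (true ∷ w) {zero} r< = refl
  ones-clear (true ∷ w) {suc r} (s≤s r<) = cong suc (ones-clear w r<)
  ones-clear (false ∷ w) r< = ones-clear w r<

  zeros-clear : ∀ w {r} → r < ones w → zeros (proj₁ (clear w r)) ≡ suc (zeros w)
  zeros-clear (true ∷ w) {zero} r< = refl
  zeros-clear (true ∷ w) {suc r} (s≤s r<) = zeros-clear w r<
  zeros-clear (false ∷ w) r< = cong suc (zeros-clear w r<)

  clear-rank : ∀ w {r} → r < ones w → proj₂ (clear w r) < zeros (proj₁ (clear w r))
  clear-rank (true ∷ w) {zero} r< = s≤s z≤n
  clear-rank (true ∷ w) {suc r} (s≤s r<) = clear-rank w r<
  clear-rank (false ∷ w) r< = s≤s (clear-rank w r<)

  clear-below : ∀ w r → proj₁ (clear w r) ⊑ₗ w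
  clear-below [] r = []
  clear-below (true ∷ w) zero = Bool.f≤t ∷ ⊑ₗ-refl
  clear-below (true ∷ w) (suc r) = Bool.b≤b ∷ clear-below w r
  clear-below (false ∷ w) r = Bool.b≤b ∷ clear-below w r

  parity : ℕ → Fin 2
  parity zero          = zero
  parity (suc zero)    = suc zero
  parity (suc (suc a)) = parity a

  halves : ∀ a b → ⌊ a /2⌋ ≡ ⌊ b /2⌋ → parity a ≡ parity b → a ≡ b
  halves zero zero _ _ = refl
  halves zero (suc zero) _ ()
  halves zero (suc (suc b)) () _
  halves (suc zero) zero _ ()
  halves (suc zero) (suc zero) _ _ = refl
  halves (suc zero) (suc (suc b)) () _
  halves (suc (suc a)) zero () _
  halves (suc (suc a)) (suc zero) () _
  halves (suc (suc a)) (suc (suc b)) e e′ = cong (λ n → suc (suc n)) (halves a b (ℕₚ.suc-injective e) e′)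

  module Lines (κ L : ℕ) where
    open Brackets κ

    -- The length proof is irrelevant, so that a line is determined by its context and rest.
    record Line : Set where
      constructor line
      field
        ctx  : Ctx 0
        rest : List Bool
        .len : length (rend (done ctx rest) 0) ≡ L

    enc : Line → Fin (suc (suc κ)) → Vec Bool L
    enc (line C w len) i = mk L (rend (done C w) (toℕ i)) (trans (length-rend (done C w) (toℕ i) 0) len)

    shape : Line → Shape
    shape j = done (Line.ctx j) (Line.rest j)

    toList-enc : ∀ j i → toList (enc j i) ≡ rend (shape j) (toℕ i)
    toList-enc (line C w len) i = toList-mk L (rend (done C w) (toℕ i)) _

    locate : (p : Shape × ℕ) → .(proj₂ p ≤ width (proj₁ p)) → .(length (render p) ≡ L) → Maybe (Line × Fin (suc (suc κ)))
    locate (act C u , a) _ _   = nothing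
    locate (done C w , a) a≤ e = just (line C w (trans (length-rend (done C w) 0 a) e) , fromℕ< (s≤s a≤))

    .bound : ∀ w → proj₂ (parse w) ≤ width (proj₁ (parse w))
    bound w = position-bound nil leaf 0 w z≤n

    .render-length : ∀ (v : Vec Bool L) → length (render (parse (toList v))) ≡ L
    render-length v = trans (cong length (render-parse (toList v))) (Vecₚ.length-toList v)

    loc : Vec Bool L → Maybe (Line × Fin (suc (suc κ)))
    loc v = locate (parse (toList v)) (bound (toList v)) (render-length v)

    locate-cong : ∀ {p p′} → p ≡ p′ → ∀ .{b b′ e e′} → locate p b e ≡ locate p′ b′ e′
    locate-cong refl = refl

    locate-just : ∀ p .{b e} {C w i} .{len} → locate p b e ≡ just (line C w len , i) → rend (done C w) (toℕ i) ≡ render p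
    locate-just (done C w , a) {b} refl = cong (rend (done C w)) (Finₚ.toℕ-fromℕ< (s≤s b))

    locate-nothing : ∀ p .{b e} → locate p b e ≡ nothing → Active (proj₁ p)
    locate-nothing (act C u , a) _ = active

    T : Tiles Fin._≤_ (vecC L)
    T = record
      { J = Line ; enc = enc ; loc = loc
      ; sound = λ {x} {j} {i} e → toList-inj (trans (toList-enc j i)
          (trans (locate-just (parse (toList x)) e) (render-parse (toList x))))
      ; stay = λ {x} {j} e i → stay j i
      ; order = λ {x} {j} e p q → mk⇔
          (λ p≤q → toList-cancel (subst₂ _⊑ₗ_ (sym (toList-enc j p)) (sym (toList-enc j q)) (rend-mono (shape j) p≤q)))
          (λ r → rend-cancel (shape j) (in-range p) (in-range q) (subst₂ _⊑ₗ_ (toList-enc j p) (toList-enc j q) (toList-mono r)))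
      }
      where
      in-range : ∀ (i : Fin (suc (suc κ))) → toℕ i ≤ suc κ
      in-range i = ℕₚ.≤-pred (Finₚ.toℕ<n i)
      stay : ∀ j i → loc (enc j i) ≡ just (j , i)
      stay (line C w len) i = trans (locate-cong (trans (cong parse (toList-enc (line C w len) i)) (parse-rend (done C w) (in-range i)))
          {b′ = in-range i} {e′ = trans (length-rend (done C w) (toℕ i) 0) len})
        (cong (λ i → just (line C w len , i)) (Finₚ.fromℕ<-toℕ i (s≤s (in-range i))))

    open Tiles T using (Free; Hits)

    -- For κ = B + κ₀ with κ₀ ≤ B, low positions are at most B. A shifted copy that starts at one
    -- still fits into the line.
    Low : Fin (suc (suc κ)) → Set
    Low i = toℕ i ≤ ⌊ κ /2⌋

    private
      HalfFree : Vec Bool L → Set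
      HalfFree v = Active (proj₁ (parse (toList v))) × proj₂ (parse (toList v)) ≤ ⌊ κ /2⌋

      half : List Bool → List Bool
      half w = rend (proj₁ (parse w)) ⌊ proj₂ (parse w) /2⌋

      half-bound : ∀ w → ⌊ proj₂ (parse w) /2⌋ ≤ width (proj₁ (parse w))
      half-bound w = ℕₚ.≤-trans (ℕₚ.⌊n/2⌋≤n _) (position-bound nil leaf 0 w z≤n)

      parse-half : ∀ w → parse (half w) ≡ (proj₁ (parse w) , ⌊ proj₂ (parse w) /2⌋)
      parse-half w = parse-rend (proj₁ (parse w)) (half-bound w)

      half-below : ∀ w → half w ⊑ₗ w
      half-below w = subst (half w ⊑ₗ_) (render-parse w) (rend-mono (proj₁ (parse w)) (ℕₚ.⌊n/2⌋≤n _))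

      .half-length : ∀ (v : Vec Bool L) → length (half (toList v)) ≡ L
      half-length v = trans (LPW.Pointwise-length (half-below (toList v))) (Vecₚ.length-toList v)

      halfV : Vec Bool L → Vec Bool L
      halfV v = mk L (half (toList v)) (half-length v)

      toList-half : ∀ v → toList (halfV v) ≡ half (toList v)
      toList-half v = toList-mk L (half (toList v)) _

      half-injective : ∀ v w → half v ≡ half w → parity (proj₂ (parse v)) ≡ parity (proj₂ (parse w)) → v ≡ w
      half-injective v w e e′ = trans (sym (render-parse v)) (trans (cong render (cong₂ _,_ (cong proj₁ same) (halves _ _ (cong proj₂ same) e′))) (render-parse w))
        where
        same : (proj₁ (parse v) , ⌊ proj₂ (parse v) /2⌋) ≡ (proj₁ (parse w) , ⌊ proj₂ (parse w) /2⌋)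
        same = trans (sym (parse-half v)) (trans (cong parse e) (parse-half w))

    -- Halving the position along the chain of a word without a line costs only one bit.
    halving : Spread (vecC L) Free HalfFree 1 2
    halving = record
      { f = λ v _ _ → halfV v , parity (proj₂ (parse (toList v)))
      ; below = λ v _ _ → toList-cancel (subst (_⊑ₗ toList v) (sym (toList-half v)) (half-below (toList v)))
      ; target = λ v e _ → target v (locate-nothing (parse (toList v)) e)
      ; inj = λ { {v} {w} _ _ {zero} {zero} e → toList-inj (half-injective (toList v) (toList w)
          (trans (sym (toList-half v)) (trans (cong toList (cong proj₁ e)) (toList-half w))) (cong proj₂ e)) , refl }
      }
      where
      active-bound : ∀ p → Active (proj₁ p) → proj₂ p ≤ width (proj₁ p) → proj₂ p ≤ κ
      active-bound (act C u , a) _ a≤ = ℕₚ.≤-trans a≤ (subst (q C ≤_) (q+r C) (ℕₚ.m≤m+n (q C) _))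
      target : ∀ v → Active (proj₁ (parse (toList v))) → HalfFree (halfV v)
      target v ac rewrite toList-half v | parse-half (toList v) =
        ac , ℕₚ.⌊n/2⌋-mono (active-bound (parse (toList v)) ac (position-bound nil leaf 0 (toList v) z≤n))

    module _ (α β : ℕ) (L≥ : α + α + 3 * κ + 2 ≤ L) (L≤ : L + 3 * κ + 2 ≤ β + β) where
      private
        -- k further letters are going to be cleared.
        record Clearing (k : ℕ) (v : Vec Bool L) : Set where
          field
            enough  : α + k ≤ ones (toList v)
            few     : zeros (toList v) + k ≤ β
            surplus : ones (toList v) + suc κ ≤ zeros (toList v) + (k + k)
            origin  : List Bool
            origin-active : Active (proj₁ (parse origin))
            origin-low    : proj₂ (parse origin) ≤ ⌊ κ /2⌋
            below-origin  : toList v ⊑ₗ origin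

        double-cancel : ∀ {m n} → m + m ≤ n + n → m ≤ n
        double-cancel {m} {n} p = ℕₚ.≮⇒≥ λ n<m → ℕₚ.<⇒≱ (ℕₚ.+-mono-< n<m n<m) p

        -- In an active word the numbers of ones and zeros differ by at most κ. Both are thus close
        -- to L / 2, which the hypotheses on α and β turn into room for κ + 1 clearings.
        begin-clearing : ∀ {v} → HalfFree v → Clearing (suc κ) v
        begin-clearing {v} (ac , low) = record
          { enough = double-cancel (ℕₚ.+-cancelʳ-≤ κ _ _ (begin
              (α + suc κ) + (α + suc κ) + κ  ≡⟨ arith₁ α κ ⟩
              α + α + 3 * κ + 2              ≤⟨ L≥ ⟩
              L                              ≡⟨ o+z ⟨
              o + z                          ≤⟨ ℕₚ.+-monoʳ-≤ o (proj₁ bal) ⟩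
              o + (o + κ)                    ≡⟨ ℕₚ.+-assoc o o κ ⟨
              o + o + κ                      ∎))
          ; few = double-cancel (begin
              (z + suc κ) + (z + suc κ)    ≡⟨ arith₃ z κ ⟩
              z + z + 2 * κ + 2            ≤⟨ ℕₚ.+-monoˡ-≤ 2 (ℕₚ.+-monoˡ-≤ (2 * κ) zz≤) ⟩
              L + κ + 2 * κ + 2            ≡⟨ arith₂ L κ ⟩
              L + 3 * κ + 2                ≤⟨ L≤ ⟩
              β + β                        ∎)
          ; surplus = begin
              o + suc κ                    ≤⟨ ℕₚ.+-monoˡ-≤ (suc κ) o≤ ⟩
              z + κ + suc κ                ≤⟨ ℕₚ.+-monoˡ-≤ (suc κ) (ℕₚ.+-monoʳ-≤ z (ℕₚ.n≤1+n κ)) ⟩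
              z + suc κ + suc κ            ≡⟨ ℕₚ.+-assoc z (suc κ) (suc κ) ⟩
              z + (suc κ + suc κ)          ∎
          ; origin = toList v ; origin-active = ac ; origin-low = low ; below-origin = ⊑ₗ-refl }
          where
          open ℕₚ.≤-Reasoning
          o = ones (toList v)
          z = zeros (toList v)
          arith₁ : ∀ α κ → (α + suc κ) + (α + suc κ) + κ ≡ α + α + 3 * κ + 2
          arith₁ = solve-∀
          arith₃ : ∀ α κ → (α + suc κ) + (α + suc κ) ≡ α + α + 2 * κ + 2
          arith₃ = solve-∀
          arith₂ : ∀ L κ → L + κ + 2 * κ + 2 ≡ L + 3 * κ + 2
          arith₂ = solve-∀
          balance : ∀ p → Active (proj₁ p) → zeros (render p) ≤ ones (render p) + κ × ones (render p) ≤ zeros (render p) + κ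
          balance (act C u , a) _ = zeros-act C u a , ones-act C u a
          bal : z ≤ o + κ × o ≤ z + κ
          bal = subst (λ w → zeros w ≤ ones w + κ × ones w ≤ zeros w + κ) (render-parse (toList v)) (balance (parse (toList v)) ac)
          o≤ = proj₂ bal
          o+z : o + z ≡ L
          o+z = trans (ones+zeros (toList v)) (Vecₚ.length-toList v)
          zz≤ : z + z ≤ L + κ
          zz≤ = begin
            z + z        ≤⟨ ℕₚ.+-monoˡ-≤ z (proj₁ bal) ⟩
            o + κ + z    ≡⟨ arith o κ z ⟩
            o + z + κ    ≡⟨ cong (_+ κ) o+z ⟩
            L + κ        ∎
            where arith : ∀ o κ z → o + κ + z ≡ o + z + κ
                  arith = solve-∀

        clearV : Vec Bool L → ℕ → Vec Bool L
        clearV v r = mk L (proj₁ (clear (toList v) r)) (trans (LPW.Pointwise-length (clear-below (toList v) r)) (Vecₚ.length-toList v))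

        toList-clear : ∀ v r → toList (clearV v r) ≡ proj₁ (clear (toList v) r)
        toList-clear v r = toList-mk L (proj₁ (clear (toList v) r)) _

        -- The label chooses the letter to be cleared among at least α ones. The code is the rank of
        -- the new zero among at most β zeros, from which the letter can be restored.
        step : ∀ k → Spread (vecC L) (Clearing (suc k)) (Clearing k) α β
        step k = record
          { f = λ v d i → clearV v (toℕ i) , fromℕ< (code< v d i)
          ; below = λ v d i → toList-cancel (subst (_⊑ₗ toList v) (sym (toList-clear v (toℕ i))) (clear-below (toList v) (toℕ i)))
          ; target = target
          ; inj = λ {v} {w} d d′ {i} {j} e →
              let e₁ : proj₁ (clear (toList v) (toℕ i)) ≡ proj₁ (clear (toList w) (toℕ j))
                  e₁ = trans (sym (toList-clear v (toℕ i))) (trans (cong toList (cong proj₁ e)) (toList-clear w (toℕ j)))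
                  e₂ : proj₂ (clear (toList v) (toℕ i)) ≡ proj₂ (clear (toList w) (toℕ j))
                  e₂ = trans (sym (Finₚ.toℕ-fromℕ< (code< v d i))) (trans (cong toℕ (cong proj₂ e)) (Finₚ.toℕ-fromℕ< (code< w d′ j)))
                  e₃ = trans (sym (restore-clear (toList v) (label< v d i))) (trans (cong₂ restore e₁ e₂) (restore-clear (toList w) (label< w d′ j)))
              in toList-inj (cong proj₁ e₃) , Finₚ.toℕ-injective (cong proj₂ e₃)
          }
          where
          label< : ∀ v → Clearing (suc k) v → (i : Fin α) → toℕ i < ones (toList v)
          label< v d i = ℕₚ.≤-trans (Finₚ.toℕ<n i) (ℕₚ.≤-trans (ℕₚ.m≤m+n α (suc k)) (Clearing.enough d))
          code< : ∀ v → Clearing (suc k) v → (i : Fin α) → proj₂ (clear (toList v) (toℕ i)) < β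
          code< v d i = ℕₚ.≤-trans (clear-rank (toList v) (label< v d i)) (ℕₚ.≤-trans
            (ℕₚ.≤-reflexive (zeros-clear (toList v) (label< v d i))) (ℕₚ.≤-trans (ℕₚ.m≤m+n _ k)
              (ℕₚ.≤-trans (ℕₚ.≤-reflexive (sym (ℕₚ.+-suc _ k))) (Clearing.few d))))
          target : ∀ v d i → Clearing k (clearV v (toℕ i))
          target v d i = record
            { enough = subst (α + k ≤_) (sym (cong ones tl)) (ℕₚ.≤-pred (begin
                suc (α + k)   ≡⟨ ℕₚ.+-suc α k ⟨
                α + suc k     ≤⟨ enough ⟩
                ones (toList v) ≡⟨ o ⟨
                suc (ones c)  ∎))
            ; few = subst (λ n → n + k ≤ β) (sym (trans (cong zeros tl) z)) (begin
                suc (zeros (toList v)) + k ≡⟨ ℕₚ.+-suc _ k ⟨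
                zeros (toList v) + suc k   ≤⟨ few ⟩
                β ∎)
            ; surplus = subst₂ (λ m n → m + suc κ ≤ n + (k + k)) (sym (cong ones tl)) (sym (trans (cong zeros tl) z)) (ℕₚ.≤-pred (begin
                suc (ones c) + suc κ            ≡⟨ cong (_+ suc κ) o ⟩
                ones (toList v) + suc κ         ≤⟨ surplus ⟩
                zeros (toList v) + (suc k + suc k) ≡⟨ arith (zeros (toList v)) k ⟩
                suc (suc (zeros (toList v)) + (k + k)) ∎))
            ; origin = origin ; origin-active = origin-active ; origin-low = origin-low
            ; below-origin = LPW.transitive Boolₚ.≤-trans (subst (_⊑ₗ toList v) (sym tl) (clear-below (toList v) (toℕ i))) below-origin }
            where
            open ℕₚ.≤-Reasoning
            open Clearing d
            c = proj₁ (clear (toList v) (toℕ i))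
            tl = toList-clear v (toℕ i)
            o = ones-clear (toList v) (label< v d i)
            z = zeros-clear (toList v) (label< v d i)
            arith : ∀ z k → z + (suc k + suc k) ≡ suc (suc z + (k + k))
            arith = solve-∀

        steps : ∀ k → Spread (vecC L) (Clearing k) (Clearing 0) (α ^ k) (β ^ k)
        steps zero    = stayPut 1
        steps (suc k) = step k ⨾ steps k

        -- With no clearing left, the zeros outnumber the ones by more than κ, contrary to
        -- `zeros-act` for an active word; so the word is on a line. Its position is bounded by that
        -- of `origin`, by `position-mono`.
        finish : ∀ {v} → Clearing 0 v → Hits Low v
        finish {v} d = go (parse (toList v)) refl
          where
          open Clearing d
          go : ∀ p → parse (toList v) ≡ p → Hits Low v
          go (act C u , a) e = ⊥-elim (ℕₚ.<⇒≱ {ones w + κ} (begin-strict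
              ones w + κ      <⟨ ℕₚ.+-monoʳ-< (ones w) ℕₚ.≤-refl ⟩
              ones w + suc κ  ≡⟨ cong (λ w → ones w + suc κ) we ⟩
              ones (toList v) + suc κ ≤⟨ surplus ⟩
              zeros (toList v) + 0    ≡⟨ ℕₚ.+-identityʳ _ ⟩
              zeros (toList v)        ≡⟨ cong zeros we ⟨
              zeros w ∎) (zeros-act C u a))
            where
            open ℕₚ.≤-Reasoning
            w = rend (act C u) a
            we : w ≡ toList v
            we = trans (cong render (sym e)) (render-parse (toList v))
          go (done C w , a) e =
            line C w (trans (length-rend (done C w) 0 a) (trans (cong length we) (Vecₚ.length-toList v))) , fromℕ< (s≤s a≤) ,
            locate-cong e {b′ = a≤} {e′ = trans (cong length we) (Vecₚ.length-toList v)} ,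
            subst (_≤ ⌊ κ /2⌋) (sym (Finₚ.toℕ-fromℕ< (s≤s a≤))) (ℕₚ.≤-trans
              (ℕₚ.≤-reflexive (sym (cong proj₂ e))) (ℕₚ.≤-trans (position-mono below-origin origin-active) origin-low))
            where
            we : rend (done C w) a ≡ toList v
            we = trans (cong render (sym e)) (render-parse (toList v))
            a≤ : a ≤ suc κ
            a≤ = subst (λ p → proj₂ p ≤ width (proj₁ p)) e (position-bound nil leaf 0 (toList v) z≤n)

      reach : Spread (vecC L) Free (Hits Low) (1 * α ^ suc κ) (2 * β ^ suc κ)
      reach = halving ⨾ weaken begin-clearing finish ℕₚ.≤-refl (steps (suc κ))

-- Copies of P as shifts in a product of chains

module Chains where

  open import Data.Nat using (_≤_; _<_)
  open Cubes

  relabel : ∀ {C D T a a′ b} → a ≡ a′ → Spread C D T a b → Spread C D T a′ b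
  relabel refl s = s

  -- A copy of the order shifts a chain of B + κ₀ + 2 points, starting at a position v ≤ B.
  module Shift (κ₀ B : ℕ) (C : Cube) (T : Tiles (Fin._≤_ {suc (suc (B + κ₀))}) C) where
    private
      module C = Cube C
      module T = Tiles T

    N R : ℕ
    N = suc (suc (B + κ₀))
    R = suc (suc κ₀)

    add : Fin (suc B) → Fin R → Fin N
    add v r = fromℕ< {toℕ v + toℕ r} (s≤s (ℕₚ.≤-trans (ℕₚ.+-mono-≤ (ℕₚ.≤-pred (Finₚ.toℕ<n v)) (ℕₚ.≤-pred (Finₚ.toℕ<n r)))
                                              (ℕₚ.≤-reflexive (ℕₚ.+-suc B κ₀))))

    toℕ-add : ∀ v r → toℕ (add v r) ≡ toℕ v + toℕ r
    toℕ-add v r = Finₚ.toℕ-fromℕ< _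

    add-injective : ∀ {v v′ r} → add v r ≡ add v′ r → v ≡ v′
    add-injective {v} {v′} {r} e = Finₚ.toℕ-injective (ℕₚ.+-cancelʳ-≡ (toℕ r) (toℕ v) (toℕ v′)
      (trans (sym (toℕ-add v r)) (trans (cong toℕ e) (toℕ-add v′ r))))

    sub : Fin N → Fin R → Maybe (Fin (suc B))
    sub a r with Finₚ.any? (λ v → add v r Finₚ.≟ a)
    ... | yes (v , _) = just v
    ... | no _        = nothing

    sub-sound : ∀ {a r v} → sub a r ≡ just v → add v r ≡ a
    sub-sound {a} {r} e with Finₚ.any? (λ v → add v r Finₚ.≟ a)
    sub-sound refl | yes (_ , e) = e

    sub-add : ∀ v r → sub (add v r) r ≡ just v
    sub-add v r with Finₚ.any? (λ v′ → add v′ r Finₚ.≟ add v r)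
    ... | yes (v′ , e) = cong just (add-injective e)
    ... | no none      = ⊥-elim (none (v , refl))

    Js : ℕ → Set
    Js zero    = ⊤
    Js (suc d) = (T.J × Fin (suc B)) × Js d

    cons : ∀ {d} → T.J → Maybe (Fin (suc B)) → Maybe (Js d) → Maybe (Js (suc d))
    cons j (just v) (just js) = just ((j , v) , js)
    cons j (just v) nothing   = nothing
    cons j nothing _          = nothing

    loc₁ : ∀ {d} → Maybe (T.J × Fin N) → Fin R → Maybe (Js d) → Maybe (Js (suc d))
    loc₁ (just (j , a)) r js = cons j (sub a r) js
    loc₁ nothing r js        = nothing

    add-order : ∀ v r r′ → r Fin.≤ r′ ⇔ (add v r Fin.≤ add v r′)
    add-order v r r′ = mk⇔ (λ p → subst₂ _≤_ (sym (toℕ-add v r)) (sym (toℕ-add v r′)) (ℕₚ.+-monoʳ-≤ (toℕ v) p))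
                           (λ p → ℕₚ.+-cancelˡ-≤ (toℕ v) _ _ (subst₂ _≤_ (toℕ-add v r) (toℕ-add v r′) p))

    module _ {I : Set} where

      encs : ∀ d → (Fin d → I → Fin R) → Js d → I → Cube.Carrier (C ^C d)
      encs zero π _ p                    = tt
      encs (suc d) π ((j , v) , js) p    = T.enc j (add v (π zero p)) , encs d (π ∘ suc) js p

      locs : ∀ d → (Fin d → I → Fin R) → I → Cube.Carrier (C ^C d) → Maybe (Js d)
      locs zero π p _           = just tt
      locs (suc d) π p (x , xs) = loc₁ (T.loc x) (π zero p) (locs d (π ∘ suc) p xs)

      locs-just : ∀ {d π p x xs j v js} → T.loc x ≡ just (j , add v (π zero p)) → locs d (π ∘ suc) p xs ≡ just js →
                  locs (suc d) π p (x , xs) ≡ just ((j , v) , js)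
      locs-just {d} {π} {p} {j = j} {v} {js} e es = trans (cong₂ (λ m → loc₁ m (π zero p)) e es) (cong (λ m → cons j m (just js)) (sub-add v (π zero p)))

      locs-elim : ∀ {d π p x xs j v js} → locs (suc d) π p (x , xs) ≡ just ((j , v) , js) →
                  T.loc x ≡ just (j , add v (π zero p)) × locs d (π ∘ suc) p xs ≡ just js
      locs-elim {d} {π} {p} {x} {xs} e with T.loc x
      ... | just (j , a) with sub a (π zero p) in eq | locs d (π ∘ suc) p xs
      locs-elim refl | just (j , a) | just v | just js = cong (λ a → just (j , a)) (sym (sub-sound eq)) , refl

      locs-sound : ∀ d π p xs {js} → locs d π p xs ≡ just js → encs d π js p ≡ xs
      locs-sound zero π p tt e = refl
      locs-sound (suc d) π p (x , xs) {(j , v) , js} e =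
        let e₁ , e₂ = locs-elim {d} {π} e in cong₂ _,_ (T.sound e₁) (locs-sound d (π ∘ suc) p xs e₂)

      locs-stay : ∀ d π p xs {js} → locs d π p xs ≡ just js → ∀ q → locs d π q (encs d π js q) ≡ just js
      locs-stay zero π p tt e q = refl
      locs-stay (suc d) π p (x , xs) {(j , v) , js} e q =
        let e₁ , e₂ = locs-elim {d} {π} e in locs-just {π = π} (T.stay e₁ _) (locs-stay d (π ∘ suc) p xs e₂ q)

      locs-order : ∀ d π p xs {js} → locs d π p xs ≡ just js → ∀ q q′ →
                   (∀ i → π i q Fin.≤ π i q′) ⇔ Cube._≤_ (C ^C d) (encs d π js q) (encs d π js q′)
      locs-order zero π p tt e q q′ = mk⇔ (λ _ → tt) (λ _ ())
      locs-order (suc d) π p (x , xs) {(j , v) , js} e q q′ =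
        let e₁ , e₂ = locs-elim {d} {π} e
            o₁ = T.order e₁ (add v (π zero q)) (add v (π zero q′))
            o₂ = locs-order d (π ∘ suc) p xs e₂ q q′
            o₃ = add-order v (π zero q) (π zero q′)
        in mk⇔ (λ r → Equivalence.to o₁ (Equivalence.to o₃ (r zero)) , Equivalence.to o₂ (λ i → r (suc i)))
               (λ { (r , rs) zero → Equivalence.from o₃ (Equivalence.from o₁ r) ; (r , rs) (suc i) → Equivalence.from o₂ rs i })

    Start : C.Carrier → Set
    Start = T.Hits (λ a → toℕ a ≤ B)

    Starts : ∀ d → Cube.Carrier (C ^C d) → Set
    Starts zero _           = ⊤
    Starts (suc d) (x , xs) = Start x × Starts d xs

    module _ {I : Set} where
      starts-located : ∀ d (π : Fin d → I → Fin R) p → (∀ i → π i p ≡ zero) → ∀ xs → Starts d xs → ∃ λ js → locs d π p xs ≡ just js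
      starts-located zero π p z xs _ = tt , refl
      starts-located (suc d) π p z (x , xs) ((j , a , e , a≤) , ss) =
        let js , es = starts-located d (π ∘ suc) p (z ∘ suc) xs ss
        in ((j , v) , js) , locs-just {π = π} (trans e (cong (λ a → just (j , a)) (Finₚ.toℕ-injective eq))) es
        where
        v = fromℕ< (s≤s a≤)
        eq : toℕ a ≡ toℕ (add v (π zero p))
        eq = sym (trans (toℕ-add v (π zero p)) (trans (cong₂ (λ x r → x + toℕ r) (Finₚ.toℕ-fromℕ< (s≤s a≤)) (z zero)) (ℕₚ.+-identityʳ (toℕ a))))

    private
      Late : C.Carrier → Set
      Late = T.Hits (λ a → B < toℕ a)

      -- Only κ₀ + 1 positions are late, against B + 1 starting positions on the same line, so in a
      -- long chain the late points weigh little. The code recovers the late position.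
      late : Spread C Late Start (suc B) (suc κ₀)
      late = record
        { f = λ { x (j , a , e , B<a) i → T.enc j (early i) , over a B<a }
        ; below = λ { x (j , a , e , B<a) i → subst (C._≤_ _) (T.sound e)
            (Equivalence.to (T.order e (early i) a) (ℕₚ.≤-trans (early-≤ i) (ℕₚ.<⇒≤ B<a))) }
        ; target = λ { x (j , a , e , B<a) i → j , early i , T.stay e _ , early-≤ i }
        ; inj = λ { {x} {y} (j , a , e , B<a) (j′ , a′ , e′ , B<a′) {i} {i′} q →
            inj x y j a e B<a j′ a′ e′ B<a′ i i′ q } }
        where
        early : Fin (suc B) → Fin N
        early i = fromℕ< {toℕ i} (ℕₚ.≤-trans (Finₚ.toℕ<n i) (s≤s (ℕₚ.m≤n⇒m≤1+n (ℕₚ.m≤m+n B κ₀))))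
        early-toℕ : ∀ i → toℕ (early i) ≡ toℕ i
        early-toℕ i = Finₚ.toℕ-fromℕ< _
        early-≤ : ∀ i → toℕ (early i) ≤ B
        early-≤ i = subst (_≤ B) (sym (early-toℕ i)) (ℕₚ.≤-pred (Finₚ.toℕ<n i))
        excess : ℕ → ℕ
        excess n = n Data.Nat.∸ suc B
        over< : ∀ (a : Fin N) → B < toℕ a → excess (toℕ a) < suc κ₀
        over< a B<a = s≤s (ℕₚ.≤-trans (ℕₚ.∸-monoˡ-≤ (suc B) (ℕₚ.≤-pred (Finₚ.toℕ<n a))) (ℕₚ.≤-reflexive (ℕₚ.m+n∸m≡n (suc B) κ₀)))
        over : ∀ a → B < toℕ a → Fin (suc κ₀)
        over a B<a = fromℕ< (over< a B<a)
        inj : ∀ x y j a e B<a j′ a′ e′ B<a′ i i′ → (T.enc j (early i) , over a B<a) ≡ (T.enc j′ (early i′) , over a′ B<a′) → x ≡ y × i ≡ i′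
        inj x y j a e B<a j′ a′ e′ B<a′ i i′ q =
          trans (sym (T.sound e)) (trans (cong₂ T.enc (cong proj₁ same) a≡) (T.sound e′)) ,
          Finₚ.toℕ-injective (trans (sym (early-toℕ i)) (trans (cong (toℕ ∘ proj₂) same) (early-toℕ i′)))
          where
          same : (j , early i) ≡ (j′ , early i′)
          same = just-injective (trans (sym (T.stay e (early i))) (trans (cong (T.loc ∘ proj₁) q) (T.stay e′ (early i′))))
          a≡ : a ≡ a′
          a≡ = Finₚ.toℕ-injective (ℕₚ.∸-cancelʳ-≡ B<a B<a′
            (trans (sym (Finₚ.toℕ-fromℕ< (over< a B<a))) (trans (cong (toℕ ∘ proj₂) q) (Finₚ.toℕ-fromℕ< (over< a′ B<a′)))))

    -- Starting, late and uncovered points use separate codes. Codes over labels is 1 + (κ₀ + 1) /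
    -- (B + 1) + c / m, which can be brought close enough to 1 to survive a d-fold product.
    spread : ∀ {m c} → Spread C T.Free Start m c → Spread C (λ _ → ⊤) Start (suc B * m) (suc B * m + (suc κ₀ * m + c * suc B))
    spread {m} {c} s = either cases (stayPut (suc B * m)) (either (λ _ d → d) (late ⨾ stayPut m)
        (relabel (ℕₚ.*-comm m (suc B)) (s ⨾ stayPut (suc B))))
      where
      cases : ∀ x → ⊤ → Start x ⊎ (Late x ⊎ T.Free x)
      cases x _ with T.loc x
      ... | nothing      = inj₂ (inj₂ refl)
      ... | just (j , a) with B Data.Nat.<? toℕ a
      ...   | yes B<a = inj₂ (inj₁ (j , a , refl , B<a))
      ...   | no B≮a  = inj₁ (j , a , refl , ℕₚ.≮⇒≥ B≮a)

    spreads : ∀ {a b} → Spread C (λ _ → ⊤) Start a b → ∀ d → Spread (C ^C d) (λ _ → ⊤) (Starts d) (a ^ d) (b ^ d)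
    spreads s zero    = stayPut 1
    spreads s (suc d) = weaken (λ _ → tt , tt) (λ t → t) ℕₚ.≤-refl (s ⊗ spreads s d)

  module Reset {N : ℕ} (C : Cube) (T : Tiles (Fin._≤_ {suc N}) C) where
    private
      module C = Cube C
      module T = Tiles T

    reset : Spread C (T.Hits (λ _ → ⊤)) (T.Hits (_≡ zero)) 1 (suc N)
    reset = record
      { f = λ { x (j , a , _) _ → T.enc j zero , a }
      ; below = λ { x (j , a , e , _) _ → subst (C._≤_ _) (T.sound e) (Equivalence.to (T.order e zero a) z≤n) }
      ; target = λ { x (j , a , e , _) _ → j , zero , T.stay e zero , refl }
      ; inj = λ { {x} {y} (j , a , e , _) (j′ , a′ , e′ , _) {zero} {zero} q →
          trans (sym (T.sound e)) (trans (cong₂ T.enc (cong proj₁ (just-injective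
            (trans (sym (T.stay e zero)) (trans (cong (T.loc ∘ proj₁) q) (T.stay e′ zero))))) (cong proj₂ q)) (T.sound e′)) , refl } }

    -- Codes over labels is (N + 1) · (1 + c / m): the chain has N + 1 points, all of which are sent
    -- to its bottom.
    spread : ∀ {G m c} → Spread C T.Free (T.Hits G) m c → Spread C (λ _ → ⊤) (T.Hits (_≡ zero)) (1 * m) (suc N * m + c * suc N)
    spread {G} {m} {c} s = either cases (reset ⨾ stayPut m)
        (relabel (ℕₚ.*-comm m 1) (weaken (λ d → d) (λ (j , a , e , _) → j , a , e , tt) ℕₚ.≤-refl s ⨾ reset))
      where
      cases : ∀ x → ⊤ → T.Hits (λ _ → ⊤) x ⊎ T.Free x
      cases x _ with T.loc x
      ... | nothing      = inj₂ refl
      ... | just (j , a) = inj₁ (j , a , refl , tt)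

  -- Copies of the intersection of the linear orders π i: the role is recorded in a chain with exactly
  -- R points, ordered by π 0, and each π i shifts one further chain.
  module Realized (κ₀ B d : ℕ) {I : Set} (π : Fin (suc d) → I → Fin (suc (suc κ₀)))
    (ι : Fin (suc (suc κ₀)) → I) (π-ι : ∀ a → π zero (ι a) ≡ a) (ι-π : ∀ p → ι (π zero p) ≡ p)
    (C₀ : Cube) (T₀ : Tiles (Fin._≤_ {suc (suc κ₀)}) C₀)
    (C : Cube) (T : Tiles (Fin._≤_ {suc (suc (B + κ₀))}) C) where

    open Shift κ₀ B C T hiding (spread)
    private
      module T₀ = Tiles T₀

    infix 4 _≼_
    _≼_ : I → I → Set
    p ≼ q = ∀ i → π i p Fin.≤ π i q

    X : Cube
    X = C₀ ×C (C ^C suc d)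

    private
      J : Set
      J = T₀.J × Js (suc d)

      enc : J → I → Cube.Carrier X
      enc (j , js) p = T₀.enc j (π zero p) , encs (suc d) π js p

      loc₂ : T₀.J → I → Maybe (Js (suc d)) → Maybe (J × I)
      loc₂ j p (just js) = just ((j , js) , p)
      loc₂ j p nothing   = nothing

      loc₀ : Cube.Carrier (C ^C suc d) → Maybe (T₀.J × Fin (suc (suc κ₀))) → Maybe (J × I)
      loc₀ xs (just (j , a)) = loc₂ j (ι a) (locs (suc d) π (ι a) xs)
      loc₀ xs nothing        = nothing

      loc : Cube.Carrier X → Maybe (J × I)
      loc (x , xs) = loc₀ xs (T₀.loc x)

      loc-just : ∀ {x xs j p js} → T₀.loc x ≡ just (j , π zero p) → locs (suc d) π p xs ≡ just js → loc (x , xs) ≡ just ((j , js) , p)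
      loc-just {x} {xs} {j} {p} {js} e es = trans (cong (loc₀ xs) e)
        (trans (cong (λ p → loc₂ j p (locs (suc d) π p xs)) (ι-π p)) (cong (loc₂ j p) es))

      loc₂-elim : ∀ {j j′ p p′ js} m → loc₂ j p m ≡ just ((j′ , js) , p′) → j ≡ j′ × p ≡ p′ × m ≡ just js
      loc₂-elim (just _) refl = refl , refl , refl

      loc₀-elim : ∀ {xs j p js} m → loc₀ xs m ≡ just ((j , js) , p) → m ≡ just (j , π zero p) × locs (suc d) π p xs ≡ just js
      loc₀-elim {xs} (just (j , a)) e with refl , refl , es ← loc₂-elim (locs (suc d) π (ι a) xs) e =
        cong (λ a → just (j , a)) (sym (π-ι a)) , es

      loc-elim : ∀ {x xs j p js} → loc (x , xs) ≡ just ((j , js) , p) → T₀.loc x ≡ just (j , π zero p) × locs (suc d) π p xs ≡ just js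
      loc-elim {x} = loc₀-elim (T₀.loc x)

    tiles : Tiles _≼_ X
    tiles = record
      { J = J ; enc = enc ; loc = loc
      ; sound = λ {(x , xs)} e → let e₁ , e₂ = loc-elim e in cong₂ _,_ (T₀.sound e₁) (locs-sound (suc d) π _ xs e₂)
      ; stay = λ {(x , xs)} e q → let e₁ , e₂ = loc-elim e in loc-just (T₀.stay e₁ (π zero q)) (locs-stay (suc d) π _ xs e₂ q)
      ; order = λ {(x , xs)} e p q → let e₁ , e₂ = loc-elim e ; o₁ = T₀.order e₁ (π zero p) (π zero q) ; o₂ = locs-order (suc d) π _ xs e₂ p q in
          mk⇔ (λ r → Equivalence.to o₁ (r zero) , Equivalence.to o₂ r) (λ (_ , r) → Equivalence.from o₂ r)
      }

    -- All `π i bot` vanish, so the copy whose shifts are the starting positions of a point passes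
    -- through that point in the role `bot`.
    spread : ∀ {bot a₀ b₀ a b} → (∀ i → π i bot ≡ zero) →
             Spread C₀ (λ _ → ⊤) (T₀.Hits (_≡ zero)) a₀ b₀ → Spread C (λ _ → ⊤) Start a b →
             Spread X (λ _ → ⊤) (Tiles.Hits tiles (_≡ bot)) (a₀ * a ^ suc d) (b₀ * b ^ suc d)
    spread {bot} z s₀ s = weaken (λ _ → tt , tt) target ℕₚ.≤-refl (s₀ ⊗ Shift.spreads κ₀ B C T s (suc d))
      where
      target : ∀ {x} → T₀.Hits (_≡ zero) (proj₁ x) × Starts (suc d) (proj₂ x) → Tiles.Hits tiles (_≡ bot) x
      target {x , xs} ((j , a , e , refl) , ss) =
        let js , es = starts-located (suc d) π bot z xs ss
        in (j , js) , bot , loc-just (trans e (cong (λ a → just (j , a)) (sym (z zero)))) es , refl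

-- Retiling reserved copies so that they absorb uncovered points

module Absorbing where

  open Cubes

  -- Points of Y outside all copies come together with a point w of V and all points of S.  If w is
  -- above a copy of the square of _≼_, the |S| points (w , σ , x , k) can be absorbed: in the rows
  -- {c} × (copy × {θ σ}) they replace the tops, and the |S| displaced tops form a copy themselves.
  module Absorption
    {I : Set} (_≟_ : DecidableEquality I) (anyI : ∀ {Q : I → Set} → (∀ i → Dec (Q i)) → Dec (∃ Q))
    (_≼_ : I → I → Set) (≼-refl : ∀ {p} → p ≼ p) (≼-antisym : ∀ {p q} → p ≼ q → q ≼ p → p ≡ q)
    (bot top : I) (≼-top : ∀ p → p ≼ top)
    (V S K Y : Cube)
    (TY : Tiles _≼_ Y) (TR : Tiles _≼_ (V ×C S ×C K))
    (s₀ : Cube.Carrier S) (s₀-least : ∀ σ → Cube._≤_ S s₀ σ)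
    (θ : Cube.Carrier S → I) (θ⁻¹ : I → Cube.Carrier S)
    (θ⁻¹-θ : ∀ σ → θ⁻¹ (θ σ) ≡ σ) (θ-θ⁻¹ : ∀ i → θ (θ⁻¹ i) ≡ i)
    (High : Cube.Carrier V → Set) (high? : ∀ v → Dec (High v))
    (g : Cube.Carrier V → I → I → Cube.Carrier V)
    (g-below : ∀ {w} → High w → ∀ p p′ → Cube._≤_ V (g w p p′) w)
    (g-order : ∀ {w} → High w → ∀ p p′ q q′ → (p ≼ q × p′ ≼ q′) ⇔ Cube._≤_ V (g w p p′) (g w q q′))
    (E : Cube.Carrier Y → Cube.Carrier V → Cube.Carrier Y)
    (E-hits : ∀ {y} → Tiles.Free TY y → ∀ v → ∃ λ j → Tiles.loc TY (E y v) ≡ just (j , bot))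
    (E-below : ∀ {y} → Tiles.Free TY y → ∀ v → Cube._≤_ Y (E y v) y)
    (E-injective : ∀ {y y′ v v′} → Tiles.Free TY y → Tiles.Free TY y′ → E y v ≡ E y′ v′ → y ≡ y′ × v ≡ v′)
    (TR-indep : ∀ {v σ σ′ k} → Tiles.Free TR (v , σ , k) → Tiles.Free TR (v , σ′ , k))
    where

    private
      module V = Cube V
      module S = Cube S
      module K = Cube K
      module Y = Cube Y
      module TY = Tiles TY
      module TR = Tiles TR

      free? : ∀ {A : Set} (m : Maybe A) → Dec (m ≡ nothing)
      free? (just _) = no λ ()
      free? nothing  = yes refl

      -- The copy of Y with bottom `c` is reserved for the uncovered points over `(x , w)`, and
      -- `(p , p′)` are the coordinates of `v` in the square below `w`. Together with the role in
      -- the copy of Y this gives a block P × P × P, to be retiled in the layer σ = s₀.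
      Slot : Y.Carrier → V.Carrier → S.Carrier → K.Carrier → Y.Carrier → V.Carrier → I → I → Set
      Slot c v σ k x w p p′ = TY.Free x × High w × TR.Free (w , s₀ , k) × c ≡ E x w × v ≡ g w p p′ × σ ≡ s₀

      slot? : ∀ c v σ k → Dec (∃ λ x → ∃ λ w → ∃₂ λ p p′ → Slot c v σ k x w p p′)
      slot? c v σ k = search Y λ x → search V λ w → anyI λ p → anyI λ p′ →
        free? (TY.loc x) ×-dec high? w ×-dec free? (TR.loc (w , s₀ , k)) ×-dec (c Y.≟ E x w) ×-dec (v V.≟ g w p p′) ×-dec (σ S.≟ s₀)

      Found : Set
      Found = Y.Carrier × V.Carrier × I × I

      find : Y.Carrier → V.Carrier → S.Carrier → K.Carrier → Maybe Found
      find c v σ k with slot? c v σ k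
      ... | yes (x , w , p , p′ , _) = just (x , w , p , p′)
      ... | no _                     = nothing

      find-sound : ∀ {c v σ k x w p p′} → find c v σ k ≡ just (x , w , p , p′) → Slot c v σ k x w p p′
      find-sound {c} {v} {σ} {k} e with slot? c v σ k
      find-sound refl | yes (_ , _ , _ , _ , sl) = sl

      -- The search could meet other witnesses. `E-injective` fixes `x` and `w`, then `g-order` with
      -- antisymmetry fixes `p` and `p′`, so `loc` does not depend on the order of the search.
      find-complete : ∀ {c v σ k x w p p′} → Slot c v σ k x w p p′ → find c v σ k ≡ just (x , w , p , p′)
      find-complete {c} {v} {σ} {k} {x} {w} {p} {p′} (fx , hw , fr , c≡ , v≡ , σ≡) with slot? c v σ k
      ... | no none = ⊥-elim (none (_ , _ , _ , _ , fx , hw , fr , c≡ , v≡ , σ≡))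
      ... | yes (x₁ , w₁ , p₁ , p₁′ , fx₁ , hw₁ , _ , c≡₁ , v≡₁ , _)
        with refl , refl ← E-injective fx₁ fx (trans (sym c≡₁) c≡) =
        cong₂ (λ p p′ → just (x , w , p , p′))
          (≼-antisym (proj₁ (leq g≡)) (proj₁ (leq (sym g≡)))) (≼-antisym (proj₂ (leq g≡)) (proj₂ (leq (sym g≡))))
        where
        g≡ : g w p₁ p₁′ ≡ g w p p′
        g≡ = trans (sym v≡₁) v≡
        leq : ∀ {a a′ b b′} → g w a a′ ≡ g w b b′ → a ≼ b × a′ ≼ b′
        leq {a} {a′} {b} {b′} e = Equivalence.from (g-order hw a a′ b b′) (subst (V._≤_ _) e V.≤-refl)

      -- Outside the reserved blocks, `column` keeps the copies of Y. In a block, with coordinates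
      -- (p, p′, r), the copies run along p: plainly for r ≠ bot, and with the top exchanged for an
      -- uncovered point for r = bot. The points exchanged have p = top and form the copy
      -- `displaced` along p′. Over uncovered y, `other` keeps the copies of `TR`.
      data J : Set where
        column    : V.Carrier → S.Carrier → TY.J → K.Carrier → J
        row       : V.Carrier → TY.J → I → I → K.Carrier → J
        absorbed  : Y.Carrier → V.Carrier → S.Carrier → K.Carrier → J
        displaced : Y.Carrier → V.Carrier → K.Carrier → J
        other     : Y.Carrier → TR.J → J

      Ω : Cube
      Ω = V ×C S ×C (Y ×C K)
      module Ω = Cube Ω

      topped : ∀ {i} → Ω.Carrier → Ω.Carrier → Dec (i ≡ top) → Ω.Carrier
      topped t b (yes _) = t
      topped t b (no _)  = b

      enc : J → I → Ω.Carrier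
      enc (column v σ j k) i    = v , σ , TY.enc j i , k
      enc (row w j r p′ k) i    = g w i p′ , s₀ , TY.enc j r , k
      enc (absorbed x w σ k) i  = topped (w , σ , x , k) (g w i (θ σ) , s₀ , E x w , k) (i ≟ top)
      enc (displaced x w k) i   = g w top i , s₀ , E x w , k
      enc (other y j) i         = let v , σ , k = TR.enc j i in v , σ , y , k

      locT : ∀ {p} → Found → K.Carrier → Dec (p ≡ top) → Maybe (J × I)
      locT (x , w , p , p′) k (yes _) = just (displaced x w k , p′)
      locT (x , w , p , p′) k (no _)  = just (absorbed x w (θ⁻¹ p′) k , p)

      locB : ∀ {r} → TY.J → K.Carrier → Found → Dec (r ≡ bot) → Maybe (J × I)
      locB {r} j k (x , w , p , p′) (yes _) = locT (x , w , p , p′) k (p ≟ top)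
      locB {r} j k (x , w , p , p′) (no _)  = just (row w j r p′ k , p)

      locS : V.Carrier → S.Carrier → TY.J → I → K.Carrier → Maybe Found → Maybe (J × I)
      locS v σ j r k (just f) = locB j k f (r ≟ bot)
      locS v σ j r k nothing  = just (column v σ j k , r)

      locH : (v : V.Carrier) → S.Carrier → Y.Carrier → K.Carrier → Dec (High v) → Maybe (J × I)
      locH v σ y k (yes _) = just (absorbed y v σ k , top)
      locH v σ y k (no _)  = nothing

      locR : V.Carrier → S.Carrier → Y.Carrier → K.Carrier → Maybe (TR.J × I) → Maybe (J × I)
      locR v σ y k (just (j , i)) = just (other y j , i)
      locR v σ y k nothing        = locH v σ y k (high? v)

      locY : V.Carrier → S.Carrier → Y.Carrier → K.Carrier → Maybe (TY.J × I) → Maybe (J × I)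
      locY v σ y k (just (j , r)) = locS v σ j r k (find (TY.enc j bot) v σ k)
      locY v σ y k nothing        = locR v σ y k (TR.loc (v , σ , k))

      loc : Ω.Carrier → Maybe (J × I)
      loc (v , σ , y , k) = locY v σ y k (TY.loc y)

      data View (v : V.Carrier) (σ : S.Carrier) (y : Y.Carrier) (k : K.Carrier) : J → I → Set where
        is-column    : ∀ {j r} → TY.loc y ≡ just (j , r) → find (TY.enc j bot) v σ k ≡ nothing →
                       View v σ y k (column v σ j k) r
        is-row       : ∀ {j r x w p p′} → TY.loc y ≡ just (j , r) → Slot (TY.enc j bot) v σ k x w p p′ → r ≢ bot →
                       View v σ y k (row w j r p′ k) p
        is-absorbed  : ∀ {j x w p p′} → TY.loc y ≡ just (j , bot) → Slot (TY.enc j bot) v σ k x w p p′ → p ≢ top →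
                       View v σ y k (absorbed x w (θ⁻¹ p′) k) p
        is-displaced : ∀ {j x w p′} → TY.loc y ≡ just (j , bot) → Slot (TY.enc j bot) v σ k x w top p′ →
                       View v σ y k (displaced x w k) p′
        is-other     : ∀ {j i} → TY.Free y → TR.loc (v , σ , k) ≡ just (j , i) → View v σ y k (other y j) i
        is-top       : TY.Free y → TR.Free (v , σ , k) → High v → View v σ y k (absorbed y v σ k) top

      view : ∀ {v σ y k j i} → loc (v , σ , y , k) ≡ just (j , i) → View v σ y k j i
      view {v} {σ} {y} {k} e with TY.loc y in eY
      view {v} {σ} {y} {k} e | just (j , r) with find (TY.enc j bot) v σ k in eF
      view refl | just (j , r) | nothing = is-column eY eF
      view e | just (j , r) | just (x , w , p , p′) with r ≟ bot
      view refl | just (j , r) | just (x , w , p , p′) | no r≢ = is-row eY (find-sound eF) r≢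
      view e | just (j , r) | just (x , w , p , p′) | yes refl with p ≟ top
      view refl | just (j , r) | just (x , w , p , p′) | yes refl | yes refl = is-displaced eY (find-sound eF)
      view refl | just (j , r) | just (x , w , p , p′) | yes refl | no p≢ = is-absorbed eY (find-sound eF) p≢
      view {v} {σ} {y} {k} e | nothing with TR.loc (v , σ , k) in eR
      view refl | nothing | just _ = is-other eY eR
      view {v} e | nothing | nothing with high? v
      view refl | nothing | nothing | yes hv = is-top eY eR hv

      loc-column : ∀ {v σ y k j r} → TY.loc y ≡ just (j , r) → find (TY.enc j bot) v σ k ≡ nothing →
                   loc (v , σ , y , k) ≡ just (column v σ j k , r)
      loc-column {v} {σ} {y} {k} eY eF = trans (cong (locY v σ y k) eY) (cong (locS v σ _ _ k) eF)

      loc-slot : ∀ {v σ y k j r x w p p′} → TY.loc y ≡ just (j , r) → Slot (TY.enc j bot) v σ k x w p p′ →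
                 loc (v , σ , y , k) ≡ locB j k (x , w , p , p′) (r ≟ bot)
      loc-slot {v} {σ} {y} {k} eY sl = trans (cong (locY v σ y k) eY) (cong (locS v σ _ _ k) (find-complete sl))

      loc-row : ∀ {v σ y k j r x w p p′} → TY.loc y ≡ just (j , r) → Slot (TY.enc j bot) v σ k x w p p′ → r ≢ bot →
                loc (v , σ , y , k) ≡ just (row w j r p′ k , p)
      loc-row {r = r} eY sl r≢ with r ≟ bot | loc-slot eY sl
      ... | yes e | _ = ⊥-elim (r≢ e)
      ... | no _  | e = e

      loc-bot : ∀ {v σ y k j x w p p′} → TY.loc y ≡ just (j , bot) → Slot (TY.enc j bot) v σ k x w p p′ →
                loc (v , σ , y , k) ≡ locT (x , w , p , p′) k (p ≟ top)
      loc-bot eY sl with bot ≟ bot | loc-slot eY sl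
      ... | yes _ | e = e
      ... | no ne | _ = ⊥-elim (ne refl)

      loc-absorbed : ∀ {v σ y k j x w p p′} → TY.loc y ≡ just (j , bot) → Slot (TY.enc j bot) v σ k x w p p′ → p ≢ top →
                     loc (v , σ , y , k) ≡ just (absorbed x w (θ⁻¹ p′) k , p)
      loc-absorbed {p = p} eY sl p≢ with p ≟ top | loc-bot eY sl
      ... | yes e | _ = ⊥-elim (p≢ e)
      ... | no _  | e = e

      loc-displaced : ∀ {v σ y k j x w p′} → TY.loc y ≡ just (j , bot) → Slot (TY.enc j bot) v σ k x w top p′ →
                      loc (v , σ , y , k) ≡ just (displaced x w k , p′)
      loc-displaced eY sl with top ≟ top | loc-bot eY sl
      ... | yes _ | e = e
      ... | no ne | _ = ⊥-elim (ne refl)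

      loc-other : ∀ {v σ y k j i} → TY.Free y → TR.loc (v , σ , k) ≡ just (j , i) → loc (v , σ , y , k) ≡ just (other y j , i)
      loc-other {v} {σ} {y} {k} eY eR = trans (cong (locY v σ y k) eY) (cong (locR v σ y k) eR)

      loc-top : ∀ {v σ y k} → TY.Free y → TR.Free (v , σ , k) → High v → loc (v , σ , y , k) ≡ just (absorbed y v σ k , top)
      loc-top {v} {σ} {y} {k} eY eR hv = trans (cong (locY v σ y k) eY) (trans (cong (locR v σ y k) eR) (h (high? v)))
        where
        h : ∀ d → locH v σ y k d ≡ just (absorbed y v σ k , top)
        h (yes _) = refl
        h (no ¬h) = ⊥-elim (¬h hv)

      enc-top : ∀ {x w σ k} → enc (absorbed x w σ k) top ≡ (w , σ , x , k)
      enc-top with top ≟ top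
      ... | yes _ = refl
      ... | no ne = ⊥-elim (ne refl)

      enc-other : ∀ {x w σ k i} → i ≢ top → enc (absorbed x w σ k) i ≡ (g w i (θ σ) , s₀ , E x w , k)
      enc-other {i = i} i≢ with i ≟ top
      ... | yes e = ⊥-elim (i≢ e)
      ... | no _  = refl

      -- A slot tests only that `(w , s₀ , k)` is uncovered, yet it needs a new top for every row.
      -- `TR-indep` makes all |P| points over the various σ uncovered together.
      stay-absorbed : ∀ {x w σ k} → TY.Free x → High w → TR.Free (w , s₀ , k) → ∀ i →
                      loc (enc (absorbed x w σ k) i) ≡ just (absorbed x w σ k , i)
      stay-absorbed {x} {w} {σ} {k} fx hw fr i with i ≟ top
      ... | yes refl = loc-top fx (TR-indep fr) hw
      ... | no i≢ = let j , e = E-hits fx w in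
        trans (loc-absorbed e (fx , hw , fr , TY.sound e , refl , refl) i≢)
              (cong (λ σ → just (absorbed x w σ k , i)) (θ⁻¹-θ σ))

      -- The new top is above its row in each coordinate. It is not below any other point of the
      -- row, for `E x w` is below `x` and differs from it: one is covered and the other is not.
      order-absorbed : ∀ {x w σ k} → TY.Free x → High w → ∀ p q →
                       p ≼ q ⇔ (enc (absorbed x w σ k) p Ω.≤ enc (absorbed x w σ k) q)
      order-absorbed {x} {w} {σ} {k} fx hw p q with p ≟ top | q ≟ top
      ... | yes refl | yes refl = mk⇔ (λ _ → Ω.≤-refl) (λ _ → ≼-refl)
      ... | yes refl | no q≢ = mk⇔ (λ r → ⊥-elim (q≢ (≼-antisym (≼-top q) r))) (λ r → ⊥-elim (clash (Y.≤-antisym (proj₁ (proj₂ (proj₂ r))) (E-below fx w))))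
        where
        clash : x ≢ E x w
        clash e with () ← trans (sym fx) (trans (cong TY.loc e) (proj₂ (E-hits fx w)))
      ... | no p≢ | yes refl = mk⇔ (λ _ → g-below hw p (θ σ) , s₀-least σ , E-below fx w , K.≤-refl) (λ _ → ≼-top p)
      ... | no p≢ | no q≢ = mk⇔ (λ r → Equivalence.to (g-order hw p (θ σ) q (θ σ)) (r , ≼-refl) , S.≤-refl , Y.≤-refl , K.≤-refl)
                                (λ r → proj₁ (Equivalence.from (g-order hw p (θ σ) q (θ σ)) (proj₁ r)))

      sound : ∀ {z j i} → loc z ≡ just (j , i) → enc j i ≡ z
      sound e with view e
      ... | is-column eY _ = cong (λ y → _ , _ , y , _) (TY.sound eY)
      ... | is-row eY (_ , _ , _ , _ , refl , refl) _ = cong (λ y → _ , _ , y , _) (TY.sound eY)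
      ... | is-absorbed {p′ = p′} eY (_ , _ , _ , c≡ , refl , refl) p≢ = trans (enc-other p≢)
            (cong₂ (λ t y → g _ _ t , s₀ , y , _) (θ-θ⁻¹ p′) (trans (sym c≡) (TY.sound eY)))
      ... | is-displaced eY (_ , _ , _ , c≡ , refl , refl) = cong (λ y → _ , _ , y , _) (trans (sym c≡) (TY.sound eY))
      ... | is-other _ eR = cong (λ (v , σ , k) → v , σ , _ , k) (TR.sound eR)
      ... | is-top _ _ _ = enc-top

      stay : ∀ {z j i} → loc z ≡ just (j , i) → ∀ i′ → loc (enc j i′) ≡ just (j , i′)
      stay e i′ with view e
      ... | is-column eY eF = loc-column (TY.stay eY i′) eF
      ... | is-row eY (fx , hw , fr , c≡ , _ , _) r≢ = loc-row (TY.stay eY _) (fx , hw , fr , c≡ , refl , refl) r≢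
      ... | is-absorbed eY (fx , hw , fr , _) p≢ = stay-absorbed fx hw fr i′
      ... | is-displaced eY (fx , hw , fr , _) = let _ , eE = E-hits fx _ in loc-displaced eE (fx , hw , fr , TY.sound eE , refl , refl)
      ... | is-other eY eR = loc-other eY (TR.stay eR i′)
      ... | is-top fx fr hw = stay-absorbed fx hw (TR-indep fr) i′

      order : ∀ {z j i} → loc z ≡ just (j , i) → ∀ p q → p ≼ q ⇔ (enc j p Ω.≤ enc j q)
      order e p q with view e
      ... | is-column eY _ = let o = TY.order eY p q in
            mk⇔ (λ r → V.≤-refl , S.≤-refl , Equivalence.to o r , K.≤-refl) (λ r → Equivalence.from o (proj₁ (proj₂ (proj₂ r))))
      ... | is-row {p′ = p′} eY (_ , hw , _) _ = let o = g-order hw p p′ q p′ in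
            mk⇔ (λ r → Equivalence.to o (r , ≼-refl) , S.≤-refl , Y.≤-refl , K.≤-refl) (λ r → proj₁ (Equivalence.from o (proj₁ r)))
      ... | is-absorbed eY (fx , hw , _) _ = order-absorbed fx hw p q
      ... | is-displaced eY (_ , hw , _) = let o = g-order hw top p top q in
            mk⇔ (λ r → Equivalence.to o (≼-refl , r) , S.≤-refl , Y.≤-refl , K.≤-refl) (λ r → proj₂ (Equivalence.from o (proj₁ r)))
      ... | is-other _ eR = let o = TR.order eR p q in
            mk⇔ (λ r → let a , b , c = Equivalence.to o r in a , b , Y.≤-refl , c)
                (λ (a , b , _ , c) → Equivalence.from o (a , b , c))
      ... | is-top fx _ hw = order-absorbed fx hw p q

    tiles : Tiles _≼_ (V ×C S ×C (Y ×C K))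
    tiles = record { J = J ; enc = enc ; loc = loc ; sound = sound ; stay = stay ; order = order }

    free-elim : ∀ {v σ y k} → Tiles.Free tiles (v , σ , y , k) → TY.Free y × TR.Free (v , σ , k) × ¬ High v
    free-elim {v} {σ} {y} {k} e with TY.loc y
    free-elim {v} {σ} {y} {k} e | just (j , r) with find (TY.enc j bot) v σ k
    free-elim {v} {σ} {y} {k} e | just (j , r) | just (_ , _ , p , _) with r ≟ bot
    free-elim {v} {σ} {y} {k} e | just (j , r) | just (_ , _ , p , _) | yes _ with p ≟ top
    free-elim {v} {σ} {y} {k} () | just (j , r) | just (_ , _ , p , _) | yes _ | yes _
    free-elim {v} {σ} {y} {k} () | just (j , r) | just (_ , _ , p , _) | yes _ | no _
    free-elim {v} {σ} {y} {k} e | nothing with TR.loc (v , σ , k)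
    free-elim {v} {σ} {y} {k} e | nothing | nothing with high? v
    free-elim {v} {σ} {y} {k} e | nothing | nothing | no ¬h = refl , refl , ¬h

    free-intro : ∀ {v σ y k} → TY.Free y → TR.Free (v , σ , k) → ¬ High v → Tiles.Free tiles (v , σ , y , k)
    free-intro {v} {σ} {y} {k} eY eR ¬h = trans (cong (locY v σ y k) eY) (trans (cong (locR v σ y k) eR) (h (high? v)))
      where
      h : ∀ d → locH v σ y k d ≡ nothing
      h (yes hv) = ⊥-elim (¬h hv)
      h (no _)   = refl

-- A reserved copy for every uncovered point and bit vector

module Storage where

  open import Data.Nat using (_≤_)
  open Cubes
  open Hall

  record Store {I : Set} {_≼_ : I → I → Set} {C : Cube} (T : Tiles _≼_ C) (bot : I) (m : ℕ) : Set where
    field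
      E           : Cube.Carrier C → Vec Bool m → Cube.Carrier C
      E-hits      : ∀ {y} → Tiles.Free T y → ∀ v → ∃ λ j → Tiles.loc T (E y v) ≡ just (j , bot)
      E-below     : ∀ {y} → Tiles.Free T y → ∀ v → Cube._≤_ C (E y v) y
      E-injective : ∀ {y y′ v v′} → Tiles.Free T y → Tiles.Free T y′ → E y v ≡ E y′ v′ → y ≡ y′ × v ≡ v′

  module OneBit {I : Set} {_≼_ : I → I → Set} {C : Cube} (T : Tiles _≼_ C) (bot : I) {a b : ℕ}
    (2b≤a : 2 * suc b ≤ a) (s : Spread C (Tiles.Free T) (Tiles.Hits T (_≡ bot)) a (suc b)) where
    private
      module C = Cube C
      module T = Tiles T
      module S = Spread s

      Q : Cube
      Q = C ×C vecC 1

      Z : Set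
      Z = Cube.Carrier Q ⊎ C.Carrier

      _≟Z_ : DecidableEquality Z
      _≟Z_ = Sumₚ.≡-dec (Cube._≟_ Q) C._≟_

      label : Vec Bool 1 → Fin (suc b) → Fin a
      label (β ∷ []) i = inject≤ (combine (bitIndex β) i) 2b≤a

      label-injective : ∀ {v v′ i i′} → label v i ≡ label v′ i′ → v ≡ v′ × i ≡ i′
      label-injective {β ∷ []} {β′ ∷ []} {i} {i′} e =
        let e₁ , e₂ = Finₚ.combine-injective (bitIndex β) i (bitIndex β′) i′ (Finₚ.inject≤-injective 2b≤a 2b≤a _ _ e)
        in cong (_∷ []) (bits β β′ e₁) , e₂
        where
        bits : ∀ β β′ → bitIndex β ≡ bitIndex β′ → β ≡ β′
        bits false false _ = refl
        bits true true _   = refl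

      -- The matching is taken over all points. Covered ones need no bottom and are matched to
      -- themselves in a separate summand of `Z`; an uncovered one has enough labels to give each
      -- value of the bit its own b + 1.
      choose : (y : C.Carrier) → Vec Bool 1 → (m : Maybe (T.J × I)) → T.loc y ≡ m → Fin (suc b) → Z × Fin (suc b)
      choose y v nothing e i  = let z , c = S.f y e (label v i) in inj₂ z , c
      choose y v (just _) _ i = inj₁ (y , v) , i

      choose-injective : ∀ {y y′ v v′ i i′} m m′ e e′ → choose y v m e i ≡ choose y′ v′ m′ e′ i′ → (y , v) ≡ (y′ , v′) × i ≡ i′
      choose-injective nothing nothing e e′ q =
        let e₁ , e₂ = S.inj e e′ (cong₂ _,_ (Sumₚ.inj₂-injective (cong proj₁ q)) (cong proj₂ q)) ; e₃ , e₄ = label-injective e₂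
        in cong₂ _,_ e₁ e₃ , e₄
      choose-injective nothing (just _) e e′ q with () ← cong proj₁ q
      choose-injective (just _) nothing e e′ q with () ← cong proj₁ q
      choose-injective (just _) (just _) e e′ q = Sumₚ.inj₁-injective (cong proj₁ q) , cong proj₂ q

      Φ : Fin (points Q) → Fin (suc b) → Z × Fin (suc b)
      Φ n = let y , v = decode Q n in choose y v (T.loc y) refl

      Φ-injective : ∀ {m n i i′} → Φ m i ≡ Φ n i′ → m ≡ n × i ≡ i′
      Φ-injective {m} {n} e = let e₁ , e₂ = choose-injective (T.loc (proj₁ (decode Q m))) (T.loc (proj₁ (decode Q n))) refl refl e in
        trans (sym (code-decode Q m)) (trans (cong (code Q) e₁) (code-decode Q n)) , e₂

      module M = Matching (cancel _≟Z_ (points Q) b Φ Φ-injective)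

      value : Z → C.Carrier
      value (inj₁ (y , _)) = y
      value (inj₂ z)       = z

      E : C.Carrier → Vec Bool 1 → C.Carrier
      E y v = value (M.match (code Q (y , v)))

      chosen : ∀ {y} → T.Free y → ∀ v → ∃₂ λ f i → M.match (code Q (y , v)) ≡ inj₂ (proj₁ (S.f y f i))
      chosen {y} free v = let i , e = M.option (code Q (y , v)) in
        go (T.loc (proj₁ (decode Q (code Q (y , v))))) refl i e
        where
        y′ = proj₁ (decode Q (code Q (y , v)))
        v′ = proj₂ (decode Q (code Q (y , v)))
        y≡ : y′ ≡ y
        y≡ = cong proj₁ (decode-code Q (y , v))
        retag : ∀ {y′} → y′ ≡ y → (f : T.Free y′) → ∀ i {z} → inj₂ (proj₁ (S.f y′ f i)) ≡ z →
                ∃₂ λ f i → z ≡ inj₂ (proj₁ (S.f y f i))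
        retag refl f i e = f , i , sym e
        go : ∀ m (e : T.loc y′ ≡ m) i → proj₁ (choose y′ v′ m e i) ≡ M.match (code Q (y , v)) →
             ∃₂ λ f i → M.match (code Q (y , v)) ≡ inj₂ (proj₁ (S.f y f i))
        go nothing f i e  = retag y≡ f (label v′ i) e
        go (just _) e _ _ with () ← trans (sym e) (trans (cong T.loc y≡) free)

    oneBit : Store T bot 1
    oneBit = record
      { E = E
      ; E-hits = λ {y} free v → let f , i , e = chosen free v ; j , r , e′ , r≡ = S.target y f i in
          j , trans (cong (T.loc ∘ value) e) (trans e′ (cong (λ r → just (j , r)) r≡))
      ; E-below = λ {y} free v → let f , i , e = chosen free v in subst (C._≤ y) (sym (cong value e)) (S.below y f i)
      ; E-injective = λ {y} {y′} {v} {v′} free free′ e →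
          let f , i , q = chosen free v ; f′ , i′ , q′ = chosen free′ v′
              m≡ = M.injective (trans q (trans (cong inj₂ (trans (sym (cong value q)) (trans e (cong value q′)))) (sym q′)))
              yv≡ = trans (sym (decode-code Q (y , v))) (trans (cong (decode Q) m≡) (decode-code Q (y′ , v′)))
          in cong proj₁ yv≡ , cong proj₂ yv≡
      }

  module _ {I : Set} {_≼_ : I → I → Set} {C : Cube} (T : Tiles _≼_ C) (bot : I) (st : Store T bot 1) where
    private
      module T = Tiles T
      open Store st

      -- Each coordinate stores one bit, which is possible because all coordinates of an uncovered
      -- point of the power are uncovered. The copy reached is the one through the first coordinate,
      -- which has priority.
      Es : ∀ m → Cube.Carrier (C ^C m) → Vec Bool m → Cube.Carrier (C ^C m)
      Es zero _ _                = tt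
      Es (suc m) (y , ys) (b ∷ v) = E y (b ∷ []) , Es m ys v

      Es-below : ∀ m {ys} → Tiles.Free (powT T m) ys → ∀ v → Cube._≤_ (C ^C m) (Es m ys v) ys
      Es-below zero _ _ = tt
      Es-below (suc m) free (b ∷ v) = let f , fs = First.loc-free T (powT T m) free in E-below f (b ∷ []) , Es-below m fs v

      Es-injective : ∀ m {ys zs v w} → Tiles.Free (powT T m) ys → Tiles.Free (powT T m) zs → Es m ys v ≡ Es m zs w → ys ≡ zs × v ≡ w
      Es-injective zero {v = []} {[]} _ _ _ = refl , refl
      Es-injective (suc m) {y , ys} {z , zs} {b ∷ v} {c ∷ w} free free′ e =
        let f , fs = First.loc-free T (powT T m) free ; f′ , fs′ = First.loc-free T (powT T m) free′
            e₁ , e₂ = E-injective {v = b ∷ []} {c ∷ []} f f′ (cong proj₁ e) ; e₃ , e₄ = Es-injective m fs fs′ (cong proj₂ e)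
        in cong₂ _,_ e₁ e₃ , cong₂ _∷_ (Vecₚ.∷-injectiveˡ e₂) e₄

    manyBits : ∀ m → Store (powT T (suc m)) bot (suc m)
    manyBits m = record
      { E = Es (suc m)
      ; E-hits = λ { {y , ys} free (b ∷ v) → let f , fs = First.loc-free T (powT T m) free ; j , e = E-hits f (b ∷ []) in
          _ , First.loc-inj₁ T (powT T m) e }
      ; E-below = Es-below (suc m)
      ; E-injective = Es-injective (suc m)
      }

-- Choice of the parameters and the estimate of the dimension

module Sizes where

  open import Data.Nat using (_≤_; NonZero; pred)
  open Cubes
  open Cells
  open Chains
  open Storage

  -- (1 - δ / β)^k ≥ 1 - k δ / β, multiplied by β^(k + 1).
  bernoulli : ∀ α δ k → let β = α + δ in β ^ k * β ≤ α ^ k * β + k * δ * β ^ k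
  bernoulli α δ zero = ℕₚ.m≤m+n _ _
  bernoulli α δ (suc k) = begin
    β * b * β                                    ≡⟨ ℕₚ.*-assoc β b β ⟩
    β * (b * β)                                  ≤⟨ ℕₚ.*-monoʳ-≤ β (bernoulli α δ k) ⟩
    β * (a * β + k * δ * b)                      ≡⟨ arith₁ α δ k a b ⟩
    (α * a + δ * a) * β + k * δ * (β * b)        ≤⟨ ℕₚ.+-monoˡ-≤ _ (ℕₚ.*-monoˡ-≤ β (ℕₚ.+-monoʳ-≤ (α * a) (ℕₚ.*-monoʳ-≤ δ (ℕₚ.^-monoˡ-≤ k (ℕₚ.m≤m+n α δ))))) ⟩
    (α * a + δ * b) * β + k * δ * (β * b)        ≡⟨ arith₂ α δ k a b ⟩
    α * a * β + suc k * δ * (β * b)              ∎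
    where
    open ℕₚ.≤-Reasoning
    β = α + δ
    a = α ^ k
    b = β ^ k
    arith₁ : ∀ α δ k a b → (α + δ) * (a * (α + δ) + k * δ * b) ≡ (α * a + δ * a) * (α + δ) + k * δ * ((α + δ) * b)
    arith₁ = solve-∀
    arith₂ : ∀ α δ k a b → (α * a + δ * b) * (α + δ) + k * δ * ((α + δ) * b) ≡ α * a * (α + δ) + suc k * δ * ((α + δ) * b)
    arith₂ = solve-∀

  power-≤ : ∀ α δ k → 2 * k * δ ≤ α + δ → (α + δ) ^ k ≤ 2 * α ^ k
  power-≤ α δ k small with α + δ in eq
  ... | zero rewrite ℕₚ.m+n≡0⇒m≡0 α eq = ℕₚ.m≤m+n _ _
  ... | suc β = ℕₚ.*-cancelʳ-≤ _ _ (suc β) (ℕₚ.+-cancelʳ-≤ (suc β ^ k * suc β) _ _ (begin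
    b * suc β + b * suc β                     ≡⟨ arith₁ b (suc β) ⟩
    2 * (b * suc β)                           ≤⟨ ℕₚ.*-monoʳ-≤ 2 (subst (λ β → β ^ k * β ≤ α ^ k * β + k * δ * β ^ k) eq (bernoulli α δ k)) ⟩
    2 * (α ^ k * suc β + k * δ * b)           ≡⟨ arith₂ (α ^ k) (suc β) k δ b ⟩
    2 * α ^ k * suc β + 2 * k * δ * b         ≤⟨ ℕₚ.+-monoʳ-≤ (2 * α ^ k * suc β) (ℕₚ.*-monoˡ-≤ b small) ⟩
    2 * α ^ k * suc β + suc β * b             ≡⟨ cong (2 * α ^ k * suc β +_) (ℕₚ.*-comm (suc β) b) ⟩
    2 * α ^ k * suc β + b * suc β             ∎))
    where
    open ℕₚ.≤-Reasoning
    b = suc β ^ k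
    arith₁ : ∀ b β → b * β + b * β ≡ 2 * (b * β)
    arith₁ = solve-∀
    arith₂ : ∀ a β k δ b → 2 * (a * β + k * δ * b) ≡ 2 * a * β + 2 * k * δ * b
    arith₂ = solve-∀

  -- Words of length 16 Λ², where Λ = κ + 1, are long enough: by Bernoulli's inequality, clearing Λ of
  -- their letters has about as many preimages as images.
  module CellSize (κ : ℕ) where
    Λ len α : ℕ
    Λ   = suc κ
    len = 16 * (Λ * Λ)
    -- This is len / 2 - 2 Λ, and β below is len / 2 + 2 Λ.
    α   = Λ * (8 * κ + 6)

    u : ℕ
    u = 1 * α ^ Λ

    open Lines κ len public using (T; Low)

    private
      β = α + 4 * Λ

      cell-≥ : α + α + 3 * κ + 2 ≤ len
      cell-≥ = ℕₚ.≤-trans (ℕₚ.m≤m+n _ (κ + 2)) (ℕₚ.≤-reflexive (arith κ))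
        where
        arith : ∀ κ → suc κ * (8 * κ + 6) + suc κ * (8 * κ + 6) + 3 * κ + 2 + (κ + 2) ≡ 16 * (suc κ * suc κ)
        arith = solve-∀

      cell-≤ : len + 3 * κ + 2 ≤ β + β
      cell-≤ = ℕₚ.≤-trans (ℕₚ.m≤m+n _ (κ + 2)) (ℕₚ.≤-reflexive (arith κ))
        where
        arith : ∀ κ → 16 * (suc κ * suc κ) + 3 * κ + 2 + (κ + 2) ≡
                      (suc κ * (8 * κ + 6) + 4 * suc κ) + (suc κ * (8 * κ + 6) + 4 * suc κ)
        arith = solve-∀

      small : 2 * Λ * (4 * Λ) ≤ α + 4 * Λ
      small = ℕₚ.≤-trans (ℕₚ.m≤m+n _ (2 * Λ)) (ℕₚ.≤-reflexive (arith κ))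
        where
        arith : ∀ κ → 2 * suc κ * (4 * suc κ) + 2 * suc κ ≡ suc κ * (8 * κ + 6) + 4 * suc κ
        arith = solve-∀

    -- The factor 4 consists of 2 for the parity lost by halving and 2 for the clearings.
    reach : Spread (vecC len) (Tiles.Free T) (Tiles.Hits T Low) u (4 * u)
    reach = weaken (λ d → d) (λ t → t) bound (Lines.reach κ len α β cell-≥ cell-≤)
      where
      open ℕₚ.≤-Reasoning
      arith : ∀ x → 2 * (2 * x) ≡ 4 * (1 * x)
      arith = solve-∀
      bound : 2 * β ^ Λ ≤ 4 * u
      bound = begin
        2 * β ^ Λ        ≤⟨ ℕₚ.*-monoʳ-≤ 2 (power-≤ α (4 * Λ) Λ small) ⟩
        2 * (2 * α ^ Λ)  ≡⟨ arith (α ^ Λ) ⟩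
        4 * u            ∎

    α≢0 : NonZero α
    α≢0 = ℕₚ.m*n≢0 Λ (8 * κ + 6) {{_}} {{subst NonZero (sym (ℕₚ.+-suc (8 * κ) 5)) _}}

    u≢0 : NonZero u
    u≢0 = ℕₚ.m*n≢0 1 (α ^ Λ) {{_}} {{ℕₚ.m^n≢0 α Λ {{α≢0}}}}

  -- The dimension is suc d and the number of elements is s = κ₀ + 2.
  module Construction (κ₀ d : ℕ) {I : Set} (π : Fin (suc d) → I → Fin (suc (suc κ₀)))
    (ι : Fin (suc (suc κ₀)) → I) (π-ι : ∀ a → π zero (ι a) ≡ a) (ι-π : ∀ p → ι (π zero p) ≡ p)
    (bot : I) (π-bot : ∀ i → π i bot ≡ zero)
    (s D B M g w : ℕ) (s≡ : s ≡ suc (suc κ₀)) (D≡ : D ≡ suc d)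
    (B≡ : B ≡ 4 * D * s) (M≡ : M ≡ 16 * D) (g≡ : g ≡ 20 * s) (w≡ : suc w ≡ 4 * s) where

    private
      module C₀ = CellSize κ₀
      module C₁ = CellSize (B + κ₀)

      block : Cube
      block = vecC C₁.len ^C M

      blockT : Tiles (Fin._≤_ {suc (suc (B + κ₀))}) block
      blockT = powT C₁.T M

      m A δ b : ℕ
      m = M * C₁.u
      A = suc B * m
      δ = suc κ₀ * m + 4 * C₁.u * suc B
      b = A + δ

      module Sh = Shift κ₀ B block blockT

      low⇒early : ∀ {a : Fin (suc (suc (B + κ₀)))} → toℕ a ≤ ⌊ B + κ₀ /2⌋ → toℕ a ≤ B
      low⇒early {a} a≤ = ℕₚ.≤-trans a≤ (begin
        ⌊ B + κ₀ /2⌋   ≤⟨ ℕₚ.⌊n/2⌋-mono (ℕₚ.+-monoʳ-≤ B κ₀≤B) ⟩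
        ⌊ B + B /2⌋    ≡⟨ ℕₚ.n≡⌊n+n/2⌋ B ⟨
        B              ∎)
        where
        open ℕₚ.≤-Reasoning
        κ₀≤B : κ₀ ≤ B
        κ₀≤B rewrite B≡ | D≡ | s≡ = ℕₚ.≤-trans (ℕₚ.m≤n+m κ₀ 2) (ℕₚ.m≤n*m (suc (suc κ₀)) (4 * suc d))

      blockSpread : Spread block (λ _ → ⊤) Sh.Start A b
      blockSpread = Sh.spread (weaken (λ e → e) (λ (j , a , e , a≤) → j , a , e , low⇒early a≤) ℕₚ.≤-refl
        (pow-spread C₁.T C₁.Low C₁.reach M))

      -- δ / A = (κ₀ + 1) / (B + 1) + 4 / M. The choices B = 4 D s and M = 16 D make each term at
      -- most 1 / (4 D), so D factors lose at most 2 by `power-≤`.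
      δ-small : 2 * suc d * δ ≤ A + δ
      δ-small = ℕₚ.≤-trans (halve (begin
          2 * suc d * δ + 2 * suc d * δ                            ≡⟨ arith (suc d) (suc κ₀) m C₁.u (suc B) ⟩
          4 * suc d * suc κ₀ * m + suc B * (16 * suc d * C₁.u)     ≡⟨ cong (λ M → 4 * suc d * suc κ₀ * m + suc B * (M * C₁.u)) (trans M≡ (cong (16 *_) D≡)) ⟨
          4 * suc d * suc κ₀ * m + A                               ≤⟨ ℕₚ.+-monoˡ-≤ A (ℕₚ.*-monoˡ-≤ m 4dκ≤B) ⟩
          A + A                                                    ∎)) (ℕₚ.m≤m+n A δ)
        where
        open ℕₚ.≤-Reasoning
        halve : ∀ {m n} → m + m ≤ n + n → m ≤ n
        halve {m} {n} p = ℕₚ.≮⇒≥ λ n<m → ℕₚ.<⇒≱ (ℕₚ.+-mono-< n<m n<m) p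
        arith : ∀ D κ m u B → 2 * D * (κ * m + 4 * u * B) + 2 * D * (κ * m + 4 * u * B) ≡ 4 * D * κ * m + B * (16 * D * u)
        arith = solve-∀
        4dκ≤B : 4 * suc d * suc κ₀ ≤ suc B
        4dκ≤B rewrite B≡ | D≡ | s≡ = ℕₚ.m≤n⇒m≤1+n (ℕₚ.*-monoʳ-≤ (4 * suc d) (ℕₚ.n≤1+n (suc κ₀)))

      module R = Realized κ₀ B d π ι π-ι ι-π (vecC C₀.len) C₀.T block blockT

      a b′ : ℕ
      a = C₀.u * A ^ suc d
      b′ = 10 * s * a

      -- The 10 is 5 · 2: codes over labels is s · (1 + 4) for the chain that records the role and
      -- at most 2 for the blocks.
      xSpread : Spread R.X (λ _ → ⊤) (Tiles.Hits R.tiles (_≡ bot)) a b′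
      xSpread = relabel (cong (_* A ^ suc d) (ℕₚ.*-identityˡ C₀.u)) (weaken (λ d → d) (λ t → t) bound
        (R.spread π-bot (Reset.spread (vecC C₀.len) C₀.T C₀.reach) blockSpread))
        where
        open ℕₚ.≤-Reasoning
        arith : ∀ s u a → (s * u + 4 * u * s) * (2 * a) ≡ 10 * s * (u * a)
        arith = solve-∀
        bound : (suc (suc κ₀) * C₀.u + 4 * C₀.u * suc (suc κ₀)) * b ^ suc d ≤ b′
        bound = begin
          (suc (suc κ₀) * C₀.u + 4 * C₀.u * suc (suc κ₀)) * b ^ suc d        ≤⟨ ℕₚ.*-monoʳ-≤ (suc (suc κ₀) * C₀.u + 4 * C₀.u * suc (suc κ₀)) (power-≤ A δ (suc d) δ-small) ⟩
          (suc (suc κ₀) * C₀.u + 4 * C₀.u * suc (suc κ₀)) * (2 * A ^ suc d)  ≡⟨ arith (suc (suc κ₀)) C₀.u (A ^ suc d) ⟩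
          10 * suc (suc κ₀) * a                    ≡⟨ cong (λ s → 10 * s * a) s≡ ⟨
          b′                                       ∎

      b′≢0 : NonZero b′
      b′≢0 = ℕₚ.m*n≢0 (10 * s) a {{ℕₚ.m*n≢0 10 s {{_}} {{subst NonZero (sym s≡) _}}}} {{ℕₚ.m*n≢0 C₀.u (A ^ suc d) {{C₀.u≢0}}
               {{ℕₚ.m^n≢0 A (suc d) {{ℕₚ.m*n≢0 (suc B) m {{_}} {{ℕₚ.m*n≢0 M C₁.u
                 {{subst NonZero (sym (trans M≡ (cong (16 *_) D≡))) _}} {{C₁.u≢0}}}}}}}}}}

    open R public using (_≼_)

    Y₁ Y : Cube
    Y₁ = R.X ^C g
    Y  = Y₁ ^C suc w

    private
      T₁ : Tiles _≼_ Y₁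
      T₁ = powT R.tiles g

      suc-pred-b′ : b′ ≡ suc (pred b′)
      suc-pred-b′ = sym (ℕₚ.suc-pred b′ {{b′≢0}})

      y₁Spread : Spread Y₁ (Tiles.Free T₁) (Tiles.Hits T₁ (_≡ bot)) (g * a) (suc (pred b′))
      y₁Spread = subst (Spread Y₁ (Tiles.Free T₁) (Tiles.Hits T₁ (_≡ bot)) (g * a)) suc-pred-b′
        (pow-spread R.tiles (_≡ bot) (weaken (λ _ → tt) (λ t → t) ℕₚ.≤-refl xSpread) g)

      -- 20 s coordinates bring the ratio from 1 / (10 s) to 2, one set of labels for each value of
      -- a bit.
      room : 2 * suc (pred b′) ≤ g * a
      room = ℕₚ.≤-reflexive (trans (cong (2 *_) (sym suc-pred-b′)) (trans (arith s a) (cong (_* a) (sym g≡))))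
        where
        arith : ∀ s a → 2 * (10 * s * a) ≡ 20 * s * a
        arith = solve-∀

    tiles : Tiles _≼_ Y
    tiles = powT T₁ (suc w)

    store : Store tiles bot (suc w)
    store = manyBits T₁ bot (OneBit.oneBit T₁ bot room y₁Spread) w

    -- The length is 4 s stored bits, times 20 s coordinates for each, times the chain of roles plus
    -- D blocks of 16 D words of length at most 16 · (5 D s)². This yields D⁴ s⁴.
    dim-Y : ∀ c → 16 + 16 * (16 * 25) ≤ c → Cube.dim Y ≤ 80 * c * (D ^ 4 * s ^ 4)
    dim-Y c c≥ = begin
      Cube.dim Y                                         ≡⟨ dim-^C Y₁ (suc w) ⟩
      suc w * Cube.dim Y₁                                ≡⟨ cong₂ _*_ w≡ (dim-^C R.X g) ⟩
      4 * s * (g * Cube.dim R.X)                         ≡⟨ cong₂ (λ g n → 4 * s * (g * (C₀.len + n))) g≡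
                                                              (trans (dim-^C block (suc d)) (cong₂ _*_ (sym D≡) (dim-^C (vecC C₁.len) M))) ⟩
      4 * s * (20 * s * (C₀.len + D * (M * C₁.len)))     ≤⟨ ℕₚ.*-monoʳ-≤ (4 * s) (ℕₚ.*-monoʳ-≤ (20 * s) (begin
          C₀.len + D * (M * C₁.len)       ≤⟨ ℕₚ.+-mono-≤ len₀ lenM ⟩
          16 * t + 16 * (16 * (25 * t))   ≡⟨ collect 16 25 t ⟩
          (16 + 16 * (16 * 25)) * t       ≤⟨ ℕₚ.*-monoˡ-≤ t c≥ ⟩
          c * t                           ∎)) ⟩
      4 * s * (20 * s * (c * t))                         ≡⟨ regroup c s (D ^ 4) ⟩
      80 * c * (D ^ 4 * s ^ 4)                           ∎
      where
      open ℕₚ.≤-Reasoning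
      t = D ^ 4 * s ^ 2
      collect : ∀ a e t → a * t + a * (a * (e * t)) ≡ (a + a * (a * e)) * t
      collect = solve-∀
      regroup : ∀ c s x → 4 * s * (20 * s * (c * (x * (s * (s * 1))))) ≡ 80 * c * (x * (s * (s * (s * (s * 1)))))
      regroup = solve-∀
      D≢0 : NonZero D
      D≢0 = subst NonZero (sym D≡) _
      κ₀≤s : suc κ₀ ≤ s
      κ₀≤s = subst (suc κ₀ ≤_) (sym s≡) (ℕₚ.n≤1+n (suc κ₀))
      Λ≤ : suc (B + κ₀) ≤ 5 * (D * s)
      Λ≤ = begin
        suc (B + κ₀)            ≡⟨ ℕₚ.+-suc B κ₀ ⟨
        B + suc κ₀              ≤⟨ ℕₚ.+-monoʳ-≤ B (ℕₚ.≤-trans κ₀≤s (ℕₚ.m≤n*m s D {{D≢0}})) ⟩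
        B + D * s               ≡⟨ cong (_+ D * s) B≡ ⟩
        4 * D * s + D * s       ≡⟨ five D s ⟩
        5 * (D * s)             ∎
        where
        five : ∀ D s → 4 * D * s + D * s ≡ 5 * (D * s)
        five = solve-∀
      lenM : D * (M * C₁.len) ≤ 16 * (16 * (25 * t))
      lenM = begin
        D * (M * C₁.len)                                           ≤⟨ ℕₚ.*-monoʳ-≤ D (ℕₚ.*-monoʳ-≤ M (ℕₚ.*-monoʳ-≤ 16 (ℕₚ.*-mono-≤ Λ≤ Λ≤))) ⟩
        D * (M * (16 * (5 * (D * s) * (5 * (D * s)))))             ≡⟨ cong (λ M → D * (M * (16 * (5 * (D * s) * (5 * (D * s)))))) M≡ ⟩
        D * (16 * D * (16 * (5 * (D * s) * (5 * (D * s)))))        ≡⟨ reorder 16 D s ⟩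
        16 * (16 * (25 * t))                                       ∎
        where
        reorder : ∀ a D s → D * (a * D * (a * (5 * (D * s) * (5 * (D * s))))) ≡ a * (a * (25 * (D * (D * (D * (D * 1))) * (s * (s * 1)))))
        reorder = solve-∀
      len₀ : C₀.len ≤ 16 * t
      len₀ = ℕₚ.*-monoʳ-≤ 16 (begin
        suc κ₀ * suc κ₀   ≤⟨ ℕₚ.*-mono-≤ κ₀≤s κ₀≤s ⟩
        s * s             ≡⟨ cong (s *_) (ℕₚ.*-identityʳ s) ⟨
        s ^ 2             ≤⟨ ℕₚ.m≤n*m (s ^ 2) (D ^ 4) {{ℕₚ.m^n≢0 D 4 {{D≢0}}}} ⟩
        D ^ 4 * s ^ 2     ∎)

-- From a total tiling to a partition of the power set

open import Defs
open import Data.Nat using (_≤_; _<_)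
open import Data.Fin using (opposite)
open import Data.Fin.Subset using (Subset; _⊆_)
open import Data.Vec using (tabulate; replicate; here; there)
open import Data.Vec.Relation.Binary.Pointwise.Inductive using ([]; _∷_)
open import Data.Product using (Σ)
open import Relation.Binary.Structures using (IsPartialOrder)
open Cubes
open Absorbing
open Storage
open Sizes

private
  _⇔∘_ : ∀ {A B C : Set} → A ⇔ B → B ⇔ C → A ⇔ C
  f ⇔∘ g = mk⇔ (Equivalence.to g ∘ Equivalence.to f) (Equivalence.from f ∘ Equivalence.from g)

⊑⇒⊆ : ∀ {n} {v w : Vec Bool n} → v ⊑ w → v ⊆ w
⊑⇒⊆ (Bool.b≤b ∷ p) here      = here
⊑⇒⊆ (_ ∷ p) (there x)        = there (⊑⇒⊆ p x)

⊆⇒⊑ : ∀ {n} {v w : Vec Bool n} → v ⊆ w → v ⊑ w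
⊆⇒⊑ {v = []} {[]} _ = []
⊆⇒⊑ {v = a ∷ v} {b ∷ w} p = head a b p ∷ ⊆⇒⊑ (λ x → tail (p (there x)))
  where
  tail : ∀ {x} → (b ∷ w) Data.Vec.[ suc x ]= true → w Data.Vec.[ x ]= true
  tail (there x) = x
  head : ∀ a b → ((a ∷ v) ⊆ (b ∷ w)) → a Bool.≤ b
  head false false _ = Bool.b≤b
  head false true  _ = Bool.f≤t
  head true true   _ = Bool.b≤b
  head true false  p with () ← p here

⊑⇔⊆ : ∀ {n} (v w : Vec Bool n) → v ⊑ w ⇔ (v ⊆ w)
⊑⇔⊆ v w = mk⇔ (λ p {x} → ⊑⇒⊆ p {x}) (λ r → ⊆⇒⊑ {v = v} {w} (λ {x} → r {x}))

enumerate : ∀ m {Q : Fin m → Set} → (∀ i → Dec (Q i)) → ∃ λ t → Σ (Fin t → Fin m) λ e →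
            (∀ {i j} → e i ≡ e j → i ≡ j) × (∀ i → Q (e i)) × (∀ x → Q x → ∃ λ i → e i ≡ x)
enumerate zero Q? = 0 , (λ ()) , (λ { {()} }) , (λ ()) , (λ ())
enumerate (suc m) Q? with enumerate m (λ i → Q? (suc i)) | Q? zero
... | t , e , inj , ok , all | no ¬q =
  t , suc ∘ e , inj ∘ Finₚ.suc-injective , ok , λ { zero q → ⊥-elim (¬q q) ; (suc x) q → let i , ex = all x q in i , cong suc ex }
... | t , e , inj , ok , all | yes q =
  suc t , (λ { zero → zero ; (suc i) → suc (e i) }) ,
  (λ { {zero} {zero} _ → refl ; {suc i} {suc j} x → cong suc (inj (Finₚ.suc-injective x)) }) ,
  (λ { zero → q ; (suc i) → ok i }) ,
  λ { zero _ → zero , refl ; (suc x) q → let i , ex = all x q in suc i , cong suc ex }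

module _ (P : FinPoset) (C : Cube) {_⊴_ : Fin (size P) → Fin (size P) → Set} (T : Tiles _⊴_ C)
  (same : ∀ p q → _≼_ P p q ⇔ (p ⊴ q)) (bot : Fin (size P)) (total : ∀ x → ¬ Tiles.Free T x) where
  private
    module C = Cube C
    module T = Tiles T

    find : ∀ x → ∃₂ λ j i → T.loc x ≡ just (j , i)
    find x with T.loc x in eq
    ... | just (j , i) = j , i , refl
    ... | nothing      = ⊥-elim (total x eq)

    -- Copies are enumerated by their points of role `bot`. The type `J` cannot index them, since it
    -- may have members that belong to no point.
    Bottom : Fin (points C) → Set
    Bottom n = ∃ λ j → T.loc (decode C n) ≡ just (j , bot)

    bottom? : ∀ n → Dec (Bottom n)
    bottom? n with find (decode C n)
    ... | j , i , e with i Finₚ.≟ bot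
    ...   | yes refl = yes (j , e)
    ...   | no i≢    = no λ (j′ , e′) → i≢ (cong proj₂ (just-injective (trans (sym e) e′)))

    Bottoms = enumerate (points C) bottom?

  partition : PartitionIntoCopies P C.dim
  partition with Bottoms
  ... | t , e , e-inj , ok , all = t , copy , is-copy , disjoint , cover
    where
    j : Fin t → T.J
    j i = proj₁ (ok i)
    copy : Fin t → Fin (size P) → Subset C.dim
    copy i p = C.to (T.enc (j i) p)
    at : ∀ i p → T.loc (T.enc (j i) p) ≡ just (j i , p)
    at i p = T.stay (proj₂ (ok i)) p
    same-place : ∀ {i i′ p q} → copy i p ≡ copy i′ q → (j i , p) ≡ (j i′ , q)
    same-place {i} {i′} {p} {q} x = just-injective (trans (sym (at i p)) (trans (cong T.loc (C.to-injective x)) (at i′ q)))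
    is-copy : ∀ i → IsCopy P C.dim (copy i)
    is-copy i = (λ {p} {q} x → cong proj₂ (same-place {i} {i} {p} {q} x)) ,
      λ p q → (same p q ⇔∘ T.order (proj₂ (ok i)) p q) ⇔∘
               (mk⇔ C.to-mono C.to-cancel ⇔∘ ⊑⇔⊆ (copy i p) (copy i q))
    disjoint : ∀ i i′ p q → copy i p ≡ copy i′ q → i ≡ i′ × p ≡ q
    disjoint i i′ p q x = e-inj (trans (sym (code-decode C (e i))) (trans (cong (code C) root) (code-decode C (e i′)))) ,
        cong proj₂ (same-place x)
      where
      root : decode C (e i) ≡ decode C (e i′)
      root = trans (sym (T.sound (proj₂ (ok i)))) (trans (cong (λ j → T.enc j bot) (cong proj₁ (same-place x))) (T.sound (proj₂ (ok i′))))
    cover : ∀ S → ∃ λ i → ∃ λ p → copy i p ≡ S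
    cover S =
      let jx , p , ex = find (C.from S)
          y = T.enc jx bot
          i , ei = all (code C y) (jx , trans (cong T.loc (decode-code C y)) (T.stay ex bot))
          j≡ : j i ≡ jx
          j≡ = cong proj₁ (just-injective (trans (sym (proj₂ (ok i))) (trans (cong (T.loc ∘ decode C) ei)
                 (trans (cong T.loc (decode-code C y)) (T.stay ex bot)))))
      in i , p , trans (cong C.to (trans (cong (λ j → T.enc j p) j≡) (T.sound ex))) (C.to-from S)

-- The square of P below a word with many ones

count : ∀ {n} → Vec Bool n → ℕ
count []          = 0
count (true ∷ v)  = suc (count v)
count (false ∷ v) = count v

count-complement : ∀ {n} (v : Vec Bool n) → count v + count (complement v) ≡ n
count-complement []          = refl
count-complement (true ∷ v)  = cong suc (count-complement v)
count-complement (false ∷ v) = trans (ℕₚ.+-suc (count v) _) (cong suc (count-complement v))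

-- The ones of `w` are the places where `u` is written, padded with false. All subsets of an m-set
-- embed below `w` in this way once `w` has m ones.
under : ∀ {n m} → Vec Bool n → Vec Bool m → Vec Bool n
under [] u                = []
under (false ∷ w) u       = false ∷ under w u
under (true ∷ w) []       = false ∷ under w []
under (true ∷ w) (b ∷ u)  = b ∷ under w u

under-below : ∀ {n m} (w : Vec Bool n) (u : Vec Bool m) → under w u ⊑ w
under-below [] u               = []
under-below (false ∷ w) u      = Bool.b≤b ∷ under-below w u
under-below (true ∷ w) []      = Bool.f≤t ∷ under-below w []
under-below (true ∷ w) (false ∷ u) = Bool.f≤t ∷ under-below w u
under-below (true ∷ w) (true ∷ u)  = Bool.b≤b ∷ under-below w u

under-mono : ∀ {n m} (w : Vec Bool n) {u u′ : Vec Bool m} → u ⊑ u′ → under w u ⊑ under w u′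
under-mono [] p                 = []
under-mono (false ∷ w) p        = Bool.b≤b ∷ under-mono w p
under-mono (true ∷ w) []        = Bool.b≤b ∷ under-mono w []
under-mono (true ∷ w) (b≤ ∷ p)  = b≤ ∷ under-mono w p

under-cancel : ∀ {n m} (w : Vec Bool n) {u u′ : Vec Bool m} → m ≤ count w → under w u ⊑ under w u′ → u ⊑ u′
under-cancel w {[]} {[]} _ _ = []
under-cancel (false ∷ w) {_ ∷ _} {_ ∷ _} m≤ (_ ∷ p) = under-cancel w m≤ p
under-cancel (true ∷ w) {_ ∷ _} {_ ∷ _} (s≤s m≤) (b≤ ∷ p) = b≤ ∷ under-cancel w m≤ p

module Squares {s : ℕ} (_⊴_ : Fin s → Fin s → Set) (_⊴?_ : ∀ p q → Dec (p ⊴ q))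
  (⊴-refl : ∀ {p} → p ⊴ p) (⊴-trans : ∀ {p q r} → p ⊴ q → q ⊴ r → p ⊴ r) where

  -- Characteristic vector of the principal ideal, the standard embedding of P into the subsets of
  -- P.
  ideal : Fin s → Vec Bool s
  ideal p = tabulate (λ x → does (x ⊴? p))

  ideal-order : ∀ p q → p ⊴ q ⇔ (ideal p ⊑ ideal q)
  ideal-order p q = mk⇔ (λ r → PW.tabulate⁺ (λ x → grow x r)) (λ r → member (PW.tabulate⁻ r p))
    where
    grow : ∀ x → p ⊴ q → does (x ⊴? p) Bool.≤ does (x ⊴? q)
    grow x r with x ⊴? p | x ⊴? q
    ... | yes _ | yes _  = Bool.b≤b
    ... | yes l | no ¬l  = ⊥-elim (¬l (⊴-trans l r))
    ... | no _  | yes _  = Bool.f≤t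
    ... | no _  | no _   = Bool.b≤b
    member : does (p ⊴? p) Bool.≤ does (p ⊴? q) → p ⊴ q
    member r with p ⊴? p | p ⊴? q
    ... | no ¬l | _     = ⊥-elim (¬l ⊴-refl)
    ... | yes _ | yes l = l
    member () | yes _ | no _

  bits : Fin s → Fin s → Vec Bool (s + s)
  bits p p′ = ideal p ++ ideal p′

  bits-order : ∀ p p′ q q′ → (p ⊴ q × p′ ⊴ q′) ⇔ (bits p p′ ⊑ bits q q′)
  bits-order p p′ q q′ = mk⇔
    (λ (r , r′) → PW.++⁺ (Equivalence.to (ideal-order p q) r) (Equivalence.to (ideal-order p′ q′) r′))
    (λ r → Equivalence.from (ideal-order p q) (PW.++ˡ⁻ (ideal p) (ideal q) r) ,
           Equivalence.from (ideal-order p′ q′) (PW.++ʳ⁻ (ideal p) (ideal q) r))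

  square-below : ∀ {n} (w : Vec Bool n) → s + s ≤ count w → ∀ p p′ q q′ →
                 (p ⊴ q × p′ ⊴ q′) ⇔ (under w (bits p p′) ⊑ under w (bits q q′))
  square-below w h p p′ q q′ = bits-order p p′ q q′ ⇔∘ mk⇔ (under-mono w) (under-cancel w h)

opposite-anti : ∀ {n} {i j : Fin n} → i Fin.≤ j → opposite j Fin.≤ opposite i
opposite-anti {n} {i} {j} i≤j = subst₂ _≤_ (sym (Finₚ.opposite-prop j)) (sym (Finₚ.opposite-prop i)) (ℕₚ.∸-monoʳ-≤ n (s≤s i≤j))

opposite-cancel : ∀ {n} {i j : Fin n} → opposite j Fin.≤ opposite i → i Fin.≤ j
opposite-cancel {n} {i} {j} p = subst₂ Fin._≤_ (Finₚ.opposite-involutive i) (Finₚ.opposite-involutive j) (opposite-anti p)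

-- The absorption and its dual combined

module Assembly (κ₀ d : ℕ) (π : Fin (suc d) → Fin (suc (suc κ₀)) → Fin (suc (suc κ₀)))
  (ι : Fin (suc (suc κ₀)) → Fin (suc (suc κ₀))) (π-ι : ∀ a → π zero (ι a) ≡ a) (ι-π : ∀ p → ι (π zero p) ≡ p)
  (bot top : Fin (suc (suc κ₀))) (π-bot : ∀ i → π i bot ≡ zero) (π-top : ∀ i → opposite (π i top) ≡ zero)
  (k : ℕ) (2^k≡ : 2 ^ k ≡ suc (suc κ₀))
  (s D B M g w : ℕ) (s≡ : s ≡ suc (suc κ₀)) (D≡ : D ≡ suc d)
  (B≡ : B ≡ 4 * D * s) (M≡ : M ≡ 16 * D) (g≡ : g ≡ 20 * s) (w≡ : suc w ≡ 4 * s) where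

  private
    P = Fin (suc (suc κ₀))

    π′ : Fin (suc d) → P → P
    π′ i p = opposite (π i p)

    module Down = Construction κ₀ d π ι π-ι ι-π bot π-bot s D B M g w s≡ D≡ B≡ M≡ g≡ w≡
    module Up = Construction κ₀ d π′ (ι ∘ opposite)
      (λ a → trans (cong opposite (π-ι (opposite a))) (Finₚ.opposite-involutive a))
      (λ p → trans (cong ι (Finₚ.opposite-involutive (π zero p))) (ι-π p))
      top π-top s D B M g w s≡ D≡ B≡ M≡ g≡ w≡

  infix 4 _⊴_ _⊴′_
  _⊴_ _⊴′_ : P → P → Set
  p ⊴ q = ∀ i → π i p Fin.≤ π i q
  p ⊴′ q = ∀ i → π′ i p Fin.≤ π′ i q

  dual : ∀ p q → p ⊴ q ⇔ (q ⊴′ p)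
  dual p q = mk⇔ (λ r i → opposite-anti (r i)) (λ r i → opposite-cancel (r i))

  private
    antisym : ∀ {p q} → p ⊴ q → q ⊴ p → p ≡ q
    antisym {p} {q} r r′ = trans (sym (ι-π p)) (trans (cong ι (Finₚ.≤-antisym (r zero) (r′ zero))) (ι-π q))

    antisym′ : ∀ {p q} → p ⊴′ q → q ⊴′ p → p ≡ q
    antisym′ {p} {q} r r′ = antisym (Equivalence.from (dual p q) r′) (Equivalence.from (dual q p) r)

    module Sq = Squares _⊴_ (λ p q → Finₚ.all? λ i → π i p Finₚ.≤? π i q) (λ i → ℕₚ.≤-refl) (λ r r′ i → ℕₚ.≤-trans (r i) (r′ i))
    module Sq′ = Squares _⊴′_ (λ p q → Finₚ.all? λ i → π′ i p Finₚ.≤? π′ i q) (λ i → ℕₚ.≤-refl) (λ r r′ i → ℕₚ.≤-trans (r i) (r′ i))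

    ⊴′-bot : ∀ p → p ⊴′ bot
    ⊴′-bot p = Equivalence.to (dual bot p) (λ i → subst (Fin._≤ π i p) (sym (π-bot i)) z≤n)

    ⊴-top : ∀ p → p ⊴ top
    ⊴-top p = Equivalence.from (dual p top) (λ i → subst (Fin._≤ π′ i p) (sym (π-top i)) z≤n)

    -- The identification of the values of σ with the rows p′ of a reserved block; it is a bijection
    -- because |P| is a power of two.
    θ : Vec Bool k → P
    θ σ = Fin.cast 2^k≡ (rank σ)

    θ⁻¹ : P → Vec Bool k
    θ⁻¹ p = unrank (Fin.cast (sym 2^k≡) p)

    θ⁻¹-θ : ∀ σ → θ⁻¹ (θ σ) ≡ σ
    θ⁻¹-θ σ = trans (cong unrank (Finₚ.cast-involutive (sym 2^k≡) 2^k≡ (rank σ))) (unrank-rank σ)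

    θ-θ⁻¹ : ∀ p → θ (θ⁻¹ p) ≡ p
    θ-θ⁻¹ p = trans (cong (Fin.cast 2^k≡) (rank-unrank {k} (Fin.cast (sym 2^k≡) p))) (Finₚ.cast-involutive 2^k≡ (sym 2^k≡) p)

    falses-least : ∀ {n} (v : Vec Bool n) → replicate n false ⊑ v
    falses-least []          = []
    falses-least (false ∷ v) = Bool.b≤b ∷ falses-least v
    falses-least (true ∷ v)  = Bool.f≤t ∷ falses-least v

    trues-greatest : ∀ {n} (v : Vec Bool n) → v ⊑ replicate n true
    trues-greatest []          = []
    trues-greatest (false ∷ v) = Bool.f≤t ∷ trues-greatest v
    trues-greatest (true ∷ v)  = Bool.b≤b ∷ trues-greatest v

    V S : Cube
    V = vecC (suc w)
    S = vecC k

    s+s : ℕ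
    s+s = suc (suc κ₀) + suc (suc κ₀)

  module _ (e : ℕ) where
    private
      module DownE = Store Down.store
      module UpE = Store Up.store

      module Lower = Absorption Finₚ._≟_ Finₚ.any? _⊴_ (λ i → ℕₚ.≤-refl) antisym bot top ⊴-top
        V S (vecC e) Down.Y Down.tiles emptyT (replicate k false) falses-least θ θ⁻¹ θ⁻¹-θ θ-θ⁻¹
        (λ v → s+s ≤ count v) (λ v → s+s Data.Nat.≤? count v)
        (λ v p p′ → under v (Sq.bits p p′)) (λ {v} _ p p′ → under-below v (Sq.bits p p′))
        (λ {v} h → Sq.square-below v h)
        DownE.E DownE.E-hits DownE.E-below DownE.E-injective (λ _ → refl)

      K : Cube
      K = Down.Y ×C vecC e

      -- The tiling of `Lower` seen upside down. `opT` would give the opposite of a product and the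
      -- relation `flip _⊴_`, whereas `Upper` takes a product of opposite cubes and `_⊴′_`.
      lower′ : Tiles _⊴′_ (opC V ×C opC S ×C opC K)
      lower′ = record
        { J = J ; enc = enc ; loc = loc ; sound = sound ; stay = stay
        ; order = λ e p q → mk⇔ (λ r → Equivalence.to (order e q p) (Equivalence.from (dual q p) r))
                                (λ r → Equivalence.to (dual q p) (Equivalence.from (order e q p) r)) }
        where open Tiles Lower.tiles

      square-above : ∀ {v : Vec Bool (suc w)} → s+s ≤ count (complement v) → ∀ p p′ q q′ →
        (p ⊴′ q × p′ ⊴′ q′) ⇔ (complement (under (complement v) (Sq′.bits q q′)) ⊑ complement (under (complement v) (Sq′.bits p p′)))
      square-above {v} h p p′ q q′ = Sq′.square-below (complement v) h p p′ q q′ ⇔∘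
        mk⇔ complement-anti (λ r → subst₂ _⊑_ (complement-involutive _) (complement-involutive _) (complement-anti r))

      -- The lower stage starts from the empty tiling, so what it leaves uncovered is decided by `v`
      -- and the coordinate in `Down.Y` alone.
      lower′-indep : ∀ {v σ σ′ k} → Tiles.Free lower′ (v , σ , k) → Tiles.Free lower′ (v , σ′ , k)
      lower′-indep free = let f , r , l = Lower.free-elim free in Lower.free-intro f r l

      -- P and the cube are both reversed: `High` now counts zeros of `v`, and the result of the
      -- lower stage enters as `TR`. `Up.Y` is taken as it is, since its tiles are built from the
      -- reversed orders.
      module Upper = Absorption Finₚ._≟_ Finₚ.any? _⊴′_ (λ i → ℕₚ.≤-refl) antisym′ top bot ⊴′-bot
        (opC V) (opC S) (opC K) Up.Y Up.tiles lower′ (replicate k true) trues-greatest θ θ⁻¹ θ⁻¹-θ θ-θ⁻¹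
        (λ v → s+s ≤ count (complement v)) (λ v → s+s Data.Nat.≤? count (complement v))
        (λ v p p′ → complement (under (complement v) (Sq′.bits p p′)))
        (λ {v} _ p p′ → subst (_⊑ complement (under (complement v) (Sq′.bits p p′))) (complement-involutive v)
                          (complement-anti (under-below (complement v) (Sq′.bits p p′))))
        square-above
        UpE.E UpE.E-hits UpE.E-below UpE.E-injective
        lower′-indep

    Ω : Cube
    Ω = opC (opC V ×C opC S ×C (Up.Y ×C opC K))

    tiling : Tiles (flip _⊴′_) Ω
    tiling = opT Upper.tiles

    -- An uncovered point would have fewer than 2 s ones and fewer than 2 s zeros among the 4 s
    -- letters of `v`.
    tiling-total : ∀ x → ¬ Tiles.Free tiling x
    tiling-total (v , _) free =
      let _ , free′ , ¬h′ = Upper.free-elim free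
          _ , _ , ¬h = Lower.free-elim free′
      in ℕₚ.<-irrefl (count-complement v) (subst (count v + count (complement v) <_)
           (sym (trans w≡ (trans (cong (4 *_) s≡) (four (suc (suc κ₀))))))
           (ℕₚ.+-mono-< (ℕₚ.≰⇒> ¬h) (ℕₚ.≰⇒> ¬h′)))
      where
      four : ∀ s → 4 * s ≡ (s + s) + (s + s)
      four = solve-∀

    dim-Ω : Cube.dim Ω ≡ suc w + (k + Cube.dim Up.Y + Cube.dim Down.Y) + e
    dim-Ω = arith (suc w) k (Cube.dim Up.Y) (Cube.dim Down.Y) e
      where
      arith : ∀ w k u l e → w + (k + (u + (l + e))) ≡ w + (k + u + l) + e
      arith = solve-∀

  dims : ℕ
  dims = suc w + (k + Cube.dim Up.Y + Cube.dim Down.Y)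

  dims-≤ : ∀ c → 16 + 16 * (16 * 25) ≤ c → k ≤ s → dims ≤ (5 + 160 * c) * (D ^ 4 * s ^ 4)
  dims-≤ c c≥ k≤s = begin
    suc w + (k + Cube.dim Up.Y + Cube.dim Down.Y)      ≤⟨ ℕₚ.+-mono-≤ (ℕₚ.≤-trans (ℕₚ.≤-reflexive w≡) (ℕₚ.*-monoʳ-≤ 4 s≤t))
                                                             (ℕₚ.+-mono-≤ (ℕₚ.+-mono-≤ (ℕₚ.≤-trans k≤s s≤t) (Up.dim-Y c c≥)) (Down.dim-Y c c≥)) ⟩
    4 * t + (t + 80 * c * t + 80 * c * t)              ≡⟨ arith c t ⟩
    (5 + 160 * c) * t                                  ∎
    where
    open ℕₚ.≤-Reasoning
    t = D ^ 4 * s ^ 4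
    arith : ∀ c t → 4 * t + (t + 80 * c * t + 80 * c * t) ≡ (5 + 160 * c) * t
    arith = solve-∀
    s≤t : s ≤ t
    s≤t rewrite D≡ | s≡ = ℕₚ.≤-trans (ℕₚ.m≤m*n S′ (S′ ^ 3) {{ℕₚ.m^n≢0 S′ 3}}) (ℕₚ.m≤n*m (S′ ^ 4) (suc d ^ 4) {{ℕₚ.m^n≢0 (suc d) 4}})
      where S′ = suc (suc κ₀)

  module _ (_≼′_ : P → P → Set) (po : IsPartialOrder _≡_ _≼′_) (iff : ∀ p q → (p ≼′ q) ⇔ (p ⊴ q)) where
    private
      poset : FinPoset
      poset = record { size = suc (suc κ₀) ; _≼_ = _≼′_ ; isPO = po }

    partition-realized : ∀ c n → 16 + 16 * (16 * 25) ≤ c → k ≤ s → (5 + 160 * c) * (D ^ 4 * s ^ 4) ≤ n → PartitionIntoCopies poset n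
    partition-realized c n c≥ k≤s n≥ = subst (PartitionIntoCopies poset) dim≡n
        (partition poset (Ω e) (tiling e) (λ p q → iff p q ⇔∘ dual p q) bot (tiling-total e))
      where
      e : ℕ
      -- The dimensions left over form a factor that is carried along unchanged.
      e = n ∸ dims
      dim≡n : Cube.dim (Ω e) ≡ n
      dim≡n = trans (dim-Ω e) (ℕₚ.m+[n∸m]≡n (ℕₚ.≤-trans (dims-≤ c c≥ k≤s) n≥))

-- The theorem for all sizes of P

n≤2^n : ∀ n → n ≤ 2 ^ n
n≤2^n zero    = z≤n
n≤2^n (suc n) = ℕₚ.+-mono-≤ (ℕₚ.m^n>0 2 n) (ℕₚ.≤-trans (n≤2^n n) (ℕₚ.m≤m+n _ 0))

module _ (κ₀ : ℕ) (_≼′_ : Fin (suc (suc κ₀)) → Fin (suc (suc κ₀)) → Set) (po : IsPartialOrder _≡_ _≼′_) where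
  private
    P : FinPoset
    P = record { size = suc (suc κ₀) ; _≼_ = _≼′_ ; isPO = po }

  partition-large : ∀ c → 16 + 16 * (16 * 25) ≤ c → ∀ k d n → HasMinimum P → HasMaximum P → suc (suc κ₀) ≡ 2 ^ k →
                    Realizer P d → (5 + 160 * c) * d ^ 4 * suc (suc κ₀) ^ 4 ≤ n → PartitionIntoCopies P n
  -- An empty realizer relates two distinct elements in both directions, so the dimension is
  -- positive.
  partition-large c c≥ k zero n _ _ _ (π , _ , iff) _
    with () ← IsPartialOrder.antisym po (Equivalence.from (iff zero (suc zero)) (λ ())) (Equivalence.from (iff (suc zero) zero) (λ ()))
  partition-large c c≥ k (suc d) n (bot , bot≼) (top , ≼top) eq (π , bij , iff) n≥ =
    Assembly.partition-realized κ₀ d π (inverse zero) (π-inverse zero) (λ p → proj₁ (bij zero) (π-inverse zero (π zero p)))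
      bot top π-bot π-top k (sym eq) s (suc d) (4 * suc d * s) (16 * suc d) (20 * s) (3 + 4 * suc κ₀) refl refl refl refl refl
      (sym (ℕₚ.*-suc 4 (suc κ₀))) _≼′_ po iff c n c≥ (subst (k ≤_) (sym eq) (n≤2^n k))
      (ℕₚ.≤-trans (ℕₚ.≤-reflexive (sym (ℕₚ.*-assoc (5 + 160 * c) (suc d ^ 4) (s ^ 4)))) n≥)
    where
    s = suc (suc κ₀)
    module _ (i : Fin (suc d)) where
      inverse : Fin s → Fin s
      inverse a = proj₁ (proj₂ (bij i) a)
      π-inverse : ∀ a → π i (inverse a) ≡ a
      π-inverse a = proj₂ (proj₂ (bij i) a) refl
    π-bot : ∀ i → π i bot ≡ zero
    π-bot i = Finₚ.toℕ-injective (ℕₚ.n≤0⇒n≡0 (subst (π i bot Fin.≤_) (π-inverse i zero) (Equivalence.to (iff bot (inverse i zero)) (bot≼ _) i)))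
    π-top : ∀ i → opposite (π i top) ≡ zero
    π-top i = Finₚ.toℕ-injective (ℕₚ.n≤0⇒n≡0 (subst (opposite (π i top) Fin.≤_) (trans (cong opposite (π-inverse i (opposite zero))) (Finₚ.opposite-involutive {s} zero))
      (opposite-anti (Equivalence.to (iff (inverse i (opposite zero)) top) (≼top _) i))))

partition-singleton : ∀ (_≼′_ : Fin 1 → Fin 1 → Set) (po : IsPartialOrder _≡_ _≼′_) n →
                      PartitionIntoCopies (record { size = 1 ; _≼_ = _≼′_ ; isPO = po }) n
partition-singleton _≼′_ po n = 2 ^ n , (λ i _ → unrank {n} i) ,
  (λ i → (λ { {zero} {zero} _ → refl }) , λ { zero zero → mk⇔ (λ _ {x} m → m) (λ _ → IsPartialOrder.reflexive po refl) }) ,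
  (λ { i j zero zero x → trans (sym (rank-unrank {n} i)) (trans (cong rank x) (rank-unrank {n} j)) , refl }) ,
  λ S → rank S , zero , unrank-rank S

theorem3 : ∃ λ (c : ℕ) → ∀ (P : FinPoset) (k d n : ℕ) →
    HasMinimum P → HasMaximum P → size P ≡ 2 ^ k → HasDimension P d →
    c * d ^ 4 * size P ^ 4 ≤ n → PartitionIntoCopies P n
-- 6416 = 16 + 16 · 16 · 25 bounds the inner sum in `dim-Y`. The 160 is 80 for each of the two
-- sides, and 5 = 4 + 1 accounts for `v` and σ.
theorem3 = 5 + 160 * 6416 , cases
  where
  cases : ∀ (P : FinPoset) (k d n : ℕ) → HasMinimum P → HasMaximum P → size P ≡ 2 ^ k → HasDimension P d →
          (5 + 160 * 6416) * d ^ 4 * size P ^ 4 ≤ n → PartitionIntoCopies P n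
  cases record { size = zero } k d n (() , _)
  cases record { size = suc zero ; _≼_ = _≼′_ ; isPO = po } k d n _ _ _ _ _ = partition-singleton _≼′_ po n
  cases record { size = suc (suc κ₀) ; _≼_ = _≼′_ ; isPO = po } k d n low high eq (realizer , _) =
    partition-large κ₀ _≼′_ po 6416 ℕₚ.≤-refl k d n low high eq realizer
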